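{- For every real $\theta>1$, the set $\mathcal A_\theta$ has density $0$, i.e. $\lim_{N\to\infty}\frac{|\mathcal A_\theta\cap[1,N]|}{N}=0$.
   Context: $\lfloor x\rfloor$ is the floor of $x$; $\log$ is the natural logarithm. For real $\theta>1$ and positive integer $n$, $M'_\theta(n)=\left\lfloor 1/(\theta^{1/n}-1)\right\rfloor$, and $\mathcal A_\theta=\{n\in\mathbb N: M'_\theta(n)\neq \lfloor n/\log\theta-1/2\rfloor\}$, where $\mathbb N$ is the set of positive integers. -}

module Defs where

open import Algebra.Bundles.Raw using (RawSemiring)
import Algebra.Definitions.RawSemiring as RawSemiringDefinitions
open import Axiom.ExcludedMiddle using (ExcludedMiddle)
open import Data.Empty using (⊥-elim)
open import Data.Fin.Base using (toℕ)
open import Data.Integer.Base as ℤ using (ℤ; 0ℤ; 1ℤ; +_)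
open import Data.List.Base using (applyUpTo; filter; length)
open import Data.Nat.Base as ℕ using (ℕ; suc; _!)
import Data.Nat.Properties as ℕ
open import Data.Product using (∃; _×_; _,_)
open import Data.Rational.Base as ℚ using (ℚ; 0ℚ; 1ℚ; ½)
import Data.Rational.Properties as ℚ
open import Data.Rational.Solver using (module +-*-Solver)
open import Level using (0ℓ)
open import Relation.Binary.PropositionalEquality
  using (_≡_; _≢_; refl; sym; cong; cong₂; subst)
open import Relation.Nullary using (¬_; yes; no)
open import Relation.Unary using (Pred)

-- Real numbers: Cauchy sequences of rationals, with equality _≈_.

IsCauchy : (ℕ → ℚ) → Set
IsCauchy s = ∀ ε → 0ℚ ℚ.< ε →
  ∃ λ N → ∀ m n → N ℕ.≤ m → N ℕ.≤ n → ℚ.∣ s m ℚ.- s n ∣ ℚ.< ε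

record ℝ : Set where
  constructor mkℝ
  field
    seq    : ℕ → ℚ
    cauchy : IsCauchy seq

open ℝ public

infix 4 _≈_ _<_ _≤_

_≈_ : ℝ → ℝ → Set
x ≈ y = ∀ ε → 0ℚ ℚ.< ε →
  ∃ λ N → ∀ n → N ℕ.≤ n → ℚ.∣ seq x n ℚ.- seq y n ∣ ℚ.< ε

-- The gap ε must be uniform in n: termwise strict inequality alone would
-- allow two equal reals to satisfy x < y.
_<_ : ℝ → ℝ → Set
x < y = ∃ λ ε → 0ℚ ℚ.< ε ×
  ∃ λ N → ∀ n → N ℕ.≤ n → seq x n ℚ.+ ε ℚ.≤ seq y n

_≤_ : ℝ → ℝ → Set
x ≤ y = ¬ (y < x)

fromℚ : ℚ → ℝ
fromℚ q = mkℝ (λ _ → q) λ ε 0<ε → 0 , λ _ _ _ _ →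
  subst (ℚ._< ε) (sym (cong ℚ.∣_∣ (ℚ.+-inverseʳ q))) 0<ε

fromℤ : ℤ → ℝ
fromℤ k = fromℚ (k ℚ./ 1)

0ℝ 1ℝ ½ℝ : ℝ
0ℝ = fromℚ 0ℚ
1ℝ = fromℚ 1ℚ
½ℝ = fromℚ ½

open +-*-Solver using (solve; _:+_; _:*_; _:-_; :-_; _:=_)

½*-pos : ∀ {ε} → 0ℚ ℚ.< ε → 0ℚ ℚ.< ½ ℚ.* ε
½*-pos {ε} 0<ε = subst (ℚ._< ½ ℚ.* ε) (ℚ.*-zeroʳ ½) (ℚ.*-monoʳ-<-pos ½ 0<ε)

halves : ∀ ε → ½ ℚ.* ε ℚ.+ ½ ℚ.* ε ≡ ε
halves ε = begin-equality
  ½ ℚ.* ε ℚ.+ ½ ℚ.* ε ≡⟨ sym (ℚ.*-distribʳ-+ ε ½ ½) ⟩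
  1ℚ ℚ.* ε            ≡⟨ ℚ.*-identityˡ ε ⟩
  ε                   ∎
  where open ℚ.≤-Reasoning

+-cauchy : ∀ {s t} → IsCauchy s → IsCauchy t → IsCauchy λ n → s n ℚ.+ t n
+-cauchy {s} {t} cs ct ε 0<ε
  with cs (½ ℚ.* ε) (½*-pos 0<ε) | ct (½ ℚ.* ε) (½*-pos 0<ε)
... | M , hM | N , hN = M ℕ.⊔ N , λ m n m≥ n≥ → begin-strict
  ℚ.∣ (s m ℚ.+ t m) ℚ.- (s n ℚ.+ t n) ∣
    ≡⟨ cong ℚ.∣_∣ (solve 4 (λ a b c d →
         (a :+ b) :- (c :+ d) := (a :- c) :+ (b :- d)) refl (s m) (t m) (s n) (t n)) ⟩
  ℚ.∣ (s m ℚ.- s n) ℚ.+ (t m ℚ.- t n) ∣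
    ≤⟨ ℚ.∣p+q∣≤∣p∣+∣q∣ (s m ℚ.- s n) (t m ℚ.- t n) ⟩
  ℚ.∣ s m ℚ.- s n ∣ ℚ.+ ℚ.∣ t m ℚ.- t n ∣
    <⟨ ℚ.+-mono-< (hM m n (ℕ.m⊔n≤o⇒m≤o M N m≥) (ℕ.m⊔n≤o⇒m≤o M N n≥))
                  (hN m n (ℕ.m⊔n≤o⇒n≤o M N m≥) (ℕ.m⊔n≤o⇒n≤o M N n≥)) ⟩
  ½ ℚ.* ε ℚ.+ ½ ℚ.* ε
    ≡⟨ halves ε ⟩
  ε ∎
  where open ℚ.≤-Reasoning

neg-cauchy : ∀ {s} → IsCauchy s → IsCauchy λ n → ℚ.- s n
neg-cauchy {s} cs ε 0<ε with cs ε 0<ε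
... | N , hN = N , λ m n m≥ n≥ → subst (ℚ._< ε) (eq m n) (hN m n m≥ n≥)
  where
  open ℚ.≤-Reasoning
  eq : ∀ m n → ℚ.∣ s m ℚ.- s n ∣ ≡ ℚ.∣ (ℚ.- s m) ℚ.- (ℚ.- s n) ∣
  eq m n = begin-equality
    ℚ.∣ s m ℚ.- s n ∣
      ≡⟨ sym (ℚ.∣-p∣≡∣p∣ (s m ℚ.- s n)) ⟩
    ℚ.∣ ℚ.- (s m ℚ.- s n) ∣
      ≡⟨ cong ℚ.∣_∣ (solve 2 (λ a b → :- (a :- b) := (:- a) :- (:- b)) refl (s m) (s n)) ⟩
    ℚ.∣ (ℚ.- s m) ℚ.- (ℚ.- s n) ∣ ∎

eventually-bounded : ∀ {s} → IsCauchy s →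
  ∃ λ B → 0ℚ ℚ.< B × ∃ λ N → ∀ n → N ℕ.≤ n → ℚ.∣ s n ∣ ℚ.≤ B
eventually-bounded {s} cs with cs 1ℚ (ℚ.positive⁻¹ 1ℚ)
... | N , hN = 1ℚ ℚ.+ ℚ.∣ s N ∣ ,
  ℚ.+-mono-<-≤ (ℚ.positive⁻¹ 1ℚ) (ℚ.0≤∣p∣ (s N)) ,
  N , λ n n≥ → begin
    ℚ.∣ s n ∣
      ≡⟨ cong ℚ.∣_∣ (solve 2 (λ a b → a := (a :- b) :+ b) refl (s n) (s N)) ⟩
    ℚ.∣ (s n ℚ.- s N) ℚ.+ s N ∣
      ≤⟨ ℚ.∣p+q∣≤∣p∣+∣q∣ (s n ℚ.- s N) (s N) ⟩
    ℚ.∣ s n ℚ.- s N ∣ ℚ.+ ℚ.∣ s N ∣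
      ≤⟨ ℚ.+-monoˡ-≤ ℚ.∣ s N ∣ (ℚ.<⇒≤ (hN n N n≥ ℕ.≤-refl)) ⟩
    1ℚ ℚ.+ ℚ.∣ s N ∣ ∎
  where open ℚ.≤-Reasoning

scale : ∀ {B ε} → 0ℚ ℚ.< B → 0ℚ ℚ.< ε → ∃ λ δ → 0ℚ ℚ.< δ × B ℚ.* δ ≡ ε
scale {B} {ε} 0<B 0<ε = 1/B ℚ.* ε ,
  subst (ℚ._< 1/B ℚ.* ε) (ℚ.*-zeroʳ 1/B)
    (ℚ.*-monoʳ-<-pos 1/B {{ℚ.1/pos⇒pos B}} 0<ε) ,
  (begin-equality
    B ℚ.* (1/B ℚ.* ε)   ≡⟨ sym (ℚ.*-assoc B 1/B ε) ⟩
    (B ℚ.* 1/B) ℚ.* ε   ≡⟨ cong (ℚ._* ε) (ℚ.*-inverseʳ B) ⟩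
    1ℚ ℚ.* ε            ≡⟨ ℚ.*-identityˡ ε ⟩
    ε                   ∎)
  where
  open ℚ.≤-Reasoning
  instance
    B-pos : ℚ.Positive B
    B-pos = ℚ.positive 0<B
    B-nonZero : ℚ.NonZero B
    B-nonZero = ℚ.pos⇒nonZero B
  1/B : ℚ
  1/B = ℚ.1/ B

∣*∣-bound : ∀ {a b B δ} → 0ℚ ℚ.< B → ℚ.∣ a ∣ ℚ.≤ B → ℚ.∣ b ∣ ℚ.< δ →
  ℚ.∣ a ℚ.* b ∣ ℚ.< B ℚ.* δ
∣*∣-bound {a} {b} {B} {δ} 0<B a≤B b<δ = begin-strict
  ℚ.∣ a ℚ.* b ∣       ≡⟨ ℚ.∣p*q∣≡∣p∣*∣q∣ a b ⟩
  ℚ.∣ a ∣ ℚ.* ℚ.∣ b ∣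
    ≤⟨ ℚ.*-monoʳ-≤-nonNeg ℚ.∣ b ∣ {{ℚ.nonNegative (ℚ.0≤∣p∣ b)}} a≤B ⟩
  B ℚ.* ℚ.∣ b ∣       <⟨ ℚ.*-monoʳ-<-pos B {{ℚ.positive 0<B}} b<δ ⟩
  B ℚ.* δ             ∎
  where open ℚ.≤-Reasoning

product-diff : ∀ {a b c d B C δ η} → 0ℚ ℚ.< B → 0ℚ ℚ.< C →
  ℚ.∣ a ∣ ℚ.≤ B → ℚ.∣ d ∣ ℚ.≤ C →
  ℚ.∣ b ℚ.- d ∣ ℚ.< δ → ℚ.∣ a ℚ.- c ∣ ℚ.< η →
  ℚ.∣ a ℚ.* b ℚ.- c ℚ.* d ∣ ℚ.< B ℚ.* δ ℚ.+ C ℚ.* η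
product-diff {a} {b} {c} {d} {B} {C} {δ} {η} 0<B 0<C a≤B d≤C b-d<δ a-c<η = begin-strict
  ℚ.∣ a ℚ.* b ℚ.- c ℚ.* d ∣
    ≡⟨ cong ℚ.∣_∣ (solve 4 (λ a b c d →
         a :* b :- c :* d := a :* (b :- d) :+ d :* (a :- c)) refl a b c d) ⟩
  ℚ.∣ a ℚ.* (b ℚ.- d) ℚ.+ d ℚ.* (a ℚ.- c) ∣
    ≤⟨ ℚ.∣p+q∣≤∣p∣+∣q∣ (a ℚ.* (b ℚ.- d)) (d ℚ.* (a ℚ.- c)) ⟩
  ℚ.∣ a ℚ.* (b ℚ.- d) ∣ ℚ.+ ℚ.∣ d ℚ.* (a ℚ.- c) ∣
    <⟨ ℚ.+-mono-< (∣*∣-bound {a} {b ℚ.- d} 0<B a≤B b-d<δ)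
                  (∣*∣-bound {d} {a ℚ.- c} 0<C d≤C a-c<η) ⟩
  B ℚ.* δ ℚ.+ C ℚ.* η ∎
  where open ℚ.≤-Reasoning

*-cauchy : ∀ {s t} → IsCauchy s → IsCauchy t → IsCauchy λ n → s n ℚ.* t n
*-cauchy {s} {t} cs ct ε 0<ε =
  let B , 0<B , K , hK = eventually-bounded cs
      C , 0<C , L , hL = eventually-bounded ct
      δ , 0<δ , Bδ = scale 0<B (½*-pos 0<ε)
      η , 0<η , Cη = scale 0<C (½*-pos 0<ε)
      M , hM = ct δ 0<δ
      N , hN = cs η 0<η
  in combine Bδ Cη 0<B 0<C hK hL hM hN
  where
  combine : ∀ {B C δ η K L M N} → B ℚ.* δ ≡ ½ ℚ.* ε → C ℚ.* η ≡ ½ ℚ.* ε →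
    0ℚ ℚ.< B → 0ℚ ℚ.< C →
    (∀ n → K ℕ.≤ n → ℚ.∣ s n ∣ ℚ.≤ B) →
    (∀ n → L ℕ.≤ n → ℚ.∣ t n ∣ ℚ.≤ C) →
    (∀ m n → M ℕ.≤ m → M ℕ.≤ n → ℚ.∣ t m ℚ.- t n ∣ ℚ.< δ) →
    (∀ m n → N ℕ.≤ m → N ℕ.≤ n → ℚ.∣ s m ℚ.- s n ∣ ℚ.< η) →
    ∃ λ P → ∀ m n → P ℕ.≤ m → P ℕ.≤ n →
      ℚ.∣ s m ℚ.* t m ℚ.- s n ℚ.* t n ∣ ℚ.< ε
  combine {B} {C} {δ} {η} {K} {L} {M} {N} Bδ Cη 0<B 0<C hK hL hM hN =
    (K ℕ.⊔ L) ℕ.⊔ (M ℕ.⊔ N) , λ m n m≥ n≥ →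
      let KL≤m = ℕ.m⊔n≤o⇒m≤o (K ℕ.⊔ L) (M ℕ.⊔ N) m≥
          MN≤m = ℕ.m⊔n≤o⇒n≤o (K ℕ.⊔ L) (M ℕ.⊔ N) m≥
          KL≤n = ℕ.m⊔n≤o⇒m≤o (K ℕ.⊔ L) (M ℕ.⊔ N) n≥
          MN≤n = ℕ.m⊔n≤o⇒n≤o (K ℕ.⊔ L) (M ℕ.⊔ N) n≥
      in subst (ℚ.∣ s m ℚ.* t m ℚ.- s n ℚ.* t n ∣ ℚ.<_) Bδ+Cη≡ε
           (product-diff {s m} {t m} {s n} {t n} 0<B 0<C
             (hK m (ℕ.m⊔n≤o⇒m≤o K L KL≤m))
             (hL n (ℕ.m⊔n≤o⇒n≤o K L KL≤n))
             (hM m n (ℕ.m⊔n≤o⇒m≤o M N MN≤m) (ℕ.m⊔n≤o⇒m≤o M N MN≤n))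
             (hN m n (ℕ.m⊔n≤o⇒n≤o M N MN≤m) (ℕ.m⊔n≤o⇒n≤o M N MN≤n)))
    where
    open ℚ.≤-Reasoning
    Bδ+Cη≡ε : B ℚ.* δ ℚ.+ C ℚ.* η ≡ ε
    Bδ+Cη≡ε = begin-equality
      B ℚ.* δ ℚ.+ C ℚ.* η ≡⟨ cong₂ ℚ._+_ Bδ Cη ⟩
      ½ ℚ.* ε ℚ.+ ½ ℚ.* ε ≡⟨ halves ε ⟩
      ε                   ∎

infix  8 -_
infixl 7 _*_
infixl 6 _+_ _-_

_+_ : ℝ → ℝ → ℝ
x + y = mkℝ (λ n → seq x n ℚ.+ seq y n) (+-cauchy {seq x} {seq y} (cauchy x) (cauchy y))

-_ : ℝ → ℝ
- x = mkℝ (λ n → ℚ.- seq x n) (neg-cauchy {seq x} (cauchy x))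

_-_ : ℝ → ℝ → ℝ
x - y = x + (- y)

_*_ : ℝ → ℝ → ℝ
x * y = mkℝ (λ n → seq x n ℚ.* seq y n) (*-cauchy {seq x} {seq y} (cauchy x) (cauchy y))

ℝ-rawSemiring : RawSemiring 0ℓ 0ℓ
ℝ-rawSemiring = record
  { Carrier = ℝ ; _≈_ = _≈_ ; _+_ = _+_ ; _*_ = _*_ ; 0# = 0ℝ ; 1# = 1ℝ }

open RawSemiringDefinitions ℝ-rawSemiring public using (_^_; sum)

infix 4 _⟶_

-- The inequalities say that ∣ s n - l ∣ < ε.
_⟶_ : (ℕ → ℝ) → ℝ → Set
s ⟶ l = ∀ ε → 0ℝ < ε →
  ∃ λ N → ∀ n → N ℕ.≤ n → (- ε < s n - l) × (s n - l < ε)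

-- The partial sum over k < N of x ^ k / k !.
expSum : ℝ → ℕ → ℝ
expSum x N = sum {N} λ i →
  let k = toℕ i in x ^ k * fromℚ ((1ℤ ℚ./ (k !)) {{k ℕ.!≢0}})

-- Excluded middle is assumed from here on: the floor of a real and the
-- cardinality of an undecidable finite set are not computable.
module Classical (em : ExcludedMiddle 0ℓ) where

  -- Some element satisfying P, or the default d if there is none. Below, P
  -- has at most one solution up to equality, and it has one wherever the
  -- operation being defined makes sense mathematically.
  choose : {A : Set} → A → (A → Set) → A
  choose d P with em {∃ P}
  ... | yes (a , _) = a
  ... | no  _       = d

  choose-spec : {A : Set} (d : A) (P : A → Set) → ∃ P → P (choose d P)
  choose-spec d P ∃P with em {∃ P}
  ... | yes (_ , p) = p
  ... | no  ∄P      = ⊥-elim (∄P ∃P)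

  infix  9 _⁻¹
  infixl 7 _÷_

  _⁻¹ : ℝ → ℝ
  x ⁻¹ = choose 0ℝ λ y → x * y ≈ 1ℝ

  _÷_ : ℝ → ℝ → ℝ
  x ÷ y = x * y ⁻¹

  -- The nonnegative n-th root x^(1/n), for n ≥ 1 and x ≥ 0.
  root : ℕ → ℝ → ℝ
  root n x = choose 0ℝ λ y → 0ℝ ≤ y × y ^ n ≈ x

  lim : (ℕ → ℝ) → ℝ
  lim s = choose 0ℝ (s ⟶_)

  exp : ℝ → ℝ
  exp x = lim (expSum x)

  log : ℝ → ℝ
  log x = choose 0ℝ λ y → exp y ≈ x

  ⌊_⌋ : ℝ → ℤ
  ⌊ x ⌋ = choose 0ℤ λ k → fromℤ k ≤ x × x < fromℤ (k ℤ.+ 1ℤ)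

  M′ : ℝ → ℕ → ℤ
  M′ θ n = ⌊ 1ℝ ÷ (root n θ - 1ℝ) ⌋

  𝒜 : ℝ → Pred ℕ 0ℓ
  𝒜 θ n = 1 ℕ.≤ n × M′ θ n ≢ ⌊ fromℤ (+ n) ÷ log θ - ½ℝ ⌋

  -- The cardinality of S ∩ [1, N].
  count : Pred ℕ 0ℓ → ℕ → ℕ
  count S N = length (filter (λ n → em {S n}) (applyUpTo suc N))

  -- The sequence is indexed by N = suc k, so that N is nonzero.
  HasDensity : Pred ℕ 0ℓ → ℝ → Set
  HasDensity S d = (λ k → fromℚ (+ count S (suc k) ℚ./ suc k)) ⟶ d

{-# OPTIONS --safe #-}
module Submission where

-- Write L = log θ, α = 1/L and h = L/n, so that θ^(1/n) = e^h. The exponential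
-- series gives 1/h - 1/2 ≤ 1/(e^h - 1) ≤ 1/h - 1/2 + h. Hence n ∈ 𝒜 forces an
-- integer k with nα - 1/2 < k ≤ nα - 1/2 + L/n. For a fixed d ≥ 1 this cannot
-- hold for both n and n + d when n is large: if dα is not an integer, dα would
-- be within o(1) of one, and if it is, 2d(nα - 1/2) would be an integer lying
-- strictly within distance 1 of the integer 2dk. So the gaps of 𝒜 tend to
-- infinity, and its density is 0.

open import Defs hiding (_≈_; _<_; _≤_; _+_; _-_; -_; _*_; _^_)
open import Algebra.Bundles using (CommutativeRing; Ring; Semiring)
import Algebra.Definitions.RawSemiring as RawSemiringDefinitions
import Algebra.Solver.Ring as RingSolver
open import Algebra.Solver.Ring.AlmostCommutativeRing using (fromCommutativeRing; _-Raw-AlmostCommutative⟶_)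
open import Algebra.Structures using (IsCommutativeRing)
open import Axiom.ExcludedMiddle using (ExcludedMiddle)
open import Data.Empty using (⊥-elim)
open import Data.Fin.Base using (toℕ)
open import Data.Integer.Base as ℤ using (ℤ; 0ℤ; 1ℤ)
import Data.Integer.Properties as ℤ
import Data.Integer.Solver as ℤSolver
open import Data.List.Base as List using (applyUpTo; filter; length)
open import Data.List.Properties using (applyUpTo-∷ʳ; filter-++; filter-accept; filter-reject; length-++)
open import Data.Maybe.Base using (Maybe; just; nothing)
open import Data.Nat.Base as ℕ using (ℕ; zero; suc; _!)
open import Data.Nat.DivMod using (m≡m%n+[m/n]*n; m%n<n)
import Data.Nat.Properties as ℕ
open import Data.Product using (∃; _×_; _,_; proj₁; proj₂)
open import Data.Rational.Base as ℚ using (ℚ; 0ℚ; 1ℚ; ½)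
import Data.Rational.Properties as ℚ
open import Data.Rational.Solver using (module +-*-Solver)
open import Data.Rational.Unnormalised.Base as ℚᵘ using (mkℚᵘ; *≡*; *≤*)
import Data.Rational.Unnormalised.Properties as ℚᵘ
open import Data.Sum.Base using (_⊎_; inj₁; inj₂; [_,_]′)
open import Function.Base using (_∘_)
open import Level using (0ℓ)
import Relation.Binary.Reasoning.Base.Triple as Triple
open import Relation.Binary.PropositionalEquality as ≡ using (_≡_; _≢_)
open import Relation.Binary.Structures using (IsPreorder)
open import Relation.Nullary using (¬_; Dec; yes; no)
open import Relation.Unary using (Pred)

-- Three obstacles shape the proof. First, `exp`, `log`, roots and floors are chosen elements, known
-- only through their defining property once a witness is supplied. So a concrete exponential `Exp`
-- is built, whose n-th term is the n-th partial sum at the n-th approximation of x; the chosen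
-- `exp` agrees with it by uniqueness of limits, and the chosen root agrees with e^(L/n) by
-- uniqueness of nonnegative roots. A witness for log θ comes from a grid search at each rational
-- approximation of θ. Second, both bounds on 1/(e^h - 1) come from two inequalities for h > 0,
-- namely 1 + h + h²/2 ≤ e^h and (2 - h) e^h ≤ 2 + h. These hold already for partial sums, by
-- inspection of coefficients, so no calculus of real functions enters. Third, operations on Cauchy
-- sequences unfold to large terms; the floor argument is therefore carried out in an abstract
-- ordered field with an exponential, and only its conclusions are read in ℝ.

-- Order and arithmetic of the rationals.

module RationalOrder where
  open ≡ using (refl; sym; trans; cong; cong₂; subst)
  open import Data.Rational.Base using (_+_; _*_; _-_; -_; _≤_; _<_; ∣_∣; _/_)
  open +-*-Solver using (solve; _:+_; _:-_; :-_; _:=_)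
  open ℚ.≤-Reasoning

  0<1 : 0ℚ < 1ℚ
  0<1 = ℚ.positive⁻¹ 1ℚ

  0≤1 : 0ℚ ≤ 1ℚ
  0≤1 = ℚ.<⇒≤ 0<1

  0≤½ : 0ℚ ≤ ½
  0≤½ = ℚ.nonNegative⁻¹ ½

  p≤q⇒0≤q-p : ∀ {p q} → p ≤ q → 0ℚ ≤ q - p
  p≤q⇒0≤q-p {p} {q} p≤q = subst (_≤ q - p) (ℚ.+-inverseʳ p) (ℚ.+-monoˡ-≤ (- p) p≤q)

  p<q⇒0<q-p : ∀ {p q} → p < q → 0ℚ < q - p
  p<q⇒0<q-p {p} {q} p<q = subst (_< q - p) (ℚ.+-inverseʳ p) (ℚ.+-monoˡ-< (- p) p<q)

  -- The pattern of most inequality proofs below: the ring solver rewrites the difference of the two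
  -- sides as an expression r whose sign is read off with `_0≤+_` and `_0≤*_`.
  q-p≡r⇒p≤q : ∀ {p q r} → q - p ≡ r → 0ℚ ≤ r → p ≤ q
  q-p≡r⇒p≤q {p} {q} {r} eq 0≤r = begin
    p           ≡⟨ ℚ.+-identityˡ p ⟨
    0ℚ + p      ≤⟨ ℚ.+-monoˡ-≤ p 0≤r ⟩
    r + p       ≡⟨ cong (_+ p) eq ⟨
    q - p + p   ≡⟨ solve 2 (λ p q → q :- p :+ p := q) refl p q ⟩
    q           ∎

  q-p≡r⇒p<q : ∀ {p q r} → q - p ≡ r → 0ℚ < r → p < q
  q-p≡r⇒p<q {p} {q} {r} eq 0<r = begin-strict
    p           ≡⟨ ℚ.+-identityˡ p ⟨
    0ℚ + p      <⟨ ℚ.+-monoˡ-< p 0<r ⟩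
    r + p       ≡⟨ cong (_+ p) eq ⟨
    q - p + p   ≡⟨ solve 2 (λ p q → q :- p :+ p := q) refl p q ⟩
    q           ∎

  infixl 6 _0≤+_ _0<+_
  infixl 7 _0≤*_ _0<*_

  _0≤+_ : ∀ {p q} → 0ℚ ≤ p → 0ℚ ≤ q → 0ℚ ≤ p + q
  _0≤+_ = ℚ.+-mono-≤

  _0<+_ : ∀ {p q} → 0ℚ < p → 0ℚ ≤ q → 0ℚ < p + q
  _0<+_ = ℚ.+-mono-<-≤

  _0≤*_ : ∀ {p q} → 0ℚ ≤ p → 0ℚ ≤ q → 0ℚ ≤ p * q
  _0≤*_ {p} {q} 0≤p 0≤q = subst (_≤ p * q) (ℚ.*-zeroˡ q)
    (ℚ.*-monoʳ-≤-nonNeg q {{ℚ.nonNegative 0≤q}} 0≤p)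

  _0<*_ : ∀ {p q} → 0ℚ < p → 0ℚ < q → 0ℚ < p * q
  _0<*_ {p} {q} 0<p 0<q = subst (_< p * q) (ℚ.*-zeroˡ q)
    (ℚ.*-monoˡ-<-pos q {{ℚ.positive 0<q}} 0<p)

  *-mono-≤ : ∀ {p q r s} → 0ℚ ≤ q → 0ℚ ≤ r → p ≤ q → r ≤ s → p * r ≤ q * s
  *-mono-≤ {p} {q} {r} {s} 0≤q 0≤r p≤q r≤s = begin
    p * r ≤⟨ ℚ.*-monoʳ-≤-nonNeg r {{ℚ.nonNegative 0≤r}} p≤q ⟩
    q * r ≤⟨ ℚ.*-monoˡ-≤-nonNeg q {{ℚ.nonNegative 0≤q}} r≤s ⟩
    q * s ∎

  p≤∣p∣ : ∀ p → p ≤ ∣ p ∣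
  p≤∣p∣ p with ℚ.≤-total 0ℚ p
  ... | inj₁ 0≤p = ℚ.≤-reflexive (sym (ℚ.0≤p⇒∣p∣≡p 0≤p))
  ... | inj₂ p≤0 = ℚ.≤-trans p≤0 (ℚ.0≤∣p∣ p)

  -∣p∣≤p : ∀ p → - ∣ p ∣ ≤ p
  -∣p∣≤p p = begin
    - ∣ p ∣     ≡⟨ cong -_ (ℚ.∣-p∣≡∣p∣ p) ⟨
    - ∣ - p ∣   ≤⟨ ℚ.neg-antimono-≤ (p≤∣p∣ (- p)) ⟩
    - - p       ≡⟨ solve 1 (λ p → :- (:- p) := p) refl p ⟩
    p           ∎

  ∣p∣<q : ∀ {p q} → p < q → - p < q → ∣ p ∣ < q
  ∣p∣<q {p} {q} p<q -p<q with ℚ.∣p∣≡p∨∣p∣≡-p p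
  ... | inj₁ eq = subst (_< q) (sym eq) p<q
  ... | inj₂ eq = subst (_< q) (sym eq) -p<q

  ∣p-q∣≡∣q-p∣ : ∀ p q → ∣ p - q ∣ ≡ ∣ q - p ∣
  ∣p-q∣≡∣q-p∣ p q = trans (sym (ℚ.∣-p∣≡∣p∣ (p - q)))
    (cong ∣_∣ (solve 2 (λ p q → :- (p :- q) := q :- p) refl p q))

  ∣p-r∣≤∣p-q∣+∣q-r∣ : ∀ p q r → ∣ p - r ∣ ≤ ∣ p - q ∣ + ∣ q - r ∣
  ∣p-r∣≤∣p-q∣+∣q-r∣ p q r = subst (λ t → ∣ t ∣ ≤ ∣ p - q ∣ + ∣ q - r ∣)
    (solve 3 (λ p q r → (p :- q) :+ (q :- r) := p :- r) refl p q r)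
    (ℚ.∣p+q∣≤∣p∣+∣q∣ (p - q) (q - r))

  -- Normalisation of fractions by their gcd does not compute on variables, so this and the next
  -- identities are checked on unnormalised fractions, where they become integer identities.
  /1-+ : ∀ i j → (i ℤ.+ j) / 1 ≡ i / 1 + j / 1
  /1-+ i j = ℚ.toℚᵘ-injective (ℚᵘ.≃-trans (ℚ.toℚᵘ-fromℚᵘ (mkℚᵘ (i ℤ.+ j) 0))
    (ℚᵘ.≃-trans (*≡* eq) (ℚᵘ.≃-sym (ℚᵘ.≃-trans (ℚ.toℚᵘ-homo-+ (i / 1) (j / 1))
      (ℚᵘ.+-cong (ℚ.toℚᵘ-fromℚᵘ (mkℚᵘ i 0)) (ℚ.toℚᵘ-fromℚᵘ (mkℚᵘ j 0)))))))
    where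
    open ℤSolver.+-*-Solver renaming (solve to solveℤ; _:+_ to _⊕_; _:*_ to _⊗_; con to conℤ; _:=_ to _⊜_)
    eq : (i ℤ.+ j) ℤ.* 1ℤ ≡ (i ℤ.* 1ℤ ℤ.+ j ℤ.* 1ℤ) ℤ.* 1ℤ
    eq = solveℤ 2 (λ i j → (i ⊕ j) ⊗ conℤ 1ℤ ⊜ (i ⊗ conℤ 1ℤ ⊕ j ⊗ conℤ 1ℤ) ⊗ conℤ 1ℤ) refl i j

  /1-neg : ∀ i → (ℤ.- i) / 1 ≡ - (i / 1)
  /1-neg i = ℚ.toℚᵘ-injective (ℚᵘ.≃-trans (ℚ.toℚᵘ-fromℚᵘ (mkℚᵘ (ℤ.- i) 0))
    (ℚᵘ.≃-sym (ℚᵘ.≃-trans (ℚ.toℚᵘ-homo‿- (i / 1)) (ℚᵘ.-‿cong (ℚ.toℚᵘ-fromℚᵘ (mkℚᵘ i 0))))))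

  /1-* : ∀ i j → (i ℤ.* j) / 1 ≡ i / 1 * (j / 1)
  /1-* i j = ℚ.toℚᵘ-injective (ℚᵘ.≃-trans (ℚ.toℚᵘ-fromℚᵘ (mkℚᵘ (i ℤ.* j) 0))
    (ℚᵘ.≃-sym (ℚᵘ.≃-trans (ℚ.toℚᵘ-homo-* (i / 1) (j / 1))
      (ℚᵘ.*-cong (ℚ.toℚᵘ-fromℚᵘ (mkℚᵘ i 0)) (ℚ.toℚᵘ-fromℚᵘ (mkℚᵘ j 0))))))

  /1-mono-≤ : ∀ i j → i ℤ.≤ j → i / 1 ≤ j / 1
  /1-mono-≤ i j i≤j = ℚ.toℚᵘ-cancel-≤
    (ℚᵘ.≤-respˡ-≃ (ℚᵘ.≃-sym (ℚ.toℚᵘ-fromℚᵘ (mkℚᵘ i 0)))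
      (ℚᵘ.≤-respʳ-≃ (ℚᵘ.≃-sym (ℚ.toℚᵘ-fromℚᵘ (mkℚᵘ j 0))) (*≤* (ℤ.*-monoʳ-≤-nonNeg 1ℤ i≤j))))

  ι : ℕ → ℚ
  ι n = ℤ.+ n / 1

  ι-suc : ∀ n → ι (suc n) ≡ 1ℚ + ι n
  ι-suc n = /1-+ 1ℤ (ℤ.+ n)

  ι-mono-≤ : ∀ m n → m ℕ.≤ n → ι m ≤ ι n
  ι-mono-≤ m n m≤n = /1-mono-≤ (ℤ.+ m) (ℤ.+ n) (ℤ.+≤+ m≤n)

  0≤ι : ∀ n → 0ℚ ≤ ι n
  0≤ι n = ι-mono-≤ 0 n ℕ.z≤n

  0<ι : ∀ n → 0ℚ < ι (suc n)
  0<ι n = ℚ.<-≤-trans 0<1 (ι-mono-≤ 1 (suc n) (ℕ.s≤s ℕ.z≤n))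

  /≡/1*1/ : ∀ i n → i / suc n ≡ i / 1 * (1ℤ / suc n)
  /≡/1*1/ i n = ℚ.toℚᵘ-injective (ℚᵘ.≃-trans (ℚ.toℚᵘ-fromℚᵘ (mkℚᵘ i n))
    (ℚᵘ.≃-trans (*≡* eq)
    (ℚᵘ.≃-sym (ℚᵘ.≃-trans (ℚ.toℚᵘ-homo-* (i / 1) (1ℤ / suc n))
      (ℚᵘ.*-cong (ℚ.toℚᵘ-fromℚᵘ (mkℚᵘ i 0)) (ℚ.toℚᵘ-fromℚᵘ (mkℚᵘ 1ℤ n)))))))
    where
    eq : i ℤ.* (ℚᵘ.↧ (mkℚᵘ i 0 ℚᵘ.* mkℚᵘ 1ℤ n)) ≡ (i ℤ.* 1ℤ) ℤ.* (ℤ.+ suc n)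
    eq = cong₂ ℤ._*_ (sym (ℤ.*-identityʳ i)) (cong (λ m → ℤ.+ suc m) (ℕ.+-identityʳ n))

  ι*1/ : ∀ n → ι (suc n) * (1ℤ / suc n) ≡ 1ℚ
  ι*1/ n = trans (sym (/≡/1*1/ (ℤ.+ suc n) n))
    (ℚ.toℚᵘ-injective (ℚᵘ.≃-trans (ℚ.toℚᵘ-fromℚᵘ (mkℚᵘ (ℤ.+ suc n) n)) (*≡* (ℤ.*-comm (ℤ.+ suc n) 1ℤ))))

  -- Splits 1/(k+1)! into 1/(k+1) and 1/k!, which links the series of `expSum` to the recursive
  -- terms `e`.
  1/-* : ∀ m n .{{_ : ℕ.NonZero m}} .{{_ : ℕ.NonZero n}} .{{_ : ℕ.NonZero (m ℕ.* n)}} →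
    1ℤ / (m ℕ.* n) ≡ (1ℤ / m) * (1ℤ / n)
  1/-* (suc m) (suc n) = ℚ.toℚᵘ-injective (ℚᵘ.≃-trans (ℚ.toℚᵘ-fromℚᵘ (mkℚᵘ 1ℤ (n ℕ.+ m ℕ.* suc n)))
    (ℚᵘ.≃-sym (ℚᵘ.≃-trans (ℚ.toℚᵘ-homo-* (1ℤ / suc m) (1ℤ / suc n))
      (ℚᵘ.*-cong (ℚ.toℚᵘ-fromℚᵘ (mkℚᵘ 1ℤ m)) (ℚ.toℚᵘ-fromℚᵘ (mkℚᵘ 1ℤ n))))))

  0<1/ : ∀ n → 0ℚ < 1ℤ / suc n
  0<1/ n = ℚ.positive⁻¹ (1ℤ / suc n) {{ℚ.normalize-pos 1 (suc n)}}

  0≤1/ : ∀ n → 0ℚ ≤ 1ℤ / suc n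
  0≤1/ n = ℚ.<⇒≤ (0<1/ n)

  archimedean : ∀ p → ∃ λ n → p < ι n
  archimedean p@(ℚ.mkℚ i d _) = suc ℤ.∣ i ∣ , (begin-strict
    p                       ≡⟨ ℚ.↥p/↧p≡p p ⟨
    i / suc d               ≡⟨ /≡/1*1/ i d ⟩
    i / 1 * (1ℤ / suc d)    ≤⟨ *-mono-≤ (0≤ι ℤ.∣ i ∣) (0≤1/ d) (/1-mono-≤ i (ℤ.+ ℤ.∣ i ∣) (i≤∣i∣ i)) 1/≤1 ⟩
    ι ℤ.∣ i ∣ * 1ℚ          ≡⟨ ℚ.*-identityʳ (ι ℤ.∣ i ∣) ⟩
    ι ℤ.∣ i ∣               ≡⟨ ℚ.+-identityˡ (ι ℤ.∣ i ∣) ⟨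
    0ℚ + ι ℤ.∣ i ∣          <⟨ ℚ.+-monoˡ-< (ι ℤ.∣ i ∣) 0<1 ⟩
    1ℚ + ι ℤ.∣ i ∣          ≡⟨ ι-suc ℤ.∣ i ∣ ⟨
    ι (suc ℤ.∣ i ∣)         ∎)
    where
    i≤∣i∣ : ∀ i → i ℤ.≤ ℤ.+ ℤ.∣ i ∣
    i≤∣i∣ (ℤ.+ n) = ℤ.≤-refl
    i≤∣i∣ (ℤ.-[1+ n ]) = ℤ.-≤+
    1/≤1 : 1ℤ / suc d ≤ 1ℚ
    1/≤1 = begin
      1ℤ / suc d               ≡⟨ ℚ.*-identityˡ (1ℤ / suc d) ⟨
      1ℚ * (1ℤ / suc d)        ≤⟨ ℚ.*-monoʳ-≤-nonNeg (1ℤ / suc d) {{ℚ.nonNegative (0≤1/ d)}} (ι-mono-≤ 1 (suc d) (ℕ.s≤s ℕ.z≤n)) ⟩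
      ι (suc d) * (1ℤ / suc d) ≡⟨ ι*1/ d ⟩
      1ℚ                       ∎

  -- The multiplier is a successor so that it can also serve as a denominator.
  archimedean-* : ∀ p {ε} → 0ℚ < ε → ∃ λ n → p < ι (suc n) * ε
  archimedean-* p {ε} 0<ε with archimedean (p * ε⁻¹)
    where
    instance
      _ : ℚ.NonZero ε
      _ = ℚ.pos⇒nonZero ε {{ℚ.positive 0<ε}}
    ε⁻¹ = ℚ.1/ ε
  ... | n , h = n , (begin-strict
    p                 ≡⟨ ℚ.*-identityʳ p ⟨
    p * 1ℚ            ≡⟨ cong (p *_) (ℚ.*-inverseˡ ε) ⟨
    p * (ℚ.1/ ε * ε)  ≡⟨ ℚ.*-assoc p (ℚ.1/ ε) ε ⟨
    p * ℚ.1/ ε * ε    <⟨ ℚ.*-monoˡ-<-pos ε {{ℚ.positive 0<ε}} h ⟩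
    ι n * ε           ≤⟨ ℚ.*-monoʳ-≤-nonNeg ε {{ℚ.nonNegative (ℚ.<⇒≤ 0<ε)}} (ι-mono-≤ n (suc n) (ℕ.n≤1+n n)) ⟩
    ι (suc n) * ε     ∎)
    where
    instance
      _ : ℚ.NonZero ε
      _ = ℚ.pos⇒nonZero ε {{ℚ.positive 0<ε}}

-- Finite sums and partial sums of the exponential series over ℚ.

module ExponentialSums where
  open ≡ using (refl; sym; trans; cong; cong₂; subst; subst₂)
  open RationalOrder
  open import Data.Rational.Base using (_+_; _*_; _-_; -_; _≤_; _<_; ∣_∣; _/_)
  open +-*-Solver using (solve; con; _:+_; _:*_; _:-_; :-_; _:=_)
  open ℚ.≤-Reasoning

  ∑ : (ℕ → ℚ) → ℕ → ℚ
  ∑ f zero    = 0ℚ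
  ∑ f (suc n) = f 0 + ∑ (f ∘ suc) n

  ∑-cong : ∀ {f g} → (∀ k → f k ≡ g k) → ∀ n → ∑ f n ≡ ∑ g n
  ∑-cong f≡g zero    = refl
  ∑-cong f≡g (suc n) = cong₂ _+_ (f≡g 0) (∑-cong (f≡g ∘ suc) n)

  ∑-last : ∀ f n → ∑ f (suc n) ≡ ∑ f n + f n
  ∑-last f zero    = solve 1 (λ a → a :+ con 0ℚ := con 0ℚ :+ a) refl (f 0)
  ∑-last f (suc n) = trans (cong (f 0 +_) (∑-last (f ∘ suc) n))
    (sym (ℚ.+-assoc (f 0) (∑ (f ∘ suc) n) (f (suc n))))

  ∑-+ : ∀ f g n → ∑ (λ k → f k + g k) n ≡ ∑ f n + ∑ g n
  ∑-+ f g zero    = refl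
  ∑-+ f g (suc n) = trans (cong (f 0 + g 0 +_) (∑-+ (f ∘ suc) (g ∘ suc) n))
    (solve 4 (λ a b c d → a :+ b :+ (c :+ d) := a :+ c :+ (b :+ d)) refl
      (f 0) (g 0) (∑ (f ∘ suc) n) (∑ (g ∘ suc) n))

  ∑-*ˡ : ∀ c f n → ∑ (λ k → c * f k) n ≡ c * ∑ f n
  ∑-*ˡ c f zero    = sym (ℚ.*-zeroʳ c)
  ∑-*ˡ c f (suc n) = trans (cong (c * f 0 +_) (∑-*ˡ c (f ∘ suc) n))
    (sym (ℚ.*-distribˡ-+ c (f 0) (∑ (f ∘ suc) n)))

  ∑-mono-≤ : ∀ {f g} → (∀ k → f k ≤ g k) → ∀ n → ∑ f n ≤ ∑ g n
  ∑-mono-≤ f≤g zero    = ℚ.≤-refl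
  ∑-mono-≤ f≤g (suc n) = ℚ.+-mono-≤ (f≤g 0) (∑-mono-≤ (f≤g ∘ suc) n)

  0≤∑ : ∀ {f} → (∀ k → 0ℚ ≤ f k) → ∀ n → 0ℚ ≤ ∑ f n
  0≤∑ 0≤f zero    = ℚ.≤-refl
  0≤∑ 0≤f (suc n) = 0≤f 0 0≤+ 0≤∑ (0≤f ∘ suc) n

  ∑-monoʳ-≤ : ∀ {f} → (∀ k → 0ℚ ≤ f k) → ∀ {m n} → m ℕ.≤ n → ∑ f m ≤ ∑ f n
  ∑-monoʳ-≤ 0≤f {n = n} ℕ.z≤n = 0≤∑ 0≤f n
  ∑-monoʳ-≤ {f} 0≤f (ℕ.s≤s m≤n) = ℚ.+-monoʳ-≤ (f 0) (∑-monoʳ-≤ (0≤f ∘ suc) m≤n)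

  ∑-tail : ∀ {f g} → (∀ k → ∣ f k ∣ ≤ g k) → ∀ {m n} → m ℕ.≤ n →
    ∣ ∑ f n - ∑ f m ∣ ≤ ∑ g n - ∑ g m
  ∑-tail {f} {g} f≤g {n = zero} ℕ.z≤n = ℚ.≤-refl
  ∑-tail {f} {g} f≤g {n = suc n} ℕ.z≤n = begin
    ∣ f 0 + ∑ (f ∘ suc) n - 0ℚ ∣
      ≡⟨ cong ∣_∣ (solve 2 (λ a b → a :+ b :- con 0ℚ := a :+ (b :- con 0ℚ)) refl (f 0) (∑ (f ∘ suc) n)) ⟩
    ∣ f 0 + (∑ (f ∘ suc) n - 0ℚ) ∣
      ≤⟨ ℚ.∣p+q∣≤∣p∣+∣q∣ (f 0) (∑ (f ∘ suc) n - 0ℚ) ⟩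
    ∣ f 0 ∣ + ∣ ∑ (f ∘ suc) n - 0ℚ ∣
      ≤⟨ ℚ.+-mono-≤ (f≤g 0) (∑-tail (f≤g ∘ suc) {n = n} ℕ.z≤n) ⟩
    g 0 + (∑ (g ∘ suc) n - 0ℚ)
      ≡⟨ solve 2 (λ a b → a :+ (b :- con 0ℚ) := a :+ b :- con 0ℚ) refl (g 0) (∑ (g ∘ suc) n) ⟩
    g 0 + ∑ (g ∘ suc) n - 0ℚ ∎
  ∑-tail {f} {g} f≤g {suc m} {suc n} (ℕ.s≤s m≤n) =
    subst₂ (λ p q → ∣ p ∣ ≤ q) (shift (f 0) (∑ (f ∘ suc) n) (∑ (f ∘ suc) m))
      (shift (g 0) (∑ (g ∘ suc) n) (∑ (g ∘ suc) m)) (∑-tail (f≤g ∘ suc) m≤n)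
    where
    shift : ∀ a b c → b - c ≡ a + b - (a + c)
    shift = solve 3 (λ a b c → b :- c := a :+ b :- (a :+ c)) refl

  -- Cauchy products of coefficient sequences.

  conv : (ℕ → ℚ) → (ℕ → ℚ) → ℕ → ℚ
  conv a b zero    = a 0 * b 0
  conv a b (suc n) = a 0 * b (suc n) + conv (a ∘ suc) b n

  conv-cong : ∀ {a a′ b b′} → (∀ k → a k ≡ a′ k) → (∀ k → b k ≡ b′ k) →
    ∀ n → conv a b n ≡ conv a′ b′ n
  conv-cong a≡ b≡ zero    = cong₂ _*_ (a≡ 0) (b≡ 0)
  conv-cong a≡ b≡ (suc n) =
    cong₂ _+_ (cong₂ _*_ (a≡ 0) (b≡ (suc n))) (conv-cong (a≡ ∘ suc) b≡ n)

  conv-+ˡ : ∀ a a′ b n → conv (λ k → a k + a′ k) b n ≡ conv a b n + conv a′ b n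
  conv-+ˡ a a′ b zero    = ℚ.*-distribʳ-+ (b 0) (a 0) (a′ 0)
  conv-+ˡ a a′ b (suc n) = trans (cong ((a 0 + a′ 0) * b (suc n) +_) (conv-+ˡ (a ∘ suc) (a′ ∘ suc) b n))
    (solve 5 (λ x y z u v → (x :+ y) :* z :+ (u :+ v) := x :* z :+ u :+ (y :* z :+ v)) refl
      (a 0) (a′ 0) (b (suc n)) (conv (a ∘ suc) b n) (conv (a′ ∘ suc) b n))

  conv-*ˡ : ∀ c a b n → conv (λ k → c * a k) b n ≡ c * conv a b n
  conv-*ˡ c a b zero    = ℚ.*-assoc c (a 0) (b 0)
  conv-*ˡ c a b (suc n) = trans (cong (c * a 0 * b (suc n) +_) (conv-*ˡ c (a ∘ suc) b n))
    (solve 4 (λ c x y z → c :* x :* y :+ c :* z := c :* (x :* y :+ z)) refl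
      c (a 0) (b (suc n)) (conv (a ∘ suc) b n))

  conv-*ʳ : ∀ c a b n → conv a (λ k → c * b k) n ≡ c * conv a b n
  conv-*ʳ c a b zero    = solve 3 (λ c x y → x :* (c :* y) := c :* (x :* y)) refl c (a 0) (b 0)
  conv-*ʳ c a b (suc n) = trans (cong (a 0 * (c * b (suc n)) +_) (conv-*ʳ c (a ∘ suc) b n))
    (solve 4 (λ c x y z → x :* (c :* y) :+ c :* z := c :* (x :* y :+ z)) refl
      c (a 0) (b (suc n)) (conv (a ∘ suc) b n))

  -- The coefficients of the derivative of ∑ a k t^k.
  D : (ℕ → ℚ) → ℕ → ℚ
  D a k = ι (suc k) * a (suc k)

  -- The Leibniz rule (fg)′ = f′g + fg′ for formal power series, read off at degree n. The induction
  -- writes f = a 0 + t f₁, where f₁ has coefficients `a ∘ suc`.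
  conv-D : ∀ a b n → ι (suc n) * conv a b (suc n) ≡ conv (D a) b n + conv a (D b) n
  conv-D a b zero = solve 5
    (λ c a₀ a₁ b₀ b₁ → c :* (a₀ :* b₁ :+ a₁ :* b₀) := c :* a₁ :* b₀ :+ a₀ :* (c :* b₁)) refl
    (ι 1) (a 0) (a 1) (b 0) (b 1)
  conv-D a b (suc n) = begin-equality
    ι (2 ℕ.+ n) * (a 0 * b (2 ℕ.+ n) + a′*b)
      ≡⟨ solve 4 (λ c x y z → c :* (x :* y :+ z) := x :* (c :* y) :+ c :* z) refl
           (ι (2 ℕ.+ n)) (a 0) (b (2 ℕ.+ n)) a′*b ⟩
    a 0 * D b (suc n) + ι (2 ℕ.+ n) * a′*b
      ≡⟨ cong (λ c → a 0 * D b (suc n) + c * a′*b) (ι-suc (suc n)) ⟩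
    a 0 * D b (suc n) + (1ℚ + ι (suc n)) * a′*b
      ≡⟨ solve 3 (λ x c y → x :+ (con 1ℚ :+ c) :* y := x :+ (c :* y :+ y)) refl
           (a 0 * D b (suc n)) (ι (suc n)) a′*b ⟩
    a 0 * D b (suc n) + (ι (suc n) * a′*b + a′*b)
      ≡⟨ cong (λ t → a 0 * D b (suc n) + (t + a′*b)) (conv-D a′ b n) ⟩
    a 0 * D b (suc n) + (conv (D a′) b n + conv a′ (D b) n + (a 1 * b (suc n) + conv (a′ ∘ suc) b n))
      ≡⟨ solve 6 (λ u v w x y z → u :+ (v :+ w :+ (x :* y :+ z)) :=
           (con 1ℚ :* x) :* y :+ (v :+ z) :+ (u :+ w)) refl
           (a 0 * D b (suc n)) (conv (D a′) b n) (conv a′ (D b) n) (a 1) (b (suc n)) (conv (a′ ∘ suc) b n) ⟩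
    D a 0 * b (suc n) + (conv (D a′) b n + conv (a′ ∘ suc) b n) + (a 0 * D b (suc n) + conv a′ (D b) n)
      ≡⟨ cong (λ t → D a 0 * b (suc n) + t + conv a (D b) (suc n))
           (trans (sym (conv-+ˡ (D a′) (a′ ∘ suc) b n)) (conv-cong Da-suc (λ _ → refl) n)) ⟩
    conv (D a) b (suc n) + conv a (D b) (suc n) ∎
    where
    a′ : ℕ → ℚ
    a′ = a ∘ suc
    a′*b = conv a′ b (suc n)
    -- The coefficient form of (t f₁)′ = f₁ + t f₁′.
    Da-suc : ∀ k → D a′ k + a′ (suc k) ≡ D a (suc k)
    Da-suc k = trans (solve 2 (λ c x → c :* x :+ x := (con 1ℚ :+ c) :* x) refl (ι (suc k)) (a (2 ℕ.+ k)))
      (cong (_* a (2 ℕ.+ k)) (sym (ι-suc (suc k))))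

  -- ∑ over i + j < n of a i * b j.
  triangle : (ℕ → ℚ) → (ℕ → ℚ) → ℕ → ℚ
  triangle a b zero    = 0ℚ
  triangle a b (suc n) = a 0 * ∑ b (suc n) + triangle (a ∘ suc) b n

  ∑-conv : ∀ a b n → ∑ (conv a b) n ≡ triangle a b n
  ∑-conv a b zero    = refl
  ∑-conv a b (suc n) = begin-equality
    a 0 * b 0 + ∑ (λ k → a 0 * b (suc k) + conv (a ∘ suc) b k) n
      ≡⟨ cong (a 0 * b 0 +_) (∑-+ (λ k → a 0 * b (suc k)) (conv (a ∘ suc) b) n) ⟩
    a 0 * b 0 + (∑ (λ k → a 0 * b (suc k)) n + ∑ (conv (a ∘ suc) b) n)
      ≡⟨ cong₂ (λ s t → a 0 * b 0 + (s + t)) (∑-*ˡ (a 0) (b ∘ suc) n) (∑-conv (a ∘ suc) b n) ⟩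
    a 0 * b 0 + (a 0 * ∑ (b ∘ suc) n + triangle (a ∘ suc) b n)
      ≡⟨ solve 4 (λ x y z t → x :* y :+ (x :* z :+ t) := x :* (y :+ z) :+ t) refl
           (a 0) (b 0) (∑ (b ∘ suc) n) (triangle (a ∘ suc) b n) ⟩
    a 0 * ∑ b (suc n) + triangle (a ∘ suc) b n ∎

  0≤triangle : ∀ {a b} → (∀ k → 0ℚ ≤ a k) → (∀ k → 0ℚ ≤ b k) → ∀ n → 0ℚ ≤ triangle a b n
  0≤triangle 0≤a 0≤b zero    = ℚ.≤-refl
  0≤triangle 0≤a 0≤b (suc n) = 0≤a 0 0≤* 0≤∑ 0≤b (suc n) 0≤+ 0≤triangle (0≤a ∘ suc) 0≤b n

  -- The rectangle i < m, j < n lies inside the triangle i + j < m + n, and all terms are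
  -- nonnegative.
  ∑*∑≤triangle : ∀ {a b} → (∀ k → 0ℚ ≤ a k) → (∀ k → 0ℚ ≤ b k) →
    ∀ m n → ∑ a m * ∑ b n ≤ triangle a b (m ℕ.+ n)
  ∑*∑≤triangle {a} {b} 0≤a 0≤b zero n =
    subst (_≤ triangle a b n) (sym (ℚ.*-zeroˡ (∑ b n))) (0≤triangle 0≤a 0≤b n)
  ∑*∑≤triangle {a} {b} 0≤a 0≤b (suc m) n = begin
    (a 0 + ∑ (a ∘ suc) m) * ∑ b n
      ≡⟨ ℚ.*-distribʳ-+ (∑ b n) (a 0) (∑ (a ∘ suc) m) ⟩
    a 0 * ∑ b n + ∑ (a ∘ suc) m * ∑ b n
      ≤⟨ ℚ.+-mono-≤
           (ℚ.*-monoˡ-≤-nonNeg (a 0) {{ℚ.nonNegative (0≤a 0)}}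
             (∑-monoʳ-≤ 0≤b (ℕ.m≤n⇒m≤1+n (ℕ.m≤n+m n m))))
           (∑*∑≤triangle (0≤a ∘ suc) 0≤b m n) ⟩
    a 0 * ∑ b (suc (m ℕ.+ n)) + triangle (a ∘ suc) b (m ℕ.+ n) ∎

  -- As m ≤ n, the triangle i + j < m lies in the rectangle i < m, j < n. The left side is thus a
  -- sum over the remaining index pairs, and it is dominated term by term. A rectangle is used
  -- because the induction shortens only the first factor.
  ∣∑*∑-triangle∣≤ : ∀ {a b α β} → (∀ k → ∣ a k ∣ ≤ α k) → (∀ k → ∣ b k ∣ ≤ β k) →
    ∀ {m n} → m ℕ.≤ n →
    ∣ ∑ a m * ∑ b n - triangle a b m ∣ ≤ ∑ α m * ∑ β n - triangle α β m
  ∣∑*∑-triangle∣≤ {a} {b} {α} {β} a≤α b≤β {zero} {n} m≤n = ℚ.≤-reflexive (begin-equality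
    ∣ 0ℚ * ∑ b n - 0ℚ ∣
      ≡⟨ cong ∣_∣ (solve 1 (λ x → con 0ℚ :* x :- con 0ℚ := con 0ℚ) refl (∑ b n)) ⟩
    0ℚ
      ≡⟨ solve 1 (λ x → con 0ℚ := con 0ℚ :* x :- con 0ℚ) refl (∑ β n) ⟩
    0ℚ * ∑ β n - 0ℚ ∎)
  ∣∑*∑-triangle∣≤ {a} {b} {α} {β} a≤α b≤β {suc m} {n} m<n = begin
    ∣ (a 0 + ∑ (a ∘ suc) m) * ∑ b n - (a 0 * ∑ b (suc m) + triangle (a ∘ suc) b m) ∣
      ≡⟨ cong ∣_∣ (split (a 0) (∑ (a ∘ suc) m) (∑ b n) (∑ b (suc m)) (triangle (a ∘ suc) b m)) ⟩
    ∣ a 0 * (∑ b n - ∑ b (suc m)) + (∑ (a ∘ suc) m * ∑ b n - triangle (a ∘ suc) b m) ∣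
      ≤⟨ ℚ.∣p+q∣≤∣p∣+∣q∣ (a 0 * (∑ b n - ∑ b (suc m))) (∑ (a ∘ suc) m * ∑ b n - triangle (a ∘ suc) b m) ⟩
    ∣ a 0 * (∑ b n - ∑ b (suc m)) ∣ + ∣ ∑ (a ∘ suc) m * ∑ b n - triangle (a ∘ suc) b m ∣
      ≡⟨ cong (_+ ∣ ∑ (a ∘ suc) m * ∑ b n - triangle (a ∘ suc) b m ∣) (ℚ.∣p*q∣≡∣p∣*∣q∣ (a 0) (∑ b n - ∑ b (suc m))) ⟩
    ∣ a 0 ∣ * ∣ ∑ b n - ∑ b (suc m) ∣ + ∣ ∑ (a ∘ suc) m * ∑ b n - triangle (a ∘ suc) b m ∣
      ≤⟨ ℚ.+-mono-≤
           (*-mono-≤ (ℚ.≤-trans (ℚ.0≤∣p∣ (a 0)) (a≤α 0)) (ℚ.0≤∣p∣ (∑ b n - ∑ b (suc m))) (a≤α 0) (∑-tail b≤β m<n))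
           (∣∑*∑-triangle∣≤ (a≤α ∘ suc) b≤β (ℕ.<⇒≤ m<n)) ⟩
    α 0 * (∑ β n - ∑ β (suc m)) + (∑ (α ∘ suc) m * ∑ β n - triangle (α ∘ suc) β m)
      ≡⟨ split (α 0) (∑ (α ∘ suc) m) (∑ β n) (∑ β (suc m)) (triangle (α ∘ suc) β m) ⟨
    (α 0 + ∑ (α ∘ suc) m) * ∑ β n - (α 0 * ∑ β (suc m) + triangle (α ∘ suc) β m) ∎
    where
    split : ∀ x y z u t → (x + y) * z - (x * u + t) ≡ x * (z - u) + (y * z - t)
    split = solve 5 (λ x y z u t → (x :+ y) :* z :- (x :* u :+ t) := x :* (z :- u) :+ (y :* z :- t)) refl

  -- Terms x^k/k! and partial sums of the exponential series.

  e : ℚ → ℕ → ℚ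
  e x zero    = 1ℚ
  e x (suc k) = x * (1ℤ / suc k) * e x k

  E : ℚ → ℕ → ℚ
  E x = ∑ (e x)

  D-e : ∀ x k → D (e x) k ≡ x * e x k
  D-e x k = begin-equality
    ι (suc k) * (x * (1ℤ / suc k) * e x k)
      ≡⟨ solve 4 (λ c x r y → c :* (x :* r :* y) := (c :* r) :* (x :* y)) refl
           (ι (suc k)) x (1ℤ / suc k) (e x k) ⟩
    (ι (suc k) * (1ℤ / suc k)) * (x * e x k)
      ≡⟨ cong (_* (x * e x k)) (ι*1/ k) ⟩
    1ℚ * (x * e x k)
      ≡⟨ ℚ.*-identityˡ (x * e x k) ⟩
    x * e x k ∎

  ι-cancelˡ : ∀ n {p q} → ι (suc n) * p ≡ ι (suc n) * q → p ≡ q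
  ι-cancelˡ n {p} {q} eq = trans (sym (undo p)) (trans (cong ((1ℤ / suc n) *_) eq) (undo q))
    where
    undo : ∀ p → (1ℤ / suc n) * (ι (suc n) * p) ≡ p
    undo p = trans (solve 3 (λ r c p → r :* (c :* p) := (c :* r) :* p) refl (1ℤ / suc n) (ι (suc n)) p)
      (trans (cong (_* p) (ι*1/ n)) (ℚ.*-identityˡ p))

  -- Takes the place of the binomial theorem: both sides satisfy (n + 1) c (n + 1) = (x + y) c n
  -- with c 0 = 1, the left one by the Leibniz rule.
  conv-e : ∀ x y n → conv (e x) (e y) n ≡ e (x + y) n
  conv-e x y zero    = refl
  conv-e x y (suc n) = ι-cancelˡ n (begin-equality
    ι (suc n) * conv (e x) (e y) (suc n)
      ≡⟨ conv-D (e x) (e y) n ⟩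
    conv (D (e x)) (e y) n + conv (e x) (D (e y)) n
      ≡⟨ cong₂ _+_ (conv-cong (D-e x) (λ _ → refl) n) (conv-cong (λ _ → refl) (D-e y) n) ⟩
    conv (λ k → x * e x k) (e y) n + conv (e x) (λ k → y * e y k) n
      ≡⟨ cong₂ _+_ (conv-*ˡ x (e x) (e y) n) (conv-*ʳ y (e x) (e y) n) ⟩
    x * conv (e x) (e y) n + y * conv (e x) (e y) n
      ≡⟨ ℚ.*-distribʳ-+ (conv (e x) (e y) n) x y ⟨
    (x + y) * conv (e x) (e y) n
      ≡⟨ cong ((x + y) *_) (conv-e x y n) ⟩
    (x + y) * e (x + y) n
      ≡⟨ D-e (x + y) n ⟨
    ι (suc n) * e (x + y) (suc n) ∎)

  E-+ : ∀ x y n → E (x + y) n ≡ triangle (e x) (e y) n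
  E-+ x y n = trans (∑-cong (λ k → sym (conv-e x y k)) n) (∑-conv (e x) (e y) n)

  0≤e : ∀ {x} → 0ℚ ≤ x → ∀ k → 0ℚ ≤ e x k
  0≤e 0≤x zero    = 0≤1
  0≤e 0≤x (suc k) = 0≤x 0≤* 0≤1/ k 0≤* 0≤e 0≤x k

  ∣e∣≤ : ∀ {x b} → ∣ x ∣ ≤ b → ∀ k → ∣ e x k ∣ ≤ e b k
  ∣e∣≤ ∣x∣≤b zero = ℚ.≤-refl
  ∣e∣≤ {x} {b} ∣x∣≤b (suc k) = begin
    ∣ x * (1ℤ / suc k) * e x k ∣
      ≡⟨ ℚ.∣p*q∣≡∣p∣*∣q∣ (x * (1ℤ / suc k)) (e x k) ⟩
    ∣ x * (1ℤ / suc k) ∣ * ∣ e x k ∣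
      ≡⟨ cong (_* ∣ e x k ∣) (trans (ℚ.∣p*q∣≡∣p∣*∣q∣ x (1ℤ / suc k)) (cong (∣ x ∣ *_) (ℚ.0≤p⇒∣p∣≡p (0≤1/ k)))) ⟩
    ∣ x ∣ * (1ℤ / suc k) * ∣ e x k ∣
      ≤⟨ *-mono-≤ (0≤b 0≤* 0≤1/ k) (ℚ.0≤∣p∣ (e x k))
           (*-mono-≤ 0≤b (0≤1/ k) ∣x∣≤b ℚ.≤-refl) (∣e∣≤ ∣x∣≤b k) ⟩
    b * (1ℤ / suc k) * e b k ∎
    where
    0≤b : 0ℚ ≤ b
    0≤b = ℚ.≤-trans (ℚ.0≤∣p∣ x) ∣x∣≤b

  e-mono-≤ : ∀ {x y} → 0ℚ ≤ x → x ≤ y → ∀ k → e x k ≤ e y k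
  e-mono-≤ {x} {y} 0≤x x≤y k = ℚ.≤-trans (p≤∣p∣ (e x k))
    (∣e∣≤ (subst (_≤ y) (sym (ℚ.0≤p⇒∣p∣≡p 0≤x)) x≤y) k)

  -- The error is the part of the square outside the triangle. Replacing x, y by the bounds b, c
  -- makes all terms nonnegative; enclosing the square in the triangle of size 2n then turns the
  -- error into a piece of the tail of the series at b + c.
  ∣E*E-E∣≤ : ∀ {x y b c} → ∣ x ∣ ≤ b → ∣ y ∣ ≤ c → ∀ n →
    ∣ E x n * E y n - E (x + y) n ∣ ≤ E (b + c) (n ℕ.+ n) - E (b + c) n
  ∣E*E-E∣≤ {x} {y} {b} {c} x≤b y≤c n = begin
    ∣ E x n * E y n - E (x + y) n ∣
      ≡⟨ cong (λ t → ∣ E x n * E y n - t ∣) (E-+ x y n) ⟩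
    ∣ E x n * E y n - triangle (e x) (e y) n ∣
      ≤⟨ ∣∑*∑-triangle∣≤ (∣e∣≤ x≤b) (∣e∣≤ y≤c) (ℕ.≤-refl {n}) ⟩
    E b n * E c n - triangle (e b) (e c) n
      ≤⟨ ℚ.+-monoˡ-≤ (- triangle (e b) (e c) n)
           (∑*∑≤triangle (0≤e (ℚ.≤-trans (ℚ.0≤∣p∣ x) x≤b)) (0≤e (ℚ.≤-trans (ℚ.0≤∣p∣ y) y≤c)) n n) ⟩
    triangle (e b) (e c) (n ℕ.+ n) - triangle (e b) (e c) n
      ≡⟨ cong₂ _-_ (E-+ b c (n ℕ.+ n)) (E-+ b c n) ⟨
    E (b + c) (n ℕ.+ n) - E (b + c) n ∎

  module Tail {b : ℚ} (0≤b : 0ℚ ≤ b) (c : ℕ) (b≤c : b ≤ ι c) where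

    -- The ratio of consecutive terms is b/(k + 1), which is at most c/(2c + 1) from k = 2c on.
    e-halves : ∀ {k} → c ℕ.+ c ℕ.≤ k → e b (suc k) ≤ ½ * e b k
    e-halves {k} 2c≤k = ℚ.*-monoʳ-≤-nonNeg (e b k) {{ℚ.nonNegative (0≤e 0≤b k)}} (begin
      b * (1ℤ / suc k)
        ≡⟨ solve 2 (λ b r → b :* r := con ½ :* ((b :+ b) :* r)) refl b (1ℤ / suc k) ⟩
      ½ * ((b + b) * (1ℤ / suc k))
        ≤⟨ ℚ.*-monoˡ-≤-nonNeg ½ (ℚ.*-monoʳ-≤-nonNeg (1ℤ / suc k) {{ℚ.nonNegative (0≤1/ k)}} (begin
             b + b         ≤⟨ ℚ.+-mono-≤ b≤c b≤c ⟩
             ι c + ι c     ≡⟨ /1-+ (ℤ.+ c) (ℤ.+ c) ⟨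
             ι (c ℕ.+ c)   ≤⟨ ι-mono-≤ (c ℕ.+ c) (suc k) (ℕ.m≤n⇒m≤1+n 2c≤k) ⟩
             ι (suc k)     ∎)) ⟩
      ½ * (ι (suc k) * (1ℤ / suc k))
        ≡⟨ cong (½ *_) (ι*1/ k) ⟩
      ½ * 1ℚ ∎)

    -- E b k + 2 e b k is a nonincreasing upper bound of E b from k = 2c on.
    E-bounded : ∀ j {k} → c ℕ.+ c ℕ.≤ k → E b (j ℕ.+ k) + (e b (j ℕ.+ k) + e b (j ℕ.+ k)) ≤ E b k + (e b k + e b k)
    E-bounded zero    2c≤k = ℚ.≤-refl
    E-bounded (suc j) {k} 2c≤k = begin
      E b (suc i) + (e b (suc i) + e b (suc i))
        ≡⟨ cong (_+ (e b (suc i) + e b (suc i))) (∑-last (e b) i) ⟩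
      E b i + e b i + (e b (suc i) + e b (suc i))
        ≤⟨ ℚ.+-monoʳ-≤ (E b i + e b i) (ℚ.+-mono-≤ (e-halves 2c≤i) (e-halves 2c≤i)) ⟩
      E b i + e b i + (½ * e b i + ½ * e b i)
        ≡⟨ solve 2 (λ x y → x :+ y :+ (con ½ :* y :+ con ½ :* y) := x :+ (y :+ y)) refl (E b i) (e b i) ⟩
      E b i + (e b i + e b i)
        ≤⟨ E-bounded j 2c≤k ⟩
      E b k + (e b k + e b k) ∎
      where
      i = j ℕ.+ k
      2c≤i : c ℕ.+ c ℕ.≤ i
      2c≤i = ℕ.≤-trans 2c≤k (ℕ.m≤n+m k j)

    -- A crude consequence of geometric decay: passing from i to i + 1 halves the term, while (i +
    -- 2)/2 ≤ i + 1. Decay like 1/(i + 1) is all that the Archimedean property asks for.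
    ι*e≤ : ∀ i → ι (suc i) * e b (i ℕ.+ (c ℕ.+ c)) ≤ e b (c ℕ.+ c)
    ι*e≤ zero    = ℚ.≤-reflexive (ℚ.*-identityˡ (e b (c ℕ.+ c)))
    ι*e≤ (suc i) = begin
      ι (2 ℕ.+ i) * e b (suc k)
        ≤⟨ ℚ.*-monoˡ-≤-nonNeg (ι (2 ℕ.+ i)) {{ℚ.nonNegative (0≤ι (2 ℕ.+ i))}} (e-halves (ℕ.m≤n+m (c ℕ.+ c) i)) ⟩
      ι (2 ℕ.+ i) * (½ * e b k)
        ≡⟨ ℚ.*-assoc (ι (2 ℕ.+ i)) ½ (e b k) ⟨
      ι (2 ℕ.+ i) * ½ * e b k
        ≤⟨ ℚ.*-monoʳ-≤-nonNeg (e b k) {{ℚ.nonNegative (0≤e 0≤b k)}} (begin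
             ι (2 ℕ.+ i) * ½           ≡⟨ cong (_* ½) (trans (ι-suc (suc i)) (cong (1ℚ +_) (ι-suc i))) ⟩
             (1ℚ + (1ℚ + ι i)) * ½     ≤⟨ q-p≡r⇒p≤q (solve 1 (λ x → con 1ℚ :+ x :- (con 1ℚ :+ (con 1ℚ :+ x)) :* con ½ := con ½ :* x) refl (ι i)) (0≤½ 0≤* 0≤ι i) ⟩
             1ℚ + ι i                  ≡⟨ ι-suc i ⟨
             ι (suc i)                 ∎) ⟩
      ι (suc i) * e b k
        ≤⟨ ι*e≤ i ⟩
      e b (c ℕ.+ c) ∎
      where
      k = i ℕ.+ (c ℕ.+ c)

  -- By `E-bounded` everything past N adds at most 2 e b N, and N = i + 2c is taken so far out that
  -- `ι*e≤` pushes this below ε.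
  E-tail : ∀ {b} → 0ℚ ≤ b → ∀ {ε} → 0ℚ < ε → ∃ λ N → ∀ n → N ℕ.≤ n → E b n - E b N < ε
  E-tail {b} 0≤b {ε} 0<ε = N , λ n N≤n → begin-strict
    E b n - E b N
      ≤⟨ q-p≡r⇒p≤q (solve 4 (λ x y u v → v :+ v :- (x :- y) := y :+ (v :+ v) :- (x :+ u) :+ u) refl
           (E b n) (E b N) (e b n + e b n) (e b N))
           (p≤q⇒0≤q-p (subst (λ m → E b m + (e b m + e b m) ≤ E b N + (e b N + e b N))
             (ℕ.m∸n+n≡m N≤n) (E-bounded (n ℕ.∸ N) (ℕ.m≤n+m (c ℕ.+ c) i))) 0≤+ (0≤e 0≤b n 0≤+ 0≤e 0≤b n)) ⟩
    e b N + e b N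
      <⟨ ℚ.*-cancelˡ-<-nonNeg (ι (suc i)) {{ℚ.nonNegative (0≤ι (suc i))}} {e b N + e b N} {ε} (begin-strict
           ι (suc i) * (e b N + e b N)           ≡⟨ ℚ.*-distribˡ-+ (ι (suc i)) (e b N) (e b N) ⟩
           ι (suc i) * e b N + ι (suc i) * e b N ≤⟨ ℚ.+-mono-≤ (ι*e≤ i) (ι*e≤ i) ⟩
           e b (c ℕ.+ c) + e b (c ℕ.+ c)         <⟨ proj₂ small ⟩
           ι (suc i) * ε                         ∎) ⟩
    ε ∎
    where
    c = proj₁ (archimedean b)
    open Tail 0≤b c (ℚ.<⇒≤ (proj₂ (archimedean b)))
    small : ∃ λ i → e b (c ℕ.+ c) + e b (c ℕ.+ c) < ι (suc i) * ε
    small = archimedean-* (e b (c ℕ.+ c) + e b (c ℕ.+ c)) 0<ε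
    i = proj₁ small
    N = i ℕ.+ (c ℕ.+ c)

  -- The threshold N depends on the bound b alone, not on x. This uniformity is what permits the
  -- argument to vary together with the length of the sum.
  ∣E-E∣<ε : ∀ {b} → 0ℚ ≤ b → ∀ {ε} → 0ℚ < ε → ∃ λ N → ∀ {x} → ∣ x ∣ ≤ b → ∀ m n → N ℕ.≤ m → N ℕ.≤ n →
    ∣ E x m - E x n ∣ < ε
  ∣E-E∣<ε {b} 0≤b {ε} 0<ε = N , λ {x} x≤b m n N≤m N≤n → begin-strict
    ∣ E x m - E x n ∣
      ≤⟨ ∣p-r∣≤∣p-q∣+∣q-r∣ (E x m) (E x N) (E x n) ⟩
    ∣ E x m - E x N ∣ + ∣ E x N - E x n ∣
      ≡⟨ cong (∣ E x m - E x N ∣ +_) (∣p-q∣≡∣q-p∣ (E x N) (E x n)) ⟩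
    ∣ E x m - E x N ∣ + ∣ E x n - E x N ∣
      <⟨ ℚ.+-mono-< (near x≤b m N≤m) (near x≤b n N≤n) ⟩
    ½ * ε + ½ * ε
      ≡⟨ halves ε ⟩
    ε ∎
    where
    tail : ∃ λ N → ∀ n → N ℕ.≤ n → E b n - E b N < ½ * ε
    tail = E-tail 0≤b (½*-pos 0<ε)
    N = proj₁ tail
    near : ∀ {x} → ∣ x ∣ ≤ b → ∀ n → N ℕ.≤ n → ∣ E x n - E x N ∣ < ½ * ε
    near x≤b n N≤n = ℚ.≤-<-trans (∑-tail (∣e∣≤ x≤b) N≤n) (proj₂ tail n N≤n)

  E-upper-bound : ∀ {b} → 0ℚ ≤ b → ∃ λ C → 0ℚ < C × (∀ n → E b n ≤ C)
  E-upper-bound {b} 0≤b = 1ℚ + E b N , (0<1 0<+ 0≤∑ (0≤e 0≤b) N) , bound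
    where
    tail : ∃ λ N → ∀ n → N ℕ.≤ n → E b n - E b N < 1ℚ
    tail = E-tail 0≤b 0<1
    N = proj₁ tail
    bound : ∀ n → E b n ≤ 1ℚ + E b N
    bound n = [ small , large ]′ (ℕ.≤-total n N)
      where
      small : n ℕ.≤ N → E b n ≤ 1ℚ + E b N
      small n≤N = q-p≡r⇒p≤q (ℚ.+-assoc 1ℚ (E b N) (- E b n)) (0≤1 0≤+ p≤q⇒0≤q-p (∑-monoʳ-≤ (0≤e 0≤b) n≤N))
      large : N ℕ.≤ n → E b n ≤ 1ℚ + E b N
      large N≤n = q-p≡r⇒p≤q (solve 2 (λ x y → con 1ℚ :+ y :- x := con 1ℚ :- (x :- y)) refl (E b n) (E b N))
        (p≤q⇒0≤q-p (ℚ.<⇒≤ (proj₂ tail n N≤n)))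

  -- From x u - y v = x (u - v) + (x - y) v. Since b e_k = (k + 1) e_{k+1} at b, the two parts
  -- contribute k + 1 and 1 times |x - y| e_{k+1}; their total k + 2 cancels the new factor of the
  -- factorial.
  e-Lipschitz : ∀ {x y b} → ∣ x ∣ ≤ b → ∣ y ∣ ≤ b → ∀ k →
    ∣ e x (suc k) - e y (suc k) ∣ ≤ ∣ x - y ∣ * e b k
  e-Lipschitz {x} {y} {b} x≤b y≤b zero = ℚ.≤-reflexive (trans
    (cong ∣_∣ (solve 2 (λ x y → x :* con 1ℚ :* con 1ℚ :- y :* con 1ℚ :* con 1ℚ := x :- y) refl x y))
    (sym (ℚ.*-identityʳ ∣ x - y ∣)))
  e-Lipschitz {x} {y} {b} x≤b y≤b (suc k) = begin
    ∣ x * r * e x (suc k) - y * r * e y (suc k) ∣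
      ≡⟨ cong ∣_∣ (solve 5 (λ x y r u v → x :* r :* u :- y :* r :* v := r :* (x :* (u :- v) :+ (x :- y) :* v)) refl
           x y r (e x (suc k)) (e y (suc k))) ⟩
    ∣ r * (x * Δ + (x - y) * e y (suc k)) ∣
      ≡⟨ trans (ℚ.∣p*q∣≡∣p∣*∣q∣ r (x * Δ + (x - y) * e y (suc k)))
           (cong (_* ∣ x * Δ + (x - y) * e y (suc k) ∣) (ℚ.0≤p⇒∣p∣≡p (0≤1/ (suc k)))) ⟩
    r * ∣ x * Δ + (x - y) * e y (suc k) ∣
      ≤⟨ ℚ.*-monoˡ-≤-nonNeg r {{ℚ.nonNegative (0≤1/ (suc k))}} (begin
           ∣ x * Δ + (x - y) * e y (suc k) ∣
             ≤⟨ ℚ.∣p+q∣≤∣p∣+∣q∣ (x * Δ) ((x - y) * e y (suc k)) ⟩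
           ∣ x * Δ ∣ + ∣ (x - y) * e y (suc k) ∣
             ≡⟨ cong₂ _+_ (ℚ.∣p*q∣≡∣p∣*∣q∣ x Δ) (ℚ.∣p*q∣≡∣p∣*∣q∣ (x - y) (e y (suc k))) ⟩
           ∣ x ∣ * ∣ Δ ∣ + d * ∣ e y (suc k) ∣
             ≤⟨ ℚ.+-mono-≤ (*-mono-≤ 0≤b (ℚ.0≤∣p∣ Δ) x≤b (e-Lipschitz x≤b y≤b k))
                           (ℚ.*-monoˡ-≤-nonNeg d {{ℚ.∣-∣-nonNeg (x - y)}} (∣e∣≤ y≤b (suc k))) ⟩
           b * (d * e b k) + d * e b (suc k)
             ≡⟨ solve 4 (λ b d u v → b :* (d :* u) :+ d :* v := d :* (b :* u :+ v)) refl b d (e b k) (e b (suc k)) ⟩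
           d * (b * e b k + e b (suc k))
             ≡⟨ cong (λ t → d * (t + e b (suc k))) (D-e b k) ⟨
           d * (ι (suc k) * e b (suc k) + e b (suc k))
             ≡⟨ solve 3 (λ d c v → d :* (c :* v :+ v) := d :* ((con 1ℚ :+ c) :* v)) refl d (ι (suc k)) (e b (suc k)) ⟩
           d * ((1ℚ + ι (suc k)) * e b (suc k))
             ≡⟨ cong (λ c → d * (c * e b (suc k))) (ι-suc (suc k)) ⟨
           d * (ι (2 ℕ.+ k) * e b (suc k)) ∎) ⟩
    r * (d * (ι (2 ℕ.+ k) * e b (suc k)))
      ≡⟨ solve 4 (λ r d c v → r :* (d :* (c :* v)) := (c :* r) :* (d :* v)) refl r d (ι (2 ℕ.+ k)) (e b (suc k)) ⟩
    (ι (2 ℕ.+ k) * r) * (d * e b (suc k))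
      ≡⟨ trans (cong (_* (d * e b (suc k))) (ι*1/ (suc k))) (ℚ.*-identityˡ (d * e b (suc k))) ⟩
    d * e b (suc k) ∎
    where
    r = 1ℤ / (2 ℕ.+ k)
    d = ∣ x - y ∣
    Δ = e x (suc k) - e y (suc k)
    0≤b : 0ℚ ≤ b
    0≤b = ℚ.≤-trans (ℚ.0≤∣p∣ x) x≤b

  ∑-minus : ∀ f g n → ∑ (λ k → f k - g k) n ≡ ∑ f n - ∑ g n
  ∑-minus f g zero    = refl
  ∑-minus f g (suc n) = trans (cong (f 0 - g 0 +_) (∑-minus (f ∘ suc) (g ∘ suc) n))
    (solve 4 (λ a b c d → a :- b :+ (c :- d) := a :+ c :- (b :+ d)) refl
      (f 0) (g 0) (∑ (f ∘ suc) n) (∑ (g ∘ suc) n))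

  ∣∑∣≤ : ∀ {f g} → (∀ k → ∣ f k ∣ ≤ g k) → ∀ n → ∣ ∑ f n ∣ ≤ ∑ g n
  ∣∑∣≤ f≤g zero = ℚ.≤-refl
  ∣∑∣≤ {f} {g} f≤g (suc n) = ℚ.≤-trans (ℚ.∣p+q∣≤∣p∣+∣q∣ (f 0) (∑ (f ∘ suc) n))
    (ℚ.+-mono-≤ (f≤g 0) (∣∑∣≤ (f≤g ∘ suc) n))

  E-Lipschitz : ∀ {x y b} → ∣ x ∣ ≤ b → ∣ y ∣ ≤ b → ∀ n →
    ∣ E x n - E y n ∣ ≤ ∣ x - y ∣ * E b n
  E-Lipschitz {x} {y} {b} x≤b y≤b zero = ℚ.≤-reflexive (sym (ℚ.*-zeroʳ ∣ x - y ∣))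
  E-Lipschitz {x} {y} {b} x≤b y≤b (suc n) = begin
    ∣ 1ℚ + ∑ (e x ∘ suc) n - (1ℚ + ∑ (e y ∘ suc) n) ∣
      ≡⟨ cong ∣_∣ (trans (solve 2 (λ u v → con 1ℚ :+ u :- (con 1ℚ :+ v) := u :- v) refl (∑ (e x ∘ suc) n) (∑ (e y ∘ suc) n))
           (sym (∑-minus (e x ∘ suc) (e y ∘ suc) n))) ⟩
    ∣ ∑ (λ k → e x (suc k) - e y (suc k)) n ∣
      ≤⟨ ∣∑∣≤ (e-Lipschitz x≤b y≤b) n ⟩
    ∑ (λ k → ∣ x - y ∣ * e b k) n
      ≡⟨ ∑-*ˡ ∣ x - y ∣ (e b) n ⟩
    ∣ x - y ∣ * E b n
      ≤⟨ ℚ.*-monoˡ-≤-nonNeg ∣ x - y ∣ {{ℚ.∣-∣-nonNeg (x - y)}} (∑-monoʳ-≤ (0≤e (ℚ.≤-trans (ℚ.0≤∣p∣ x) x≤b)) (ℕ.n≤1+n n)) ⟩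
    ∣ x - y ∣ * E b (suc n) ∎

  E-expansion : ∀ x n → E x (2 ℕ.+ n) ≡ 1ℚ + x + ∑ (e x ∘ suc ∘ suc) n
  E-expansion x n = solve 2 (λ x s → con 1ℚ :+ (x :* con 1ℚ :* con 1ℚ :+ s) := con 1ℚ :+ x :+ s) refl x (∑ (e x ∘ suc ∘ suc) n)

  -- The linear terms already contribute y - x, and the terms of degree at least 2 are monotone on
  -- nonnegative arguments. This makes the inverse of the exponential 1-Lipschitz.
  E-growth : ∀ {x y} → 0ℚ ≤ x → x ≤ y → ∀ n → y - x ≤ E y (2 ℕ.+ n) - E x (2 ℕ.+ n)
  E-growth {x} {y} 0≤x x≤y n = q-p≡r⇒p≤q
    (trans (cong (_- (y - x)) (cong₂ _-_ (E-expansion y n) (E-expansion x n)))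
      (solve 4 (λ x y s t → con 1ℚ :+ y :+ t :- (con 1ℚ :+ x :+ s) :- (y :- x) := t :- s) refl
        x y (∑ (e x ∘ suc ∘ suc) n) (∑ (e y ∘ suc ∘ suc) n)))
    (p≤q⇒0≤q-p (∑-mono-≤ (λ k → e-mono-≤ 0≤x x≤y (2 ℕ.+ k)) n))

  E-zero : ∀ n → E 0ℚ (suc n) ≡ 1ℚ
  E-zero n = cong (1ℚ +_) (trans (∑-cong e-zero n) (trans (∑-*ˡ 0ℚ (e 0ℚ) n) (ℚ.*-zeroˡ (E 0ℚ n))))
    where
    e-zero : ∀ k → e 0ℚ (suc k) ≡ 0ℚ * e 0ℚ k
    e-zero k = cong (_* e 0ℚ k) (ℚ.*-zeroˡ (1ℤ / suc k))

  1+h+½h²≤E : ∀ {h} → 0ℚ ≤ h → ∀ n → 1ℚ + h + ½ * (h * h) ≤ E h (3 ℕ.+ n)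
  1+h+½h²≤E {h} 0≤h n = q-p≡r⇒p≤q
    (solve 2 (λ h s → con 1ℚ :+ (h :* con 1ℚ :* con 1ℚ :+ (h :* con ½ :* (h :* con 1ℚ :* con 1ℚ) :+ s))
      :- (con 1ℚ :+ h :+ con ½ :* (h :* h)) := s) refl h (∑ (λ k → e h (3 ℕ.+ k)) n))
    (0≤∑ (λ k → 0≤e 0≤h (3 ℕ.+ k)) n)

  -- The coefficient of h^k in (2 - h) e^h is (2 - k) / k!.
  [2-h]*E≤ : ∀ {h} → 0ℚ ≤ h → ∀ n → (1ℚ + 1ℚ - h) * E h (2 ℕ.+ n) ≤ 1ℚ + 1ℚ + h - h * e h (suc n)
  [2-h]*E≤ {h} 0≤h zero = ℚ.≤-reflexive (solve 1 (λ h →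
    (con 1ℚ :+ con 1ℚ :- h) :* (con 1ℚ :+ (h :* con 1ℚ :* con 1ℚ :+ con 0ℚ)) :=
    con 1ℚ :+ con 1ℚ :+ h :- h :* (h :* con 1ℚ :* con 1ℚ)) refl h)
  [2-h]*E≤ {h} 0≤h (suc n) = begin
    (1ℚ + 1ℚ - h) * E h (3 ℕ.+ n)
      ≡⟨ cong ((1ℚ + 1ℚ - h) *_) (∑-last (e h) (2 ℕ.+ n)) ⟩
    (1ℚ + 1ℚ - h) * (E h (2 ℕ.+ n) + eₙ)
      ≡⟨ ℚ.*-distribˡ-+ (1ℚ + 1ℚ - h) (E h (2 ℕ.+ n)) eₙ ⟩
    (1ℚ + 1ℚ - h) * E h (2 ℕ.+ n) + (1ℚ + 1ℚ - h) * eₙ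
      ≤⟨ ℚ.+-monoˡ-≤ ((1ℚ + 1ℚ - h) * eₙ) ([2-h]*E≤ 0≤h n) ⟩
    1ℚ + 1ℚ + h - h * e h (suc n) + (1ℚ + 1ℚ - h) * eₙ
      -- The correction equals (n + 2) e_{n+2}; set against the new summand (2 - h) e_{n+2} it
      -- leaves -h e_{n+2}, the next correction, and the surplus n e_{n+2}, which is discarded.
      ≡⟨ cong (λ t → 1ℚ + 1ℚ + h - t + (1ℚ + 1ℚ - h) * eₙ)
           (trans (sym (D-e h (suc n))) (cong (_* eₙ) (trans (ι-suc (suc n)) (cong (1ℚ +_) (ι-suc n))))) ⟩
    1ℚ + 1ℚ + h - (1ℚ + (1ℚ + ι n)) * eₙ + (1ℚ + 1ℚ - h) * eₙ
      ≤⟨ q-p≡r⇒p≤q (solve 3 (λ h c v →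
           con 1ℚ :+ con 1ℚ :+ h :- h :* v :- (con 1ℚ :+ con 1ℚ :+ h :- (con 1ℚ :+ (con 1ℚ :+ c)) :* v :+ (con 1ℚ :+ con 1ℚ :- h) :* v)
           := c :* v) refl h (ι n) eₙ) (0≤ι n 0≤* 0≤e 0≤h (2 ℕ.+ n)) ⟩
    1ℚ + 1ℚ + h - h * eₙ ∎
    where
    eₙ = e h (2 ℕ.+ n)

-- Archimedean ordered fields with an exponential.

record ExponentialField : Set₁ where
  infix 4 _≈_ _<_ _≤_
  infixl 6 _+_
  infixl 7 _*_
  field
    Carrier : Set
    _≈_     : Carrier → Carrier → Set
    _+_     : Carrier → Carrier → Carrier
    _*_     : Carrier → Carrier → Carrier
    -_      : Carrier → Carrier
    κ       : ℚ → Carrier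
    isCommutativeRing : IsCommutativeRing _≈_ _+_ _*_ -_ (κ 0ℚ) (κ 1ℚ)
  commutativeRing : CommutativeRing 0ℓ 0ℓ
  commutativeRing = record { isCommutativeRing = isCommutativeRing }
  open CommutativeRing commutativeRing public hiding (Carrier; _≈_; _+_; _*_; -_; isCommutativeRing)
  field
    _<_       : Carrier → Carrier → Set
    <-irrefl  : ∀ {x y} → x ≈ y → ¬ (x < y)
    <-trans   : ∀ {x y z} → x < y → y < z → x < z
    <-cmp     : ∀ x y → x < y ⊎ x ≈ y ⊎ y < x
    <-respʳ-≈ : ∀ {x y z} → y ≈ z → x < y → x < z
    <-respˡ-≈ : ∀ {x y z} → x ≈ y → x < z → y < z
    +-monoˡ-< : ∀ z {x y} → x < y → x + z < y + z
    *-pos     : ∀ {x y} → 0# < x → 0# < y → 0# < x * y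
    κ-+       : ∀ p q → κ (p ℚ.+ q) ≈ κ p + κ q
    κ-*       : ∀ p q → κ (p ℚ.* q) ≈ κ p * κ q
    κ-neg     : ∀ p → κ (ℚ.- p) ≈ - κ p
    κ-mono-<  : ∀ {p q} → p ℚ.< q → κ p < κ q
    unbounded : ∀ x → ∃ λ n → x < κ (RationalOrder.ι n)
    inverse   : ∀ {x} → 0# < x → ∃ λ y → x * y ≈ 1#
  _≤_ : Carrier → Carrier → Set
  x ≤ y = ¬ (y < x)
  field
    exp       : Carrier → Carrier
    exp-cong  : ∀ {x y} → x ≈ y → exp x ≈ exp y
    exp-+     : ∀ x y → exp (x + y) ≈ exp x * exp y
    exp-0     : exp 0# ≈ 1#
    -- With u = e^h - 1, the first bound yields the upper estimate of 1/u. The second is 1/h - 1/2 ≤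
    -- 1/u with denominators cleared.
    exp-lower : ∀ {h} → 0# < h → 1# + h + κ ½ * (h * h) ≤ exp h
    exp-upper : ∀ {h} → 0# < h → (1# + 1# - h) * exp h ≤ 1# + 1# + h

-- Order, integers, floors and powers in such a field.

module OrderedFieldProperties (F : ExponentialField) where
  open ExponentialField F
  open RationalOrder using (ι; 0<ι; /1-+; /1-*; /1-neg; /1-mono-≤)
  open RawSemiringDefinitions (Semiring.rawSemiring semiring) using (_^_) public

  private
    -- Gives the ring solver rational coefficients, so that identities containing the constant 1/2
    -- are decided.
    κ-morphism : Ring.rawRing ℚ.+-*-ring -Raw-AlmostCommutative⟶ fromCommutativeRing commutativeRing
    κ-morphism = record
      { ⟦_⟧ = κ ; +-homo = κ-+ ; *-homo = κ-* ; -‿homo = κ-neg ; 0-homo = refl ; 1-homo = refl }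

    κ-≟ : ∀ p q → Maybe (κ p ≈ κ q)
    κ-≟ p q with p ℚ.≟ q
    ... | yes p≡q = just (reflexive (≡.cong κ p≡q))
    ... | no  _   = nothing

  open RingSolver (Ring.rawRing ℚ.+-*-ring) (fromCommutativeRing commutativeRing) κ-morphism κ-≟ public
    using (solve; con; _:+_; _:*_; _:-_; :-_; _:=_)

  <-asym : ∀ {x y} → x < y → ¬ (y < x)
  <-asym x<y y<x = <-irrefl refl (<-trans x<y y<x)

  <⇒≤ : ∀ {x y} → x < y → x ≤ y
  <⇒≤ = <-asym

  ≈⇒≤ : ∀ {x y} → x ≈ y → x ≤ y
  ≈⇒≤ x≈y = <-irrefl (sym x≈y)

  -- Since `x ≤ y` is merely the negation of `y < x`, rules that conclude a strict inequality go
  -- through trichotomy.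
  <-≤-trans : ∀ {x y z} → x < y → y ≤ z → x < z
  <-≤-trans {x} {y} {z} x<y y≤z with <-cmp x z
  ... | inj₁ x<z        = x<z
  ... | inj₂ (inj₁ x≈z) = ⊥-elim (y≤z (<-respˡ-≈ x≈z x<y))
  ... | inj₂ (inj₂ z<x) = ⊥-elim (y≤z (<-trans z<x x<y))

  ≤-<-trans : ∀ {x y z} → x ≤ y → y < z → x < z
  ≤-<-trans {x} {y} {z} x≤y y<z with <-cmp x z
  ... | inj₁ x<z        = x<z
  ... | inj₂ (inj₁ x≈z) = ⊥-elim (x≤y (<-respʳ-≈ (sym x≈z) y<z))
  ... | inj₂ (inj₂ z<x) = ⊥-elim (x≤y (<-trans y<z z<x))

  ≤-trans : ∀ {x y z} → x ≤ y → y ≤ z → x ≤ z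
  ≤-trans x≤y y≤z z<x = x≤y (≤-<-trans y≤z z<x)

  ≤-antisym : ∀ {x y} → x ≤ y → y ≤ x → x ≈ y
  ≤-antisym {x} {y} x≤y y≤x with <-cmp x y
  ... | inj₁ x<y        = ⊥-elim (y≤x x<y)
  ... | inj₂ (inj₁ x≈y) = x≈y
  ... | inj₂ (inj₂ y<x) = ⊥-elim (x≤y y<x)

  ≤-isPreorder : IsPreorder _≈_ _≤_
  ≤-isPreorder = record { isEquivalence = isEquivalence ; reflexive = ≈⇒≤ ; trans = ≤-trans }

  module ≤-Reasoning = Triple ≤-isPreorder <-asym <-trans (<-respʳ-≈ , <-respˡ-≈) <⇒≤ <-≤-trans ≤-<-trans
  open ≤-Reasoning

  p<q⇒0<q-p : ∀ {p q} → p < q → 0# < q - p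
  p<q⇒0<q-p {p} {q} p<q = <-respˡ-≈ (-‿inverseʳ p) (+-monoˡ-< (- p) p<q)

  0<q-p⇒p<q : ∀ {p q} → 0# < q - p → p < q
  0<q-p⇒p<q {p} {q} 0<q-p = <-respˡ-≈ (+-identityˡ p)
    (<-respʳ-≈ (solve 2 (λ p q → q :- p :+ p := q) refl p q) (+-monoˡ-< p 0<q-p))

  q-p≈r⇒p<q : ∀ {p q r} → q - p ≈ r → 0# < r → p < q
  q-p≈r⇒p<q eq 0<r = 0<q-p⇒p<q (<-respʳ-≈ (sym eq) 0<r)

  q-p≈r⇒p≤q : ∀ {p q r} → q - p ≈ r → 0# ≤ r → p ≤ q
  q-p≈r⇒p≤q {p} {q} {r} eq 0≤r q<p = 0≤r (q-p≈r⇒p<q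
    (trans (+-congˡ (-‿cong (sym eq))) (solve 2 (λ p q → con 0ℚ :- (q :- p) := p :- q) refl p q)) (p<q⇒0<q-p q<p))

  p≤q⇒0≤q-p : ∀ {p q} → p ≤ q → 0# ≤ q - p
  p≤q⇒0≤q-p {p} {q} p≤q q-p<0 = p≤q (q-p≈r⇒p<q
    (solve 2 (λ p q → p :- q := con 0ℚ :- (q :- p)) refl p q) (p<q⇒0<q-p q-p<0))

  infixl 6 _0<+_ _0≤+_
  infixl 7 _0≤*_ _0<*_

  _0<+_ : ∀ {x y} → 0# < x → 0# ≤ y → 0# < x + y
  _0<+_ {x} {y} 0<x 0≤y = ≤-<-trans 0≤y (<-respˡ-≈ (+-identityˡ y) (+-monoˡ-< y 0<x))

  _0≤+_ : ∀ {x y} → 0# ≤ x → 0# ≤ y → 0# ≤ x + y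
  _0≤+_ {x} {y} 0≤x 0≤y x+y<0 = 0≤y (q-p≈r⇒p<q
    (solve 2 (λ x y → con 0ℚ :- y := x :- (x :+ y)) refl x y) (p<q⇒0<q-p (<-≤-trans x+y<0 0≤x)))

  _0<*_ : ∀ {x y} → 0# < x → 0# < y → 0# < x * y
  _0<*_ = *-pos

  _0≤*_ : ∀ {x y} → 0# ≤ x → 0# ≤ y → 0# ≤ x * y
  _0≤*_ {x} {y} 0≤x 0≤y with <-cmp 0# x | <-cmp 0# y
  ... | inj₂ (inj₂ x<0) | _               = ⊥-elim (0≤x x<0)
  ... | _               | inj₂ (inj₂ y<0) = ⊥-elim (0≤y y<0)
  ... | inj₂ (inj₁ 0≈x) | _               = ≈⇒≤ (trans (sym (zeroˡ y)) (*-congʳ 0≈x))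
  ... | inj₁ _          | inj₂ (inj₁ 0≈y) = ≈⇒≤ (trans (sym (zeroʳ x)) (*-congˡ 0≈y))
  ... | inj₁ 0<x        | inj₁ 0<y        = <⇒≤ (0<x 0<* 0<y)

  +-mono-<-≤ : ∀ {x y z w} → x < y → z ≤ w → x + z < y + w
  +-mono-<-≤ {x} {y} {z} {w} x<y z≤w = q-p≈r⇒p<q
    (solve 4 (λ x y z w → y :+ w :- (x :+ z) := (y :- x) :+ (w :- z)) refl x y z w)
    (p<q⇒0<q-p x<y 0<+ p≤q⇒0≤q-p z≤w)

  +-mono-≤ : ∀ {x y z w} → x ≤ y → z ≤ w → x + z ≤ y + w
  +-mono-≤ {x} {y} {z} {w} x≤y z≤w = q-p≈r⇒p≤q
    (solve 4 (λ x y z w → y :+ w :- (x :+ z) := (y :- x) :+ (w :- z)) refl x y z w)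
    (p≤q⇒0≤q-p x≤y 0≤+ p≤q⇒0≤q-p z≤w)

  *-monoˡ-< : ∀ {x y z} → 0# < x → y < z → x * y < x * z
  *-monoˡ-< {x} {y} {z} 0<x y<z = q-p≈r⇒p<q
    (solve 3 (λ x y z → x :* z :- x :* y := x :* (z :- y)) refl x y z) (0<x 0<* p<q⇒0<q-p y<z)

  *-monoˡ-≤ : ∀ {x y z} → 0# ≤ x → y ≤ z → x * y ≤ x * z
  *-monoˡ-≤ {x} {y} {z} 0≤x y≤z = q-p≈r⇒p≤q
    (solve 3 (λ x y z → x :* z :- x :* y := x :* (z :- y)) refl x y z) (0≤x 0≤* p≤q⇒0≤q-p y≤z)

  *-cancelˡ-≤ : ∀ {x y z} → 0# < x → x * y ≤ x * z → y ≤ z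
  *-cancelˡ-≤ 0<x xy≤xz z<y = xy≤xz (*-monoˡ-< 0<x z<y)

  *-cancelˡ-< : ∀ {x y z} → 0# < x → x * y < x * z → y < z
  *-cancelˡ-< {x} {y} {z} 0<x xy<xz with <-cmp y z
  ... | inj₁ y<z        = y<z
  ... | inj₂ (inj₁ y≈z) = ⊥-elim (<-irrefl (*-congˡ y≈z) xy<xz)
  ... | inj₂ (inj₂ z<y) = ⊥-elim (<-asym xy<xz (*-monoˡ-< 0<x z<y))

  κ-mono-≤ : ∀ {p q} → p ℚ.≤ q → κ p ≤ κ q
  κ-mono-≤ p≤q κq<κp = [ (λ p<q → <-asym κq<κp (κ-mono-< p<q)) , (λ p≡q → <-irrefl (reflexive (≡.cong κ (≡.sym p≡q))) κq<κp) ]′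
    (split p≤q)
    where
    split : ∀ {p q} → p ℚ.≤ q → p ℚ.< q ⊎ p ≡ q
    split {p} {q} p≤q with q ℚ.≤? p
    ... | yes q≤p = inj₂ (ℚ.≤-antisym p≤q q≤p)
    ... | no  q≰p = inj₁ (ℚ.≰⇒> q≰p)

  0<1 : 0# < 1#
  0<1 = κ-mono-< RationalOrder.0<1

  0≤1 : 0# ≤ 1#
  0≤1 = <⇒≤ 0<1

  0≤½ : 0# ≤ κ ½
  0≤½ = κ-mono-≤ RationalOrder.0≤½

  κℤ : ℤ → Carrier
  κℤ i = κ (i ℚ./ 1)

  κℤ-+ : ∀ i j → κℤ (i ℤ.+ j) ≈ κℤ i + κℤ j
  κℤ-+ i j = trans (reflexive (≡.cong κ (/1-+ i j))) (κ-+ (i ℚ./ 1) (j ℚ./ 1))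

  κℤ-* : ∀ i j → κℤ (i ℤ.* j) ≈ κℤ i * κℤ j
  κℤ-* i j = trans (reflexive (≡.cong κ (/1-* i j))) (κ-* (i ℚ./ 1) (j ℚ./ 1))

  κℤ-neg : ∀ i → κℤ (ℤ.- i) ≈ - κℤ i
  κℤ-neg i = trans (reflexive (≡.cong κ (/1-neg i))) (κ-neg (i ℚ./ 1))

  κℤ-mono-≤ : ∀ i j → i ℤ.≤ j → κℤ i ≤ κℤ j
  κℤ-mono-≤ i j i≤j = κ-mono-≤ (/1-mono-≤ i j i≤j)

  κℤ-cancel-< : ∀ i j → κℤ i < κℤ j → i ℤ.< j
  κℤ-cancel-< i j i<j = ℤ.≰⇒> λ j≤i → κℤ-mono-≤ j i j≤i i<j

  κι-suc : ∀ n → κ (ι (suc n)) ≈ 1# + κ (ι n)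
  κι-suc n = κℤ-+ 1ℤ (ℤ.+ n)

  0<κι : ∀ n → 0# < κ (ι (suc n))
  0<κι n = κ-mono-< (0<ι n)

  no-integer-between : ∀ i j {x} → κℤ i ≈ x → x < κℤ j → ¬ (κℤ j < x + 1#)
  no-integer-between i j {x} i≈x x<j j<x+1 = ℤ.<-irrefl ≡.refl
    (ℤ.<-≤-trans (κℤ-cancel-< j (i ℤ.+ 1ℤ) (<-respʳ-≈ (trans (+-congʳ (sym i≈x)) (sym (κℤ-+ i 1ℤ))) j<x+1))
      (≡.subst (ℤ._≤ j) (ℤ.+-comm 1ℤ i) (ℤ.i<j⇒suc[i]≤j (κℤ-cancel-< i j (<-respˡ-≈ (sym i≈x) x<j)))))

  -- Lowers the strict upper bound i + n one unit at a time, until i + n - 1 no longer exceeds x. It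
  -- cannot come down to i itself, because i ≤ x.
  floor-search : ∀ x i n → κℤ i ≤ x → x < κℤ (i ℤ.+ ℤ.+ n) → ∃ λ k → κℤ k ≤ x × x < κℤ (k ℤ.+ 1ℤ)
  floor-search x i zero    i≤x x<i+0 = ⊥-elim (i≤x (≡.subst (λ j → x < κℤ j) (ℤ.+-identityʳ i) x<i+0))
  floor-search x i (suc n) i≤x x<i+sn with <-cmp x (κℤ (i ℤ.+ ℤ.+ n))
  ... | inj₁ x<i+n        = floor-search x i n i≤x x<i+n
  ... | inj₂ i+n≤x        = i ℤ.+ ℤ.+ n , [ (λ x≈ → ≈⇒≤ (sym x≈)) , <⇒≤ ]′ i+n≤x ,
    ≡.subst (λ j → x < κℤ j) (≡.trans (≡.cong (λ j → i ℤ.+ j) (ℤ.+-comm 1ℤ (ℤ.+ n))) (≡.sym (ℤ.+-assoc i (ℤ.+ n) 1ℤ))) x<i+sn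

  floor-exists : ∀ x → ∃ λ k → κℤ k ≤ x × x < κℤ (k ℤ.+ 1ℤ)
  floor-exists x = floor-search x (ℤ.- ℤ.+ m) (m ℕ.+ n) -m≤x x<-m+m+n
    where
    m = proj₁ (unbounded (- x))
    n = proj₁ (unbounded x)
    -m≤x : κℤ (ℤ.- ℤ.+ m) ≤ x
    -m≤x = begin
      κℤ (ℤ.- ℤ.+ m)  ≈⟨ κℤ-neg (ℤ.+ m) ⟩
      - κ (ι m)       ≤⟨ <⇒≤ (q-p≈r⇒p<q (solve 2 (λ x m → x :- (:- m) := m :- (:- x)) refl x (κ (ι m))) (p<q⇒0<q-p (proj₂ (unbounded (- x))))) ⟩
      x               ∎
    x<-m+m+n : x < κℤ (ℤ.- ℤ.+ m ℤ.+ ℤ.+ (m ℕ.+ n))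
    x<-m+m+n = ≡.subst (λ j → x < κℤ j) (≡.sym (≡.trans (≡.sym (ℤ.+-assoc (ℤ.- ℤ.+ m) (ℤ.+ m) (ℤ.+ n)))
      (≡.trans (≡.cong (λ j → j ℤ.+ ℤ.+ n) (ℤ.+-inverseˡ (ℤ.+ m))) (ℤ.+-identityˡ (ℤ.+ n))))) (proj₂ (unbounded x))

  ^-nonNeg : ∀ {x} → 0# ≤ x → ∀ n → 0# ≤ x ^ n
  ^-nonNeg 0≤x zero    = 0≤1
  ^-nonNeg 0≤x (suc n) = 0≤x 0≤* ^-nonNeg 0≤x n

  ^-pos : ∀ {x} → 0# < x → ∀ n → 0# < x ^ n
  ^-pos 0<x zero    = 0<1
  ^-pos 0<x (suc n) = 0<x 0<* ^-pos 0<x n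

  ^-monoˡ-< : ∀ {x y} → 0# ≤ x → x < y → ∀ n → x ^ suc n < y ^ suc n
  ^-monoˡ-< {x} {y} 0≤x x<y zero    = <-respˡ-≈ (sym (*-identityʳ x)) (<-respʳ-≈ (sym (*-identityʳ y)) x<y)
  ^-monoˡ-< {x} {y} 0≤x x<y (suc n) = begin-strict
    x * x ^ suc n ≤⟨ *-monoˡ-≤ 0≤x (<⇒≤ (^-monoˡ-< 0≤x x<y n)) ⟩
    x * y ^ suc n ≈⟨ *-comm x (y ^ suc n) ⟩
    y ^ suc n * x <⟨ *-monoˡ-< (^-pos (≤-<-trans 0≤x x<y) (suc n)) x<y ⟩
    y ^ suc n * y ≈⟨ *-comm (y ^ suc n) y ⟩
    y * y ^ suc n ∎

  -- Uniqueness of nonnegative roots, by which a root known only through its defining property is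
  -- identified with e^(L/n).
  ^-injectiveˡ : ∀ {x y} → 0# ≤ x → 0# ≤ y → ∀ n → x ^ suc n ≈ y ^ suc n → x ≈ y
  ^-injectiveˡ {x} {y} 0≤x 0≤y n eq with <-cmp x y
  ... | inj₁ x<y        = ⊥-elim (<-irrefl eq (^-monoˡ-< 0≤x x<y n))
  ... | inj₂ (inj₁ x≈y) = x≈y
  ... | inj₂ (inj₂ y<x) = ⊥-elim (<-irrefl (sym eq) (^-monoˡ-< 0≤y y<x n))

-- Comparison of the two floors and separation of exceptional indices.

module FloorComparison (F : ExponentialField) where
  open ExponentialField F
  open RationalOrder using (ι; ι*1/; ι-mono-≤; 0<1/)
  open OrderedFieldProperties F
  open ≤-Reasoning

  1≤exp : ∀ {h} → 0# < h → 1# ≤ exp h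
  1≤exp {h} 0<h = ≤-trans (q-p≈r⇒p≤q
    (solve 1 (λ h → con 1ℚ :+ h :+ con ½ :* (h :* h) :- con 1ℚ := h :+ con ½ :* (h :* h)) refl h)
    (<⇒≤ 0<h 0≤+ 0≤½ 0≤* (<⇒≤ 0<h 0≤* <⇒≤ 0<h))) (exp-lower 0<h)

  exp-^ : ∀ x n → exp (κ (ι n) * x) ≈ exp x ^ n
  exp-^ x zero    = trans (exp-cong (zeroˡ x)) exp-0
  exp-^ x (suc n) = begin-equality
    exp (κ (ι (suc n)) * x)        ≈⟨ exp-cong (trans (*-congʳ (κι-suc n)) (solve 2 (λ c x → (con 1ℚ :+ c) :* x := x :+ c :* x) refl (κ (ι n)) x)) ⟩
    exp (x + κ (ι n) * x)          ≈⟨ exp-+ x (κ (ι n) * x) ⟩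
    exp x * exp (κ (ι n) * x)      ≈⟨ *-congˡ (exp-^ x n) ⟩
    exp x * exp x ^ n              ∎

  -- For negative x the factor e^(-x) is at least 1, so e^x ≤ e^x e^(-x) = 1.
  1<exp⇒0< : ∀ {x} → 1# < exp x → 0# < x
  1<exp⇒0< {x} 1<eˣ with <-cmp 0# x
  ... | inj₁ 0<x        = 0<x
  ... | inj₂ (inj₁ 0≈x) = ⊥-elim (<-irrefl (trans (sym exp-0) (exp-cong 0≈x)) 1<eˣ)
  ... | inj₂ (inj₂ x<0) = ⊥-elim (<-irrefl refl (begin-strict
    exp x             ≈⟨ *-identityʳ (exp x) ⟨
    exp x * 1#        ≤⟨ *-monoˡ-≤ (<⇒≤ (<-trans 0<1 1<eˣ)) (1≤exp (q-p≈r⇒p<q (solve 1 (λ x → :- x :- con 0ℚ := con 0ℚ :- x) refl x) (p<q⇒0<q-p x<0))) ⟩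
    exp x * exp (- x) ≈⟨ exp-+ x (- x) ⟨
    exp (x - x)       ≈⟨ exp-cong (-‿inverseʳ x) ⟩
    exp 0#            ≈⟨ exp-0 ⟩
    1#                <⟨ 1<eˣ ⟩
    exp x             ∎))

  module _ {θ L : Carrier} (1<θ : 1# < θ) (eᴸ≈θ : exp L ≈ θ) where

    0<L : 0# < L
    0<L = 1<exp⇒0< (<-respʳ-≈ (sym eᴸ≈θ) 1<θ)

    -- Here and below the index m stands for the positive integer n = m + 1.
    h : ℕ → Carrier
    h m = L * κ (1ℤ ℚ./ suc m)

    0<h : ∀ m → 0# < h m
    0<h m = 0<L 0<* κ-mono-< (0<1/ m)

    κι*h : ∀ m → κ (ι (suc m)) * h m ≈ L
    κι*h m = begin-equality
      κ (ι (suc m)) * (L * κ (1ℤ ℚ./ suc m)) ≈⟨ solve 3 (λ c l r → c :* (l :* r) := l :* (c :* r)) refl (κ (ι (suc m))) L (κ (1ℤ ℚ./ suc m)) ⟩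
      L * (κ (ι (suc m)) * κ (1ℤ ℚ./ suc m)) ≈⟨ *-congˡ (κ-* (ι (suc m)) (1ℤ ℚ./ suc m)) ⟨
      L * κ (ι (suc m) ℚ.* (1ℤ ℚ./ suc m))   ≡⟨ ≡.cong (λ q → L * κ q) (ι*1/ m) ⟩
      L * 1#                                 ≈⟨ *-identityʳ L ⟩
      L                                      ∎

    h-vanishes : ∀ {η} → 0# < η → ∃ λ N → ∀ m → N ℕ.≤ m → h m < η
    h-vanishes {η} 0<η = N , λ m N≤m → *-cancelˡ-< (0<κι m) (begin-strict
        κ (ι (suc m)) * h m ≈⟨ κι*h m ⟩
        L                   ≈⟨ *-identityʳ L ⟨
        L * 1#              ≈⟨ *-congˡ (proj₂ (inverse 0<η)) ⟨
        L * (η * η⁻¹)       ≈⟨ solve 3 (λ l e i → l :* (e :* i) := e :* (l :* i)) refl L η η⁻¹ ⟩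
        η * (L * η⁻¹)       <⟨ *-monoˡ-< 0<η (proj₂ (unbounded (L * η⁻¹))) ⟩
        η * κ (ι N)         ≤⟨ *-monoˡ-≤ (<⇒≤ 0<η) (κ-mono-≤ (ι-mono-≤ N (suc m) (ℕ.m≤n⇒m≤1+n N≤m))) ⟩
        η * κ (ι (suc m))   ≈⟨ *-comm η (κ (ι (suc m))) ⟩
        κ (ι (suc m)) * η   ∎)
      where
      η⁻¹ = proj₁ (inverse 0<η)
      N = proj₁ (unbounded (L * η⁻¹))

    0≤exph : ∀ m → 0# ≤ exp (h m)
    0≤exph m = ≤-trans 0≤1 (1≤exp (0<h m))

    exph^ : ∀ m → exp (h m) ^ suc m ≈ θ
    exph^ m = trans (sym (exp-^ (h m) (suc m))) (trans (exp-cong (κι*h m)) eᴸ≈θ)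

    root≈exph : ∀ m {r} → 0# ≤ r → r ^ suc m ≈ θ → r ≈ exp (h m)
    root≈exph m 0≤r r^≈θ = ^-injectiveˡ 0≤r (0≤exph m) m (trans r^≈θ (sym (exph^ m)))

    h+½h²≤exph-1 : ∀ m → h m + κ ½ * (h m * h m) ≤ exp (h m) - 1#
    h+½h²≤exph-1 m = q-p≈r⇒p≤q
      (solve 3 (λ e x y → e :- con 1ℚ :- (x :+ y) := e :- (con 1ℚ :+ x :+ y)) refl (exp (h m)) (h m) (κ ½ * (h m * h m)))
      (p≤q⇒0≤q-p (exp-lower (0<h m)))

    0<exph-1 : ∀ m → 0# < exp (h m) - 1#
    0<exph-1 m = <-≤-trans (0<h m 0<+ 0≤½ 0≤* (<⇒≤ (0<h m) 0≤* <⇒≤ (0<h m))) (h+½h²≤exph-1 m)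

    root-exists : ∀ m → ∃ λ r → 0# ≤ r × r ^ suc m ≈ θ
    root-exists m = exp (h m) , 0≤exph m , exph^ m

    0<root-1 : ∀ m {r} → 0# ≤ r → r ^ suc m ≈ θ → 0# < r - 1#
    0<root-1 m 0≤r r^≈θ = <-respʳ-≈ (+-congʳ (sym (root≈exph m 0≤r r^≈θ))) (0<exph-1 m)

    module _ {α : Carrier} (Lα≈1 : L * α ≈ 1#) where

      v : ℕ → Carrier
      v m = κ (ι (suc m)) * α - κ ½

      h*κια : ∀ m → h m * (κ (ι (suc m)) * α) ≈ 1#
      h*κια m = begin-equality
        h m * (κ (ι (suc m)) * α) ≈⟨ solve 3 (λ h c a → h :* (c :* a) := c :* h :* a) refl (h m) (κ (ι (suc m))) α ⟩
        κ (ι (suc m)) * h m * α   ≈⟨ *-congʳ (κι*h m) ⟩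
        L * α                     ≈⟨ Lα≈1 ⟩
        1#                        ∎

      -- With u = e^h - 1 and x = 1/h, the bound (2 - h) u ≤ 2h is 1/h - 1/2 ≤ 1/u.
      v≤1/[exph-1] : ∀ m {w} → (exp (h m) - 1#) * w ≈ 1# → v m ≤ w
      v≤1/[exph-1] m {w} uw≈1 = *-cancelˡ-≤ (*-pos (0<h m) (0<exph-1 m)) (begin
        hₘ * u * (x - κ ½)
          ≈⟨ solve 3 (λ h u x → h :* u :* (x :- con ½) := (h :* x) :* u :- con ½ :* (h :* u)) refl hₘ u x ⟩
        (hₘ * x) * u - κ ½ * (hₘ * u)
          ≈⟨ +-congʳ (*-congʳ (h*κια m)) ⟩
        1# * u - κ ½ * (hₘ * u)
          ≈⟨ solve 2 (λ h e → con 1ℚ :* (e :- con 1ℚ) :- con ½ :* (h :* (e :- con 1ℚ)) :=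
               con ½ :* ((con 1ℚ :+ con 1ℚ :- h) :* e) :- con 1ℚ :+ con ½ :* h) refl hₘ (exp hₘ) ⟩
        κ ½ * ((1# + 1# - hₘ) * exp hₘ) - 1# + κ ½ * hₘ
          ≤⟨ +-mono-≤ (+-mono-≤ (*-monoˡ-≤ 0≤½ (exp-upper (0<h m))) (≈⇒≤ refl)) (≈⇒≤ refl) ⟩
        κ ½ * (1# + 1# + hₘ) - 1# + κ ½ * hₘ
          ≈⟨ solve 1 (λ h → con ½ :* (con 1ℚ :+ con 1ℚ :+ h) :- con 1ℚ :+ con ½ :* h := h :* con 1ℚ) refl hₘ ⟩
        hₘ * 1#
          ≈⟨ *-congˡ uw≈1 ⟨
        hₘ * (u * w)
          ≈⟨ *-assoc hₘ u w ⟨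
        hₘ * u * w ∎)
        where
        hₘ = h m
        u = exp hₘ - 1#
        x = κ (ι (suc m)) * α

      -- With a = h + h²/2 ≤ e^h - 1 it suffices that 1 ≤ a (1/h - 1/2 + h), and the right side is 1
      -- + 3h²/4 + h³/2. Any error tending to 0 would serve later; h makes all coefficients of this
      -- difference nonnegative.
      1/[exph-1]≤v+h : ∀ m {w} → (exp (h m) - 1#) * w ≈ 1# → w ≤ v m + h m
      1/[exph-1]≤v+h m {w} uw≈1 = *-cancelˡ-≤ 0<a (begin
        a * w             ≈⟨ *-comm a w ⟩
        w * a             ≤⟨ *-monoˡ-≤ (<⇒≤ 0<w) (h+½h²≤exph-1 m) ⟩
        w * u             ≈⟨ trans (*-comm w u) uw≈1 ⟩
        1#                ≤⟨ q-p≈r⇒p≤q (solve 1 (λ h →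
                               con 1ℚ :+ con ½ :* (con 1ℚ :* h) :+ (h :+ con ½ :* (h :* h)) :* (h :- con ½) :- con 1ℚ
                               := con ½ :* (h :* h) :+ con ½ :* (h :* h) :* h :+ con ½ :* con ½ :* (h :* h)) refl hₘ)
                             (0≤½ 0≤* 0≤h² 0≤+ 0≤½ 0≤* 0≤h² 0≤* 0≤h 0≤+ 0≤½ 0≤* 0≤½ 0≤* 0≤h²) ⟩
        1# + κ ½ * (1# * hₘ) + a * (hₘ - κ ½)
                          ≈⟨ +-congʳ (+-cong (h*κια m) (*-congˡ (*-congʳ (h*κια m)))) ⟨
        hₘ * x + κ ½ * (hₘ * x * hₘ) + a * (hₘ - κ ½)
                          ≈⟨ solve 2 (λ h x → h :* x :+ con ½ :* (h :* x :* h) :+ (h :+ con ½ :* (h :* h)) :* (h :- con ½)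
                               := (h :+ con ½ :* (h :* h)) :* (x :- con ½ :+ h)) refl hₘ x ⟩
        a * (v m + hₘ)    ∎)
        where
        hₘ = h m
        u = exp hₘ - 1#
        x = κ (ι (suc m)) * α
        a = hₘ + κ ½ * (hₘ * hₘ)
        0≤h : 0# ≤ hₘ
        0≤h = <⇒≤ (0<h m)
        0≤h² : 0# ≤ hₘ * hₘ
        0≤h² = 0≤h 0≤* 0≤h
        0<a : 0# < a
        0<a = 0<h m 0<+ 0≤½ 0≤* 0≤h²
        0<w : 0# < w
        0<w = *-cancelˡ-< (0<exph-1 m) (<-respˡ-≈ (sym (zeroʳ u)) (<-respʳ-≈ (sym uw≈1) 0<1))

      IsFloor : Carrier → ℤ → Set
      IsFloor y k = κℤ k ≤ y × y < κℤ (k ℤ.+ 1ℤ)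

      Exceptional : ℕ → Set
      Exceptional m = ∃ λ k → v m < κℤ k × κℤ k ≤ v m + h m

      -- The witness is i, the floor of w. From v ≤ w follows j ≤ i, and i ≠ j improves this to j +
      -- 1 ≤ i, whence v < j + 1 ≤ i ≤ w ≤ v + h.
      exceptional : ∀ m {w i j} → (exp (h m) - 1#) * w ≈ 1# →
        IsFloor w i → IsFloor (v m) j → i ≢ j → Exceptional m
      exceptional m {w} {i} {j} uw≈1 (i≤w , w<i+1) (j≤v , v<j+1) i≢j =
        i , <-≤-trans v<j+1 (κℤ-mono-≤ (j ℤ.+ 1ℤ) i (≡.subst (ℤ._≤ i) (ℤ.+-comm 1ℤ j) (ℤ.i<j⇒suc[i]≤j j<i))) ,
        ≤-trans i≤w (1/[exph-1]≤v+h m uw≈1)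
        where
        j≤i : j ℤ.≤ i
        j≤i = ≡.subst (j ℤ.≤_) (ℤ.pred-suc i) (ℤ.i<j⇒i≤pred[j]
          (κℤ-cancel-< j (ℤ.suc i) (≤-<-trans j≤v (≤-<-trans (v≤1/[exph-1] m uw≈1)
            (≡.subst (λ k → w < κℤ k) (ℤ.+-comm i 1ℤ) w<i+1)))))
        j<i : j ℤ.< i
        j<i = ℤ.≤∧≢⇒< j≤i (i≢j ∘ ≡.sym)

      v-shift : ∀ d m → v (suc d ℕ.+ m) ≈ v m + κ (ι (suc d)) * α
      v-shift d m = begin-equality
        κ (ι (suc (suc d ℕ.+ m))) * α - κ ½
          ≡⟨ ≡.cong (λ n → κ (ι n) * α - κ ½) (≡.sym (ℕ.+-suc (suc d) m)) ⟩
        κ (ι (suc d ℕ.+ suc m)) * α - κ ½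
          ≈⟨ +-congʳ (*-congʳ (κℤ-+ (ℤ.+ suc d) (ℤ.+ suc m))) ⟩
        (κ (ι (suc d)) + κ (ι (suc m))) * α - κ ½
          ≈⟨ solve 4 (λ c n a k → (c :+ n) :* a :- k := n :* a :- k :+ c :* a) refl (κ (ι (suc d))) (κ (ι (suc m))) α (κ ½) ⟩
        v m + κ (ι (suc d)) * α ∎

      Separated : ℕ → Set
      Separated d = ∃ λ N → ∀ m → N ℕ.≤ m → Exceptional m → ¬ Exceptional (suc d ℕ.+ m)

      -- If every c v is an integer, an exceptional m would put the integer c k strictly between c v
      -- and c v + c h. Once h < 1/c there is no room for it, so no large m is exceptional at all.
      separated-integral : ∀ d c (a : ℕ → ℤ) → 0# < κℤ c → (∀ m → κℤ (a m) ≈ κℤ c * v m) → Separated d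
      separated-integral d c a 0<c a≈ = N , λ m N≤m (k , v<k , k≤v+h) _ →
        no-integer-between (a m) (c ℤ.* k) (a≈ m)
          (begin-strict
            κℤ c * v m      <⟨ *-monoˡ-< 0<c v<k ⟩
            κℤ c * κℤ k     ≈⟨ κℤ-* c k ⟨
            κℤ (c ℤ.* k)    ∎)
          (begin-strict
            κℤ (c ℤ.* k)          ≈⟨ κℤ-* c k ⟩
            κℤ c * κℤ k           ≤⟨ *-monoˡ-≤ (<⇒≤ 0<c) k≤v+h ⟩
            κℤ c * (v m + h m)    ≈⟨ distribˡ (κℤ c) (v m) (h m) ⟩
            κℤ c * v m + κℤ c * h m
              <⟨ q-p≈r⇒p<q (solve 3 (λ x y z → x :+ y :- (x :+ z) := y :- z) refl (κℤ c * v m) (κℤ c * η) (κℤ c * h m))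
                   (p<q⇒0<q-p (*-monoˡ-< 0<c (proj₂ small m N≤m))) ⟩
            κℤ c * v m + κℤ c * η ≈⟨ +-congˡ (proj₂ (inverse 0<c)) ⟩
            κℤ c * v m + 1#       ∎)
        where
        η = proj₁ (inverse 0<c)
        0<η : 0# < η
        0<η = *-cancelˡ-< 0<c (<-respˡ-≈ (sym (zeroʳ (κℤ c))) (<-respʳ-≈ (sym (proj₂ (inverse 0<c))) 0<1))
        small = h-vanishes 0<η
        N = proj₁ small

      -- If dα = p then 2d v n = 2np - d is an integer, so that v n cannot be
      -- arbitrarily close to another integer.
      separated-rational : ∀ d p → κ (ι (suc d)) * α ≈ κℤ p → Separated d
      separated-rational d p dα≈p =
        separated-integral d (ℤ.+ suc d ℤ.+ ℤ.+ suc d) a (0<κι (d ℕ.+ suc d)) a≈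
        where
        a : ℕ → ℤ
        a m = ℤ.+ suc m ℤ.* (p ℤ.+ p) ℤ.+ ℤ.- (ℤ.+ suc d)
        a≈ : ∀ m → κℤ (a m) ≈ κℤ (ℤ.+ suc d ℤ.+ ℤ.+ suc d) * v m
        a≈ m = begin-equality
          κℤ (a m)
            ≈⟨ κℤ-+ (ℤ.+ suc m ℤ.* (p ℤ.+ p)) (ℤ.- (ℤ.+ suc d)) ⟩
          κℤ (ℤ.+ suc m ℤ.* (p ℤ.+ p)) + κℤ (ℤ.- (ℤ.+ suc d))
            ≈⟨ +-cong (κℤ-* (ℤ.+ suc m) (p ℤ.+ p)) (κℤ-neg (ℤ.+ suc d)) ⟩
          κℤ (ℤ.+ suc m) * κℤ (p ℤ.+ p) - κℤ (ℤ.+ suc d)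
            ≈⟨ +-congʳ (*-congˡ (trans (κℤ-+ p p) (sym (+-cong dα≈p dα≈p)))) ⟩
          κℤ (ℤ.+ suc m) * (κℤ (ℤ.+ suc d) * α + κℤ (ℤ.+ suc d) * α) - κℤ (ℤ.+ suc d)
            ≈⟨ solve 3 (λ n d a → n :* (d :* a :+ d :* a) :- d := (d :+ d) :* (n :* a :- con ½)) refl (κℤ (ℤ.+ suc m)) (κℤ (ℤ.+ suc d)) α ⟩
          (κℤ (ℤ.+ suc d) + κℤ (ℤ.+ suc d)) * v m
            ≈⟨ *-congʳ (κℤ-+ (ℤ.+ suc d) (ℤ.+ suc d)) ⟨
          κℤ (ℤ.+ suc d ℤ.+ ℤ.+ suc d) * v m ∎

      -- If p < dα < p + 1, then two exceptional indices at distance d put an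
      -- integer within o(1) of dα.
      separated-irrational : ∀ d p → κℤ p < κ (ι (suc d)) * α → κ (ι (suc d)) * α < κℤ p + 1# → Separated d
      separated-irrational d p p<dα dα<p+1 = N , λ m N≤m (k , v<k , k≤v+h) (k′ , v′<k′ , k′≤v′+h′) →
        no-integer-between p (k′ ℤ.- k) refl
          -- Subtracting v < k ≤ v + h from v′ < k′ ≤ v′ + h′ gives dα - h < k′ - k < dα + h′.
          -- Beyond N both errors are smaller than the distances from dα to p and to p + 1.
          (begin-strict
            κℤ p
              <⟨ q-p≈r⇒p<q (solve 3 (λ x p h → x :- h :- p := x :- p :- h) refl dα (κℤ p) (h m)) (p<q⇒0<q-p (proj₂ small₁ m (ℕ.m⊔n≤o⇒m≤o N₁ N₂ N≤m))) ⟩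
            dα - h m
              ≤⟨ q-p≈r⇒p≤q (solve 5 (λ x h k k′ v → k′ :- k :- (x :- h) := k′ :- (v :+ x) :+ (v :+ h :- k)) refl dα (h m) (κℤ k) (κℤ k′) (v m))
                   (p≤q⇒0≤q-p (<⇒≤ (<-respˡ-≈ (v-shift d m) v′<k′)) 0≤+ p≤q⇒0≤q-p k≤v+h) ⟩
            κℤ k′ - κℤ k
              ≈⟨ κℤ-minus k′ k ⟨
            κℤ (k′ ℤ.- k) ∎)
          (begin-strict
            κℤ (k′ ℤ.- k)
              ≈⟨ κℤ-minus k′ k ⟩
            κℤ k′ - κℤ k
              ≤⟨ q-p≈r⇒p≤q (solve 5 (λ x h k k′ v → x :+ h :- (k′ :- k) := v :+ x :+ h :- k′ :+ (k :- v)) refl dα (h (suc d ℕ.+ m)) (κℤ k) (κℤ k′) (v m))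
                   (p≤q⇒0≤q-p (≤-trans k′≤v′+h′ (≈⇒≤ (+-congʳ (v-shift d m)))) 0≤+ p≤q⇒0≤q-p (<⇒≤ v<k)) ⟩
            dα + h (suc d ℕ.+ m)
              <⟨ q-p≈r⇒p<q (solve 3 (λ x p h → p :+ con 1ℚ :- (x :+ h) := p :+ con 1ℚ :- x :- h) refl dα (κℤ p) (h (suc d ℕ.+ m)))
                   (p<q⇒0<q-p (proj₂ small₂ (suc d ℕ.+ m) (ℕ.≤-trans (ℕ.m⊔n≤o⇒n≤o N₁ N₂ N≤m) (ℕ.m≤n+m m (suc d))))) ⟩
            κℤ p + 1# ∎)
        where
        dα = κ (ι (suc d)) * α
        small₁ = h-vanishes (p<q⇒0<q-p p<dα)
        small₂ = h-vanishes (p<q⇒0<q-p dα<p+1)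
        N₁ = proj₁ small₁
        N₂ = proj₁ small₂
        N = N₁ ℕ.⊔ N₂
        κℤ-minus : ∀ i j → κℤ (i ℤ.- j) ≈ κℤ i - κℤ j
        κℤ-minus i j = trans (κℤ-+ i (ℤ.- j)) (+-congˡ (κℤ-neg j))

      -- The case split is whether (d + 1) α equals its floor p, for this one d; rationality of α is
      -- never decided.
      separated : ∀ d → Separated d
      separated d = [ (λ p<dα → separated-irrational d p p<dα (<-respʳ-≈ (κℤ-+ p 1ℤ) dα<p+1)) ,
                      [ (λ p≈dα → separated-rational d p (sym p≈dα)) , (λ dα<p → ⊥-elim (p≤dα dα<p)) ]′ ]′
                    (<-cmp (κℤ p) (κ (ι (suc d)) * α))
        where
        floor = floor-exists (κ (ι (suc d)) * α)
        p = proj₁ floor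
        p≤dα = proj₁ (proj₂ floor)
        dα<p+1 = proj₂ (proj₂ floor)

      -- Root, reciprocal and floors are quantified and described by their defining properties. The
      -- chosen values in ℝ then fit in through their specifications, without unfolding.
      FloorsDiffer : ℕ → Set
      FloorsDiffer m = ∃ λ r → ∃ λ w → ∃ λ i → ∃ λ j →
        (0# ≤ r × r ^ suc m ≈ θ) × (r - 1#) * w ≈ 1# × IsFloor w i × IsFloor (v m) j × i ≢ j

      floors-differ⇒exceptional : ∀ m → FloorsDiffer m → Exceptional m
      floors-differ⇒exceptional m (r , w , i , j , (0≤r , r^≈θ) , uw≈1 , i-floor , j-floor , i≢j) =
        exceptional m (trans (*-congʳ (+-congʳ (sym (root≈exph m 0≤r r^≈θ)))) uw≈1) i-floor j-floor i≢j

      floors-differ-gaps : ∀ d → ∃ λ N → ∀ m → N ℕ.≤ m → FloorsDiffer m → ¬ FloorsDiffer (suc d ℕ.+ m)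
      floors-differ-gaps d = proj₁ (separated d) , λ m N≤m x y →
        proj₂ (separated d) m N≤m (floors-differ⇒exceptional m x) (floors-differ⇒exceptional (suc d ℕ.+ m) y)

open Defs using (_≈_; _<_; _≤_; _+_; _-_; -_; _*_; _^_)

-- The reals as an Archimedean ordered field.

module RealField where
  open ≡ using (refl; sym; trans; cong; cong₂; subst)
  open RationalOrder
  open +-*-Solver using (solve; con; _:+_; _:*_; _:-_; :-_; _:=_)
  open ℚ.≤-Reasoning

  Eventually : (ℕ → Set) → Set
  Eventually P = ∃ λ N → ∀ n → N ℕ.≤ n → P n

  -- `x ≈ y` unfolds to `Null` of the termwise difference, so congruence of the operations reduces
  -- to closure properties of null sequences.
  Null : (ℕ → ℚ) → Set
  Null s = ∀ ε → 0ℚ ℚ.< ε → Eventually λ n → ℚ.∣ s n ∣ ℚ.< ε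

  map : ∀ {P Q : ℕ → Set} → (∀ {n} → P n → Q n) → Eventually P → Eventually Q
  map f (N , h) = N , λ n N≤n → f (h n N≤n)

  zip : ∀ {P Q R : ℕ → Set} → (∀ {n} → P n → Q n → R n) → Eventually P → Eventually Q → Eventually R
  zip f (M , g) (N , h) = M ℕ.⊔ N , λ n n≥ → f (g n (ℕ.m⊔n≤o⇒m≤o M N n≥)) (h n (ℕ.m⊔n≤o⇒n≤o M N n≥))

  eventually-≥ : ∀ N → Eventually (N ℕ.≤_)
  eventually-≥ N = N , λ _ N≤n → N≤n

  never : ∀ {P : ℕ → Set} → (∀ {n} → ¬ P n) → ¬ Eventually P
  never ¬p (N , h) = ¬p (h N ℕ.≤-refl)

  null-resp : ∀ {s t} → (∀ n → s n ≡ t n) → Null s → Null t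
  null-resp s≡t null ε 0<ε = map (λ {n} → subst (λ q → ℚ.∣ q ∣ ℚ.< ε) (s≡t n)) (null ε 0<ε)

  null-dominated : ∀ {s t} → Eventually (λ n → ℚ.∣ t n ∣ ℚ.≤ ℚ.∣ s n ∣) → Null s → Null t
  null-dominated t≤s null ε 0<ε = zip ℚ.≤-<-trans t≤s (null ε 0<ε)

  null-zero : Null λ _ → 0ℚ
  null-zero ε 0<ε = 0 , λ _ _ → 0<ε

  null-+ : ∀ {s t} → Null s → Null t → Null λ n → s n ℚ.+ t n
  null-+ {s} {t} ns nt ε 0<ε = zip (λ {n} → add n) (ns (½ ℚ.* ε) (½*-pos 0<ε)) (nt (½ ℚ.* ε) (½*-pos 0<ε))
    where
    add : ∀ n → ℚ.∣ s n ∣ ℚ.< ½ ℚ.* ε → ℚ.∣ t n ∣ ℚ.< ½ ℚ.* ε → ℚ.∣ s n ℚ.+ t n ∣ ℚ.< ε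
    add n s<½ε t<½ε = begin-strict
      ℚ.∣ s n ℚ.+ t n ∣          ≤⟨ ℚ.∣p+q∣≤∣p∣+∣q∣ (s n) (t n) ⟩
      ℚ.∣ s n ∣ ℚ.+ ℚ.∣ t n ∣    <⟨ ℚ.+-mono-< s<½ε t<½ε ⟩
      ½ ℚ.* ε ℚ.+ ½ ℚ.* ε        ≡⟨ halves ε ⟩
      ε                          ∎

  null-neg : ∀ {s} → Null s → Null λ n → ℚ.- s n
  null-neg {s} = null-dominated (0 , λ n _ → ℚ.≤-reflexive (ℚ.∣-p∣≡∣p∣ (s n)))

  null-* : ∀ {s t : ℕ → ℚ} → (∃ λ B → 0ℚ ℚ.< B × Eventually λ n → ℚ.∣ s n ∣ ℚ.≤ B) → Null t → Null λ n → s n ℚ.* t n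
  null-* {s} {t} (B , 0<B , s≤B) nt ε 0<ε = zip (λ {n} → bound n) s≤B (nt δ (proj₁ (proj₂ δ-scale)))
    where
    δ-scale = scale 0<B 0<ε
    δ = proj₁ δ-scale
    bound : ∀ n → ℚ.∣ s n ∣ ℚ.≤ B → ℚ.∣ t n ∣ ℚ.< δ → ℚ.∣ s n ℚ.* t n ∣ ℚ.< ε
    bound n s≤B t<δ = subst (ℚ.∣ s n ℚ.* t n ∣ ℚ.<_) (proj₂ (proj₂ δ-scale)) (∣*∣-bound {s n} {t n} 0<B s≤B t<δ)

  bounded : ∀ x → ∃ λ B → 0ℚ ℚ.< B × Eventually λ n → ℚ.∣ seq x n ∣ ℚ.≤ B
  bounded x = eventually-bounded {seq x} (cauchy x)

  pointwise : ∀ {x y} → (∀ n → seq x n ≡ seq y n) → x ≈ y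
  pointwise {x} {y} x≡y = null-resp {λ _ → 0ℚ} {λ n → seq x n ℚ.- seq y n}
    (λ n → sym (trans (cong (ℚ._- seq y n) (x≡y n)) (ℚ.+-inverseʳ (seq y n)))) null-zero

  ≈-refl : ∀ {x} → x ≈ x
  ≈-refl {x} = pointwise {x} {x} λ _ → refl

  ≈-sym : ∀ {x y} → x ≈ y → y ≈ x
  ≈-sym {x} {y} x≈y = null-resp {λ n → ℚ.- (seq x n ℚ.- seq y n)} {λ n → seq y n ℚ.- seq x n}
    (λ n → solve 2 (λ x y → :- (x :- y) := y :- x) refl (seq x n) (seq y n))
    (null-neg {λ n → seq x n ℚ.- seq y n} x≈y)

  ≈-trans : ∀ {x y z} → x ≈ y → y ≈ z → x ≈ z
  ≈-trans {x} {y} {z} x≈y y≈z = null-resp {λ n → (seq x n ℚ.- seq y n) ℚ.+ (seq y n ℚ.- seq z n)} {λ n → seq x n ℚ.- seq z n}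
    (λ n → solve 3 (λ x y z → (x :- y) :+ (y :- z) := x :- z) refl (seq x n) (seq y n) (seq z n))
    (null-+ {λ n → seq x n ℚ.- seq y n} {λ n → seq y n ℚ.- seq z n} x≈y y≈z)

  +-cong : ∀ {x y u v} → x ≈ y → u ≈ v → x + u ≈ y + v
  +-cong {x} {y} {u} {v} x≈y u≈v = null-resp {λ n → (seq x n ℚ.- seq y n) ℚ.+ (seq u n ℚ.- seq v n)} {λ n → (seq x n ℚ.+ seq u n) ℚ.- (seq y n ℚ.+ seq v n)}
    (λ n → solve 4 (λ x y u v → (x :- y) :+ (u :- v) := (x :+ u) :- (y :+ v)) refl (seq x n) (seq y n) (seq u n) (seq v n))
    (null-+ {λ n → seq x n ℚ.- seq y n} {λ n → seq u n ℚ.- seq v n} x≈y u≈v)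

  -‿cong : ∀ {x y} → x ≈ y → - x ≈ - y
  -‿cong {x} {y} x≈y = null-resp {λ n → ℚ.- (seq x n ℚ.- seq y n)} {λ n → (ℚ.- seq x n) ℚ.- (ℚ.- seq y n)}
    (λ n → solve 2 (λ x y → :- (x :- y) := (:- x) :- (:- y)) refl (seq x n) (seq y n))
    (null-neg {λ n → seq x n ℚ.- seq y n} x≈y)

  *-cong : ∀ {x y u v} → x ≈ y → u ≈ v → x * u ≈ y * v
  *-cong {x} {y} {u} {v} x≈y u≈v =
    null-resp {λ n → seq x n ℚ.* (seq u n ℚ.- seq v n) ℚ.+ seq v n ℚ.* (seq x n ℚ.- seq y n)} {λ n → seq x n ℚ.* seq u n ℚ.- seq y n ℚ.* seq v n}
    (λ n → solve 4 (λ x y u v → x :* (u :- v) :+ v :* (x :- y) := x :* u :- y :* v) refl (seq x n) (seq y n) (seq u n) (seq v n))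
    (null-+ {λ n → seq x n ℚ.* (seq u n ℚ.- seq v n)} {λ n → seq v n ℚ.* (seq x n ℚ.- seq y n)}
      (null-* {seq x} {λ n → seq u n ℚ.- seq v n} (bounded x) u≈v)
      (null-* {seq v} {λ n → seq x n ℚ.- seq y n} (bounded v) x≈y))

  isCommutativeRing : IsCommutativeRing _≈_ _+_ _*_ -_ 0ℝ 1ℝ
  isCommutativeRing = record
    { isRing = record
      { +-isAbelianGroup = record
        { isGroup = record
          { isMonoid = record
            { isSemigroup = record
              { isMagma = record
                { isEquivalence = record
                  { refl  = λ {x} → ≈-refl {x}
                  ; sym   = λ {x} {y} → ≈-sym {x} {y}
                  ; trans = λ {x} {y} {z} → ≈-trans {x} {y} {z} }
                ; ∙-cong = λ {x} {y} {u} {v} → +-cong {x} {y} {u} {v} }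
              ; assoc = λ x y z → pointwise {(x + y) + z} {x + (y + z)} λ n → ℚ.+-assoc (seq x n) (seq y n) (seq z n) }
            ; identity = (λ x → pointwise {0ℝ + x} {x} λ n → ℚ.+-identityˡ (seq x n))
                       , (λ x → pointwise {x + 0ℝ} {x} λ n → ℚ.+-identityʳ (seq x n)) }
          ; inverse = (λ x → pointwise {(- x) + x} {0ℝ} λ n → ℚ.+-inverseˡ (seq x n))
                    , (λ x → pointwise {x + - x} {0ℝ} λ n → ℚ.+-inverseʳ (seq x n))
          ; ⁻¹-cong = λ {x} {y} → -‿cong {x} {y} }
        ; comm = λ x y → pointwise {x + y} {y + x} λ n → ℚ.+-comm (seq x n) (seq y n) }
      ; *-cong = λ {x} {y} {u} {v} → *-cong {x} {y} {u} {v}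
      ; *-assoc = λ x y z → pointwise {(x * y) * z} {x * (y * z)} λ n → ℚ.*-assoc (seq x n) (seq y n) (seq z n)
      ; *-identity = (λ x → pointwise {1ℝ * x} {x} λ n → ℚ.*-identityˡ (seq x n))
                   , (λ x → pointwise {x * 1ℝ} {x} λ n → ℚ.*-identityʳ (seq x n))
      ; distrib = (λ x y z → pointwise {x * (y + z)} {x * y + x * z} λ n → ℚ.*-distribˡ-+ (seq x n) (seq y n) (seq z n))
                , (λ x y z → pointwise {(y + z) * x} {y * x + z * x} λ n → ℚ.*-distribʳ-+ (seq x n) (seq y n) (seq z n)) }
    ; *-comm = λ x y → pointwise {x * y} {y * x} λ n → ℚ.*-comm (seq x n) (seq y n) }

  p+ε≰p : ∀ {p ε} → 0ℚ ℚ.< ε → ¬ (p ℚ.+ ε ℚ.≤ p)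
  p+ε≰p {p} {ε} 0<ε p+ε≤p = ℚ.<⇒≢ (ℚ.<-≤-trans (q-p≡r⇒p<q (solve 2 (λ p e → p :+ e :- p := e) refl p ε) 0<ε) p+ε≤p) refl

  <-irrefl : ∀ {x y} → x ≈ y → ¬ (x < y)
  <-irrefl {x} {y} x≈y (ε , 0<ε , x+ε≤y) = never absurd (zip _,_ (x≈y ε 0<ε) x+ε≤y)
    where
    absurd : ∀ {n} → ¬ (ℚ.∣ seq x n ℚ.- seq y n ∣ ℚ.< ε × seq x n ℚ.+ ε ℚ.≤ seq y n)
    absurd {n} (close , gap) = ℚ.<⇒≢ {ε} {ε} (begin-strict
      ε                           ≡⟨ solve 2 (λ x e → e := x :+ e :- x) refl (seq x n) ε ⟩
      seq x n ℚ.+ ε ℚ.- seq x n   ≤⟨ ℚ.+-monoˡ-≤ (ℚ.- seq x n) gap ⟩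
      seq y n ℚ.- seq x n         ≤⟨ p≤∣p∣ (seq y n ℚ.- seq x n) ⟩
      ℚ.∣ seq y n ℚ.- seq x n ∣   ≡⟨ ∣p-q∣≡∣q-p∣ (seq y n) (seq x n) ⟩
      ℚ.∣ seq x n ℚ.- seq y n ∣   <⟨ close ⟩
      ε                           ∎) refl

  <-trans : ∀ {x y z} → x < y → y < z → x < z
  <-trans {x} {y} {z} (ε , 0<ε , x+ε≤y) (δ , 0<δ , y+δ≤z) = ε , 0<ε , zip (λ {n} → step n) x+ε≤y y+δ≤z
    where
    step : ∀ n → seq x n ℚ.+ ε ℚ.≤ seq y n → seq y n ℚ.+ δ ℚ.≤ seq z n → seq x n ℚ.+ ε ℚ.≤ seq z n
    step n x≤ y≤ = q-p≡r⇒p≤q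
      (solve 5 (λ x y z e d → z :- (x :+ e) := z :- (y :+ d) :+ (y :- (x :+ e)) :+ d) refl (seq x n) (seq y n) (seq z n) ε δ)
      (p≤q⇒0≤q-p y≤ 0≤+ p≤q⇒0≤q-p x≤ 0≤+ ℚ.<⇒≤ 0<δ)

  <-respʳ-≈ : ∀ {x y z} → y ≈ z → x < y → x < z
  <-respʳ-≈ {x} {y} {z} y≈z (ε , 0<ε , x+ε≤y) = ½ ℚ.* ε , ½*-pos 0<ε , zip (λ {n} → step n) (y≈z (½ ℚ.* ε) (½*-pos 0<ε)) x+ε≤y
    where
    step : ∀ n → ℚ.∣ seq y n ℚ.- seq z n ∣ ℚ.< ½ ℚ.* ε → seq x n ℚ.+ ε ℚ.≤ seq y n → seq x n ℚ.+ ½ ℚ.* ε ℚ.≤ seq z n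
    step n close gap = q-p≡r⇒p≤q
      (solve 4 (λ x y z e → z :- (x :+ con ½ :* e) := con ½ :* e :- (y :- z) :+ (y :- (x :+ e))) refl (seq x n) (seq y n) (seq z n) ε)
      (p≤q⇒0≤q-p (ℚ.≤-trans (p≤∣p∣ (seq y n ℚ.- seq z n)) (ℚ.<⇒≤ close)) 0≤+ p≤q⇒0≤q-p gap)

  <-respˡ-≈ : ∀ {x y z} → x ≈ y → x < z → y < z
  <-respˡ-≈ {x} {y} {z} x≈y (ε , 0<ε , x+ε≤z) = ½ ℚ.* ε , ½*-pos 0<ε , zip (λ {n} → step n) (≈-sym {x} {y} x≈y (½ ℚ.* ε) (½*-pos 0<ε)) x+ε≤z
    where
    step : ∀ n → ℚ.∣ seq y n ℚ.- seq x n ∣ ℚ.< ½ ℚ.* ε → seq x n ℚ.+ ε ℚ.≤ seq z n → seq y n ℚ.+ ½ ℚ.* ε ℚ.≤ seq z n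
    step n close gap = q-p≡r⇒p≤q
      (solve 4 (λ x y z e → z :- (y :+ con ½ :* e) := con ½ :* e :- (y :- x) :+ (z :- (x :+ e))) refl (seq x n) (seq y n) (seq z n) ε)
      (p≤q⇒0≤q-p (ℚ.≤-trans (p≤∣p∣ (seq y n ℚ.- seq x n)) (ℚ.<⇒≤ close)) 0≤+ p≤q⇒0≤q-p gap)

  -- Past N the difference z of the two sequences moves by less than δ = ε/4. If z N were at least
  -- 2δ, or at most -2δ, a gap of δ would persist and the reals would be strictly ordered. Hence |z
  -- N| < 2δ, and |z n| < 3δ < ε from there on.
  ≮∧≯⇒≈ : ∀ {x y} → ¬ (x < y) → ¬ (y < x) → x ≈ y
  ≮∧≯⇒≈ {x} {y} x≮y y≮x ε 0<ε = N , close
    where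
    -- `0<ι 3` is positivity of 4.
    quarters = scale (0<ι 3) 0<ε
    δ = proj₁ quarters
    0<δ : 0ℚ ℚ.< δ
    0<δ = proj₁ (proj₂ quarters)
    4δ≡ε : δ ℚ.+ δ ℚ.+ δ ℚ.+ δ ≡ ε
    4δ≡ε = trans (solve 1 (λ d → d :+ d :+ d :+ d := con (ι 4) :* d) refl δ) (proj₂ (proj₂ quarters))
    z : ℕ → ℚ
    z n = seq x n ℚ.- seq y n
    tail = cauchy (x - y) δ 0<δ
    N = proj₁ tail
    ∣z-zN∣<δ : ∀ n → N ℕ.≤ n → ℚ.∣ z n ℚ.- z N ∣ ℚ.< δ
    ∣z-zN∣<δ n N≤n = proj₂ tail n N N≤n ℕ.≤-refl
    zN<2δ : z N ℚ.< δ ℚ.+ δ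
    zN<2δ = ℚ.≰⇒> λ 2δ≤zN → y≮x (δ , 0<δ , N , λ n N≤n → q-p≡r⇒p≤q
      (solve 4 (λ x y d c → x :- (y :+ d) := (d :- (c :- (x :- y))) :+ (c :- (d :+ d))) refl (seq x n) (seq y n) δ (z N))
      (p≤q⇒0≤q-p (ℚ.≤-trans (p≤∣p∣ (z N ℚ.- z n)) (subst (ℚ._≤ δ) (∣p-q∣≡∣q-p∣ (z n) (z N)) (ℚ.<⇒≤ (∣z-zN∣<δ n N≤n)))) 0≤+ p≤q⇒0≤q-p 2δ≤zN))
    -2δ<zN : ℚ.- (δ ℚ.+ δ) ℚ.< z N
    -2δ<zN = ℚ.≰⇒> λ zN≤-2δ → x≮y (δ , 0<δ , N , λ n N≤n → q-p≡r⇒p≤q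
      (solve 4 (λ x y d c → y :- (x :+ d) := (d :- (x :- y :- c)) :+ (:- (d :+ d) :- c)) refl (seq x n) (seq y n) δ (z N))
      (p≤q⇒0≤q-p (ℚ.≤-trans (p≤∣p∣ (z n ℚ.- z N)) (ℚ.<⇒≤ (∣z-zN∣<δ n N≤n))) 0≤+ p≤q⇒0≤q-p zN≤-2δ))
    close : ∀ n → N ℕ.≤ n → ℚ.∣ z n ∣ ℚ.< ε
    close n N≤n = begin-strict
      ℚ.∣ z n ∣                         ≡⟨ cong ℚ.∣_∣ (solve 2 (λ a b → a := a :- b :+ b) refl (z n) (z N)) ⟩
      ℚ.∣ z n ℚ.- z N ℚ.+ z N ∣         ≤⟨ ℚ.∣p+q∣≤∣p∣+∣q∣ (z n ℚ.- z N) (z N) ⟩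
      ℚ.∣ z n ℚ.- z N ∣ ℚ.+ ℚ.∣ z N ∣   <⟨ ℚ.+-mono-< (∣z-zN∣<δ n N≤n) (∣p∣<q zN<2δ
                                             (subst (ℚ.- z N ℚ.<_) (solve 1 (λ d → :- (:- d) := d) refl (δ ℚ.+ δ)) (ℚ.neg-antimono-< -2δ<zN))) ⟩
      δ ℚ.+ (δ ℚ.+ δ)                   <⟨ q-p≡r⇒p<q (solve 1 (λ d → d :+ d :+ d :+ d :- (d :+ (d :+ d)) := d) refl δ) 0<δ ⟩
      δ ℚ.+ δ ℚ.+ δ ℚ.+ δ               ≡⟨ 4δ≡ε ⟩
      ε                                 ∎

  <-cmp : ExcludedMiddle 0ℓ → ∀ x y → x < y ⊎ x ≈ y ⊎ y < x
  <-cmp em x y with em {x < y} | em {y < x}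
  ... | yes x<y | _       = inj₁ x<y
  ... | no  _   | yes y<x = inj₂ (inj₂ y<x)
  ... | no  x≮y | no  y≮x = inj₂ (inj₁ (≮∧≯⇒≈ {x} {y} x≮y y≮x))

  +-monoˡ-< : ∀ z {x y} → x < y → x + z < y + z
  +-monoˡ-< z {x} {y} (ε , 0<ε , x+ε≤y) = ε , 0<ε , map (λ {n} → step n) x+ε≤y
    where
    step : ∀ n → seq x n ℚ.+ ε ℚ.≤ seq y n → seq x n ℚ.+ seq z n ℚ.+ ε ℚ.≤ seq y n ℚ.+ seq z n
    step n gap = q-p≡r⇒p≤q (solve 4 (λ x y z e → y :+ z :- (x :+ z :+ e) := y :- (x :+ e)) refl (seq x n) (seq y n) (seq z n) ε) (p≤q⇒0≤q-p gap)

  *-pos : ∀ {x y} → 0ℝ < x → 0ℝ < y → 0ℝ < x * y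
  *-pos {x} {y} (ε , 0<ε , ε≤x) (δ , 0<δ , δ≤y) = ε ℚ.* δ , (0<ε 0<* 0<δ) , zip (λ {n} → step n) ε≤x δ≤y
    where
    step : ∀ n → 0ℚ ℚ.+ ε ℚ.≤ seq x n → 0ℚ ℚ.+ δ ℚ.≤ seq y n → 0ℚ ℚ.+ ε ℚ.* δ ℚ.≤ seq x n ℚ.* seq y n
    step n ε≤x δ≤y = subst (ℚ._≤ seq x n ℚ.* seq y n) (sym (ℚ.+-identityˡ (ε ℚ.* δ)))
      (*-mono-≤ (ℚ.≤-trans (ℚ.<⇒≤ 0<ε) ε≤xₙ) (ℚ.<⇒≤ 0<δ) ε≤xₙ (subst (ℚ._≤ seq y n) (ℚ.+-identityˡ δ) δ≤y))
      where
      ε≤xₙ : ε ℚ.≤ seq x n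
      ε≤xₙ = subst (ℚ._≤ seq x n) (ℚ.+-identityˡ ε) ε≤x

  fromℚ-mono-< : ∀ {p q} → p ℚ.< q → fromℚ p < fromℚ q
  fromℚ-mono-< {p} {q} p<q = q ℚ.- p , p<q⇒0<q-p p<q , 0 , λ _ _ → ℚ.≤-reflexive (solve 2 (λ p q → p :+ (q :- p) := q) refl p q)

  unbounded : ∀ x → ∃ λ n → x < fromℚ (ι n)
  unbounded x = n , ι n ℚ.- B , p<q⇒0<q-p (proj₂ (archimedean B)) , map (λ {k} → step k) (proj₂ (proj₂ (bounded x)))
    where
    B = proj₁ (bounded x)
    n = proj₁ (archimedean B)
    step : ∀ k → ℚ.∣ seq x k ∣ ℚ.≤ B → seq x k ℚ.+ (ι n ℚ.- B) ℚ.≤ ι n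
    step k x≤B = q-p≡r⇒p≤q (solve 3 (λ x i b → i :- (x :+ (i :- b)) := b :- x) refl (seq x k) (ι n) B) (p≤q⇒0≤q-p (ℚ.≤-trans (p≤∣p∣ (seq x k)) x≤B))

  module Reciprocal (x : ℝ) (ε : ℚ) (0<ε : 0ℚ ℚ.< ε) (ε≤x : Eventually λ n → 0ℚ ℚ.+ ε ℚ.≤ seq x n) where

    -- Truncating below at ε keeps every term invertible, and changes nothing from the index on
    -- where x already has this gap above 0.
    denominator : ℕ → ℚ
    denominator n = seq x n ℚ.⊔ ε

    ε≤denominator : ∀ n → ε ℚ.≤ denominator n
    ε≤denominator n = ℚ.p≤q⊔p (seq x n) ε

    reciprocal : ∀ {p} → ε ℚ.≤ p → ∃ λ q → 0ℚ ℚ.< q × p ℚ.* q ≡ 1ℚ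
    reciprocal ε≤p = scale (ℚ.<-≤-trans 0<ε ε≤p) 0<1

    y : ℕ → ℚ
    y n = proj₁ (reciprocal (ε≤denominator n))

    0≤y : ∀ n → 0ℚ ℚ.≤ y n
    0≤y n = ℚ.<⇒≤ (proj₁ (proj₂ (reciprocal (ε≤denominator n))))

    denominator*y : ∀ n → denominator n ℚ.* y n ≡ 1ℚ
    denominator*y n = proj₂ (proj₂ (reciprocal (ε≤denominator n)))

    C : ℚ
    C = proj₁ (reciprocal {ε} ℚ.≤-refl)
    0<C : 0ℚ ℚ.< C
    0<C = proj₁ (proj₂ (reciprocal {ε} ℚ.≤-refl))

    y≤C : ∀ n → y n ℚ.≤ C
    y≤C n = begin
      y n                             ≡⟨ ℚ.*-identityˡ (y n) ⟨
      1ℚ ℚ.* y n                      ≡⟨ cong (ℚ._* y n) (proj₂ (proj₂ (reciprocal {ε} ℚ.≤-refl))) ⟨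
      ε ℚ.* C ℚ.* y n                 ≤⟨ ℚ.*-monoʳ-≤-nonNeg (y n) {{ℚ.nonNegative (0≤y n)}} (ℚ.*-monoʳ-≤-nonNeg C {{ℚ.nonNegative (ℚ.<⇒≤ 0<C)}} (ε≤denominator n)) ⟩
      denominator n ℚ.* C ℚ.* y n     ≡⟨ solve 3 (λ d c y → d :* c :* y := c :* (d :* y)) refl (denominator n) C (y n) ⟩
      C ℚ.* (denominator n ℚ.* y n)   ≡⟨ cong (C ℚ.*_) (denominator*y n) ⟩
      C ℚ.* 1ℚ                        ≡⟨ ℚ.*-identityʳ C ⟩
      C                               ∎

    N = proj₁ ε≤x

    denominator≡x : ∀ n → N ℕ.≤ n → denominator n ≡ seq x n
    denominator≡x n N≤n = ℚ.p≥q⇒p⊔q≡p (subst (ℚ._≤ seq x n) (ℚ.+-identityˡ ε) (proj₂ ε≤x n N≤n))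

    ∣y∣≤C : ∀ n → ℚ.∣ y n ∣ ℚ.≤ C
    ∣y∣≤C n = subst (ℚ._≤ C) (sym (ℚ.0≤p⇒∣p∣≡p (0≤y n))) (y≤C n)

    x*y : ∀ n → N ℕ.≤ n → seq x n ℚ.* y n ≡ 1ℚ
    x*y n N≤n = trans (cong (ℚ._* y n) (sym (denominator≡x n N≤n))) (denominator*y n)

    -- Past N one has y m - y n = y m y n (x n - x m), and the reciprocals are bounded by C = 1/ε.
    y-cauchy : IsCauchy y
    y-cauchy η 0<η = N ℕ.⊔ K , λ m n m≥ n≥ →
      close m n (ℕ.m⊔n≤o⇒m≤o N K m≥) (ℕ.m⊔n≤o⇒m≤o N K n≥) (ℕ.m⊔n≤o⇒n≤o N K m≥) (ℕ.m⊔n≤o⇒n≤o N K n≥)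
      where
      δ-scale = scale (0<C 0<* 0<C) 0<η
      δ = proj₁ δ-scale
      tail = cauchy x δ (proj₁ (proj₂ δ-scale))
      K = proj₁ tail
      close : ∀ m n → N ℕ.≤ m → N ℕ.≤ n → K ℕ.≤ m → K ℕ.≤ n → ℚ.∣ y m ℚ.- y n ∣ ℚ.< η
      close m n N≤m N≤n K≤m K≤n = begin-strict
        ℚ.∣ y m ℚ.- y n ∣
          ≡⟨ cong ℚ.∣_∣ (trans (cong₂ ℚ._-_ (sym (trans (cong (y m ℚ.*_) (x*y n N≤n)) (ℚ.*-identityʳ (y m)))) (sym (trans (cong (y n ℚ.*_) (x*y m N≤m)) (ℚ.*-identityʳ (y n)))))
               (solve 4 (λ p q u v → u :* (q :* v) :- v :* (p :* u) := u :* v :* (q :- p)) refl (seq x m) (seq x n) (y m) (y n))) ⟩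
        ℚ.∣ y m ℚ.* y n ℚ.* (seq x n ℚ.- seq x m) ∣
          <⟨ ∣*∣-bound {y m ℚ.* y n} {seq x n ℚ.- seq x m} (0<C 0<* 0<C)
               (subst (ℚ._≤ C ℚ.* C) (sym (ℚ.∣p*q∣≡∣p∣*∣q∣ (y m) (y n))) (*-mono-≤ (ℚ.<⇒≤ 0<C) (ℚ.0≤∣p∣ (y n)) (∣y∣≤C m) (∣y∣≤C n)))
               (proj₂ tail n m K≤n K≤m) ⟩
        C ℚ.* C ℚ.* δ
          ≡⟨ proj₂ (proj₂ δ-scale) ⟩
        η ∎

    inv : ℝ
    inv = mkℝ y y-cauchy

    x*inv≈1 : x * inv ≈ 1ℝ
    x*inv≈1 η 0<η = N , λ n N≤n → subst (λ p → ℚ.∣ p ℚ.- 1ℚ ∣ ℚ.< η) (sym (x*y n N≤n)) 0<η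

  inverse : ∀ {x} → 0ℝ < x → ∃ λ y → x * y ≈ 1ℝ
  inverse {x} (ε , 0<ε , ε≤x) = inv , x*inv≈1
    where open Reciprocal x ε 0<ε ε≤x

  ≤-eventually : ∀ {x y} → Eventually (λ n → seq x n ℚ.≤ seq y n) → x ≤ y
  ≤-eventually {x} {y} x≤y (ε , 0<ε , y+ε≤x) = never (λ {n} → absurd n) (zip _,_ x≤y y+ε≤x)
    where
    absurd : ∀ n → ¬ (seq x n ℚ.≤ seq y n × seq y n ℚ.+ ε ℚ.≤ seq x n)
    absurd n (x≤y , y+ε≤x) = p+ε≰p 0<ε (ℚ.≤-trans y+ε≤x x≤y)

-- The exponential and the logarithm on Cauchy sequences.

module RealExponential where
  open ≡ using (refl; sym; trans; cong; cong₂; subst; subst₂)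
  open RationalOrder
  open RealField
  open ExponentialSums using (E; ∣E-E∣<ε; E-upper-bound; E-Lipschitz; ∣E*E-E∣≤; E-zero; 1+h+½h²≤E; [2-h]*E≤; E-growth; E-expansion; e; ∑; ∑-cong; 0≤∑; 0≤e)
  open +-*-Solver using (solve; con; _:+_; _:*_; _:-_; :-_; _:=_)
  open ℚ.≤-Reasoning

  -- First the length of the sum changes from m to n at a fixed argument, controlled by the uniform
  -- tail estimate. Then the argument changes at fixed length, controlled by the Lipschitz constant
  -- C.
  E-diagonal-cauchy : ∀ x → IsCauchy λ n → E (seq x n) n
  E-diagonal-cauchy x ε 0<ε = M , λ m n M≤m M≤n →
    let K≤m = ℕ.m⊔n≤o⇒m≤o K (N ℕ.⊔ P) M≤m
        K≤n = ℕ.m⊔n≤o⇒m≤o K (N ℕ.⊔ P) M≤n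
        NP≤m = ℕ.m⊔n≤o⇒n≤o K (N ℕ.⊔ P) M≤m
        NP≤n = ℕ.m⊔n≤o⇒n≤o K (N ℕ.⊔ P) M≤n
    in begin-strict
    ℚ.∣ E (seq x m) m ℚ.- E (seq x n) n ∣
      ≤⟨ ∣p-r∣≤∣p-q∣+∣q-r∣ (E (seq x m) m) (E (seq x m) n) (E (seq x n) n) ⟩
    ℚ.∣ E (seq x m) m ℚ.- E (seq x m) n ∣ ℚ.+ ℚ.∣ E (seq x m) n ℚ.- E (seq x n) n ∣
      <⟨ ℚ.+-mono-<
           (proj₂ uniform (x≤B m K≤m) m n (ℕ.m⊔n≤o⇒m≤o N P NP≤m) (ℕ.m⊔n≤o⇒m≤o N P NP≤n))
           (lipschitz m n K≤m K≤n (ℕ.m⊔n≤o⇒n≤o N P NP≤m) (ℕ.m⊔n≤o⇒n≤o N P NP≤n)) ⟩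
    ½ ℚ.* ε ℚ.+ ½ ℚ.* ε
      ≡⟨ halves ε ⟩
    ε ∎
    where
    B = proj₁ (bounded x)
    0≤B : 0ℚ ℚ.≤ B
    0≤B = ℚ.<⇒≤ (proj₁ (proj₂ (bounded x)))
    K = proj₁ (proj₂ (proj₂ (bounded x)))
    x≤B : ∀ n → K ℕ.≤ n → ℚ.∣ seq x n ∣ ℚ.≤ B
    x≤B = proj₂ (proj₂ (proj₂ (bounded x)))
    uniform = ∣E-E∣<ε 0≤B (½*-pos 0<ε)
    N = proj₁ uniform
    C = proj₁ (E-upper-bound 0≤B)
    0<C : 0ℚ ℚ.< C
    0<C = proj₁ (proj₂ (E-upper-bound 0≤B))
    δ-scale = scale 0<C (½*-pos 0<ε)
    δ = proj₁ δ-scale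
    tail = cauchy x δ (proj₁ (proj₂ δ-scale))
    P = proj₁ tail
    M = K ℕ.⊔ (N ℕ.⊔ P)
    lipschitz : ∀ m n → K ℕ.≤ m → K ℕ.≤ n → P ℕ.≤ m → P ℕ.≤ n → ℚ.∣ E (seq x m) n ℚ.- E (seq x n) n ∣ ℚ.< ½ ℚ.* ε
    lipschitz m n K≤m K≤n P≤m P≤n = begin-strict
      ℚ.∣ E (seq x m) n ℚ.- E (seq x n) n ∣
        ≤⟨ E-Lipschitz (x≤B m K≤m) (x≤B n K≤n) n ⟩
      ℚ.∣ seq x m ℚ.- seq x n ∣ ℚ.* E B n
        ≤⟨ ℚ.*-monoˡ-≤-nonNeg ℚ.∣ seq x m ℚ.- seq x n ∣ {{ℚ.∣-∣-nonNeg (seq x m ℚ.- seq x n)}} (proj₂ (proj₂ (E-upper-bound 0≤B)) n) ⟩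
      ℚ.∣ seq x m ℚ.- seq x n ∣ ℚ.* C
        <⟨ ℚ.*-monoˡ-<-pos C {{ℚ.positive 0<C}} (proj₂ tail m n P≤m P≤n) ⟩
      δ ℚ.* C
        ≡⟨ trans (ℚ.*-comm δ C) (proj₂ (proj₂ δ-scale)) ⟩
      ½ ℚ.* ε ∎

  Exp : ℝ → ℝ
  Exp x = mkℝ (λ n → E (seq x n) n) (E-diagonal-cauchy x)

  -- The common bound B + B′ for both arguments gives one Lipschitz constant C valid for all partial
  -- sums.
  Exp-cong : ∀ {x y} → x ≈ y → Exp x ≈ Exp y
  Exp-cong {x} {y} x≈y = null-dominated {λ n → C ℚ.* (seq x n ℚ.- seq y n)} {λ n → E (seq x n) n ℚ.- E (seq y n) n}
    (zip (λ {n} → step n) (proj₂ (proj₂ (bounded x))) (proj₂ (proj₂ (bounded y))))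
    (null-* {λ _ → C} {λ n → seq x n ℚ.- seq y n} (C , 0<C , 0 , λ _ _ → ℚ.≤-reflexive (ℚ.0≤p⇒∣p∣≡p (ℚ.<⇒≤ 0<C))) x≈y)
    where
    B = proj₁ (bounded x)
    B′ = proj₁ (bounded y)
    0≤B : 0ℚ ℚ.≤ B
    0≤B = ℚ.<⇒≤ (proj₁ (proj₂ (bounded x)))
    0≤B′ : 0ℚ ℚ.≤ B′
    0≤B′ = ℚ.<⇒≤ (proj₁ (proj₂ (bounded y)))
    C = proj₁ (E-upper-bound (0≤B 0≤+ 0≤B′))
    0<C : 0ℚ ℚ.< C
    0<C = proj₁ (proj₂ (E-upper-bound (0≤B 0≤+ 0≤B′)))
    step : ∀ n → ℚ.∣ seq x n ∣ ℚ.≤ B → ℚ.∣ seq y n ∣ ℚ.≤ B′ →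
      ℚ.∣ E (seq x n) n ℚ.- E (seq y n) n ∣ ℚ.≤ ℚ.∣ C ℚ.* (seq x n ℚ.- seq y n) ∣
    step n x≤B y≤B′ = begin
      ℚ.∣ E (seq x n) n ℚ.- E (seq y n) n ∣
        ≤⟨ E-Lipschitz {b = B ℚ.+ B′}
             (ℚ.≤-trans x≤B (q-p≡r⇒p≤q (solve 2 (λ b c → b :+ c :- b := c) refl B B′) 0≤B′))
             (ℚ.≤-trans y≤B′ (q-p≡r⇒p≤q (solve 2 (λ b c → b :+ c :- c := b) refl B B′) 0≤B)) n ⟩
      ℚ.∣ seq x n ℚ.- seq y n ∣ ℚ.* E (B ℚ.+ B′) n
        ≤⟨ ℚ.*-monoˡ-≤-nonNeg ℚ.∣ seq x n ℚ.- seq y n ∣ {{ℚ.∣-∣-nonNeg (seq x n ℚ.- seq y n)}} (proj₂ (proj₂ (E-upper-bound (0≤B 0≤+ 0≤B′))) n) ⟩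
      ℚ.∣ seq x n ℚ.- seq y n ∣ ℚ.* C
        ≡⟨ ℚ.*-comm ℚ.∣ seq x n ℚ.- seq y n ∣ C ⟩
      C ℚ.* ℚ.∣ seq x n ℚ.- seq y n ∣
        ≡⟨ cong (ℚ._* ℚ.∣ seq x n ℚ.- seq y n ∣) (ℚ.0≤p⇒∣p∣≡p (ℚ.<⇒≤ 0<C)) ⟨
      ℚ.∣ C ∣ ℚ.* ℚ.∣ seq x n ℚ.- seq y n ∣
        ≡⟨ ℚ.∣p*q∣≡∣p∣*∣q∣ C (seq x n ℚ.- seq y n) ⟨
      ℚ.∣ C ℚ.* (seq x n ℚ.- seq y n) ∣ ∎

  Exp-+ : ∀ x y → Exp (x + y) ≈ Exp x * Exp y
  Exp-+ x y ε 0<ε = zip (λ {n} → step n) (eventually-≥ N)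
      (zip _,_ (proj₂ (proj₂ (bounded x))) (proj₂ (proj₂ (bounded y))))
    where
    B = proj₁ (bounded x)
    B′ = proj₁ (bounded y)
    0≤B+B′ : 0ℚ ℚ.≤ B ℚ.+ B′
    0≤B+B′ = ℚ.<⇒≤ (proj₁ (proj₂ (bounded x))) 0≤+ ℚ.<⇒≤ (proj₁ (proj₂ (bounded y)))
    tail = ∣E-E∣<ε 0≤B+B′ 0<ε
    N = proj₁ tail
    step : ∀ n → N ℕ.≤ n → ℚ.∣ seq x n ∣ ℚ.≤ B × ℚ.∣ seq y n ∣ ℚ.≤ B′ →
      ℚ.∣ E (seq x n ℚ.+ seq y n) n ℚ.- E (seq x n) n ℚ.* E (seq y n) n ∣ ℚ.< ε
    step n N≤n (x≤B , y≤B′) = begin-strict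
      ℚ.∣ E (seq x n ℚ.+ seq y n) n ℚ.- E (seq x n) n ℚ.* E (seq y n) n ∣
        ≡⟨ ∣p-q∣≡∣q-p∣ (E (seq x n ℚ.+ seq y n) n) (E (seq x n) n ℚ.* E (seq y n) n) ⟩
      ℚ.∣ E (seq x n) n ℚ.* E (seq y n) n ℚ.- E (seq x n ℚ.+ seq y n) n ∣
        ≤⟨ ∣E*E-E∣≤ x≤B y≤B′ n ⟩
      E (B ℚ.+ B′) (n ℕ.+ n) ℚ.- E (B ℚ.+ B′) n
        ≤⟨ p≤∣p∣ (E (B ℚ.+ B′) (n ℕ.+ n) ℚ.- E (B ℚ.+ B′) n) ⟩
      ℚ.∣ E (B ℚ.+ B′) (n ℕ.+ n) ℚ.- E (B ℚ.+ B′) n ∣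
        <⟨ proj₂ tail (ℚ.≤-reflexive (ℚ.0≤p⇒∣p∣≡p 0≤B+B′)) (n ℕ.+ n) n (ℕ.≤-trans N≤n (ℕ.m≤m+n n n)) N≤n ⟩
      ε ∎

  Exp-0 : Exp 0ℝ ≈ 1ℝ
  -- The index starts at 1 because the sum at index 0 is empty.
  Exp-0 ε 0<ε = 1 , λ { (suc n) _ → subst (λ p → ℚ.∣ p ℚ.- 1ℚ ∣ ℚ.< ε) (sym (E-zero n)) 0<ε }

  eventually-nonNeg : ∀ {h} → 0ℝ < h → Eventually λ n → 0ℚ ℚ.≤ seq h n
  eventually-nonNeg {h} (ε , 0<ε , ε≤h) = map (λ {n} ε≤h → ℚ.≤-trans (ℚ.≤-trans (ℚ.<⇒≤ 0<ε) (ℚ.≤-reflexive (sym (ℚ.+-identityˡ ε)))) ε≤h) ε≤h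

  Exp-lower : ∀ {h} → 0ℝ < h → 1ℝ + h + ½ℝ * (h * h) ≤ Exp h
  Exp-lower {h} 0<h = ≤-eventually {1ℝ + h + ½ℝ * (h * h)} {Exp h} (zip (λ {n} → step n) (eventually-≥ 3) (eventually-nonNeg {h} 0<h))
    where
    step : ∀ n → 3 ℕ.≤ n → 0ℚ ℚ.≤ seq h n → 1ℚ ℚ.+ seq h n ℚ.+ ½ ℚ.* (seq h n ℚ.* seq h n) ℚ.≤ E (seq h n) n
    step n 3≤n 0≤h = subst (λ k → 1ℚ ℚ.+ seq h n ℚ.+ ½ ℚ.* (seq h n ℚ.* seq h n) ℚ.≤ E (seq h n) k) (ℕ.m+[n∸m]≡n 3≤n) (1+h+½h²≤E 0≤h (n ℕ.∸ 3))

  Exp-upper : ∀ {h} → 0ℝ < h → (1ℝ + 1ℝ - h) * Exp h ≤ 1ℝ + 1ℝ + h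
  Exp-upper {h} 0<h = ≤-eventually {(1ℝ + 1ℝ - h) * Exp h} {1ℝ + 1ℝ + h} (zip (λ {n} → step n) (eventually-≥ 2) (eventually-nonNeg {h} 0<h))
    where
    bound : ∀ {p} → 0ℚ ℚ.≤ p → ∀ k → (1ℚ ℚ.+ 1ℚ ℚ.- p) ℚ.* E p (2 ℕ.+ k) ℚ.≤ 1ℚ ℚ.+ 1ℚ ℚ.+ p
    bound {p} 0≤p k = ℚ.≤-trans ([2-h]*E≤ 0≤p k)
      (q-p≡r⇒p≤q (solve 2 (λ a b → a :- (a :- b) := b) refl (1ℚ ℚ.+ 1ℚ ℚ.+ p) (p ℚ.* e p (suc k))) (0≤p 0≤* 0≤e 0≤p (suc k)))
    step : ∀ n → 2 ℕ.≤ n → 0ℚ ℚ.≤ seq h n → (1ℚ ℚ.+ 1ℚ ℚ.- seq h n) ℚ.* E (seq h n) n ℚ.≤ 1ℚ ℚ.+ 1ℚ ℚ.+ seq h n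
    step n 2≤n 0≤h = subst (λ k → (1ℚ ℚ.+ 1ℚ ℚ.- seq h n) ℚ.* E (seq h n) k ℚ.≤ 1ℚ ℚ.+ 1ℚ ℚ.+ seq h n) (ℕ.m+[n∸m]≡n 2≤n) (bound 0≤h (n ℕ.∸ 2))

  -- Strict order of reals demands a uniform rational gap: of the gap δ by which ε exceeds 0, one
  -- half bounds z and the other half remains as the gap.
  within : ∀ {ε z δ} → 0ℚ ℚ.< δ → Eventually (λ n → 0ℚ ℚ.+ δ ℚ.≤ seq ε n) →
    Eventually (λ n → ℚ.∣ seq z n ∣ ℚ.≤ ½ ℚ.* δ) → (- ε < z) × (z < ε)
  within {ε} {z} {δ} 0<δ δ≤ε z≤½δ =
    (½ ℚ.* δ , ½*-pos 0<δ , zip (λ {n} → lower n) δ≤ε z≤½δ) , (½ ℚ.* δ , ½*-pos 0<δ , zip (λ {n} → upper n) δ≤ε z≤½δ)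
    where
    lower : ∀ n → 0ℚ ℚ.+ δ ℚ.≤ seq ε n → ℚ.∣ seq z n ∣ ℚ.≤ ½ ℚ.* δ → ℚ.- seq ε n ℚ.+ ½ ℚ.* δ ℚ.≤ seq z n
    lower n δ≤ε z≤½δ = q-p≡r⇒p≤q (solve 4 (λ e d z a → z :- (:- e :+ con ½ :* d) := (z :- :- a) :+ (con ½ :* d :- a) :+ (e :- (con 0ℚ :+ d))) refl (seq ε n) δ (seq z n) ℚ.∣ seq z n ∣)
      (p≤q⇒0≤q-p (-∣p∣≤p (seq z n)) 0≤+ p≤q⇒0≤q-p z≤½δ 0≤+ p≤q⇒0≤q-p δ≤ε)
    upper : ∀ n → 0ℚ ℚ.+ δ ℚ.≤ seq ε n → ℚ.∣ seq z n ∣ ℚ.≤ ½ ℚ.* δ → seq z n ℚ.+ ½ ℚ.* δ ℚ.≤ seq ε n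
    upper n δ≤ε z≤½δ = q-p≡r⇒p≤q (solve 4 (λ e d z a → e :- (z :+ con ½ :* d) := (a :- z) :+ (con ½ :* d :- a) :+ (e :- (con 0ℚ :+ d))) refl (seq ε n) δ (seq z n) ℚ.∣ seq z n ∣)
      (p≤q⇒0≤q-p (p≤∣p∣ (seq z n)) 0≤+ p≤q⇒0≤q-p z≤½δ 0≤+ p≤q⇒0≤q-p δ≤ε)

  seq-sum : ∀ (f : ℕ → ℝ) n N → seq (sum {N} (f ∘ toℕ)) n ≡ ∑ (λ k → seq (f k) n) N
  seq-sum f n zero    = refl
  seq-sum f n (suc N) = cong (seq (f 0) n ℚ.+_) (seq-sum (f ∘ suc) n N)

  seq-term : ∀ x n k → seq (x ^ k) n ℚ.* (1ℤ ℚ./ (k !)) {{k ℕ.!≢0}} ≡ e (seq x n) k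
  seq-term x n zero    = refl
  seq-term x n (suc k) = trans
    (cong (seq x n ℚ.* seq (x ^ k) n ℚ.*_) (1/-* (suc k) (k !) {{_}} {{k ℕ.!≢0}} {{suc k ℕ.!≢0}}))
    (trans (solve 4 (λ x y r f → x :* y :* (r :* f) := x :* r :* (y :* f)) refl (seq x n) (seq (x ^ k) n) (1ℤ ℚ./ suc k) ((1ℤ ℚ./ (k !)) {{k ℕ.!≢0}}))
      (cong (seq x n ℚ.* (1ℤ ℚ./ suc k) ℚ.*_) (seq-term x n k)))

  seq-expSum : ∀ x N n → seq (expSum x N) n ≡ E (seq x n) N
  seq-expSum x N n = trans (seq-sum (λ k → x ^ k * fromℚ ((1ℤ ℚ./ (k !)) {{k ℕ.!≢0}})) n N) (∑-cong (seq-term x n) N)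

  <-eventually : ∀ {x y} → x < y → Eventually λ n → seq x n ℚ.< seq y n
  <-eventually {x} {y} (ε , 0<ε , x+ε≤y) = map (λ {n} → ℚ.<-≤-trans (q-p≡r⇒p<q (solve 2 (λ x e → x :+ e :- x := e) refl (seq x n) ε) 0<ε)) x+ε≤y

  ⟶-unique : ∀ {s l l′} → s ⟶ l → s ⟶ l′ → l ≈ l′
  ⟶-unique {s} {l} {l′} s⟶l s⟶l′ ε 0<ε = zip (λ {n} → close n)
    (zip _,_ (<-eventually { - η} {s k - l} (proj₁ near)) (<-eventually {s k - l} {η} (proj₂ near)))
    (zip _,_ (<-eventually { - η} {s k - l′} (proj₁ near′)) (<-eventually {s k - l′} {η} (proj₂ near′)))
    where
    η : ℝ
    η = fromℚ (½ ℚ.* ε)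
    0<η : 0ℝ < η
    0<η = fromℚ-mono-< (½*-pos 0<ε)
    N = proj₁ (s⟶l η 0<η)
    N′ = proj₁ (s⟶l′ η 0<η)
    k = N ℕ.⊔ N′
    near = proj₂ (s⟶l η 0<η) k (ℕ.m≤m⊔n N N′)
    near′ = proj₂ (s⟶l′ η 0<η) k (ℕ.m≤n⊔m N N′)
    close : ∀ n → ℚ.- (½ ℚ.* ε) ℚ.< seq (s k) n ℚ.- seq l n × seq (s k) n ℚ.- seq l n ℚ.< ½ ℚ.* ε →
      ℚ.- (½ ℚ.* ε) ℚ.< seq (s k) n ℚ.- seq l′ n × seq (s k) n ℚ.- seq l′ n ℚ.< ½ ℚ.* ε →
      ℚ.∣ seq l n ℚ.- seq l′ n ∣ ℚ.< ε
    close n (l-lower , l-upper) (l′-lower , l′-upper) = ∣p∣<q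
      (q-p≡r⇒p<q (solve 4 (λ s l m e → e :- (l :- m) := (s :- l :- :- (con ½ :* e)) :+ (con ½ :* e :- (s :- m))) refl (seq (s k) n) (seq l n) (seq l′ n) ε)
        (p<q⇒0<q-p l-lower 0<+ ℚ.<⇒≤ (p<q⇒0<q-p l′-upper)))
      (q-p≡r⇒p<q (solve 4 (λ s l m e → e :- :- (l :- m) := (s :- m :- :- (con ½ :* e)) :+ (con ½ :* e :- (s :- l))) refl (seq (s k) n) (seq l n) (seq l′ n) ε)
        (p<q⇒0<q-p l′-lower 0<+ ℚ.<⇒≤ (p<q⇒0<q-p l-upper)))

  -- The n-th term of the k-th partial sum is `E (seq x n) k`, against `E (seq x n) n` in the limit:
  -- same argument, different lengths, so the uniform tail estimate applies once k and n pass N.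
  expSum⟶Exp : ∀ x → expSum x ⟶ Exp x
  expSum⟶Exp x ε (δ , 0<δ , δ≤ε) = N , λ k N≤k → within {ε} {expSum x k - Exp x} 0<δ δ≤ε
    (zip (λ {n} → close k N≤k n) (eventually-≥ N) (proj₂ (proj₂ (bounded x))))
    where
    B = proj₁ (bounded x)
    uniform = ∣E-E∣<ε (ℚ.<⇒≤ (proj₁ (proj₂ (bounded x)))) (½*-pos 0<δ)
    N = proj₁ uniform
    close : ∀ k → N ℕ.≤ k → ∀ n → N ℕ.≤ n → ℚ.∣ seq x n ∣ ℚ.≤ B → ℚ.∣ seq (expSum x k) n ℚ.- E (seq x n) n ∣ ℚ.≤ ½ ℚ.* δ
    close k N≤k n N≤n x≤B = subst (λ p → ℚ.∣ p ℚ.- E (seq x n) n ∣ ℚ.≤ ½ ℚ.* δ) (sym (seq-expSum x k n))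
      (ℚ.<⇒≤ (proj₂ uniform x≤B k n N≤k N≤n))

  -- Existence of logarithms by a discrete intermediate value argument.

  crossing : ∀ (g : ℕ → ℚ) t → g 0 ℚ.≤ t → ∀ k → t ℚ.≤ g (suc k) → ∃ λ j → j ℕ.≤ k × g j ℚ.≤ t × t ℚ.≤ g (suc j)
  crossing g t g0≤t zero    t≤g1 = 0 , ℕ.z≤n , g0≤t , t≤g1
  crossing g t g0≤t (suc k) t≤gk with ℚ.≤-total t (g (suc k))
  ... | inj₂ g≤t = suc k , ℕ.≤-refl , g≤t , t≤gk
  ... | inj₁ t≤g with crossing g t g0≤t k t≤g
  ... | j , j≤k , g≤t , t≤g′ = j , ℕ.m≤n⇒m≤1+n j≤k , g≤t , t≤g′

  module LogApproximation (m : ℕ) {t δ : ℚ} (1≤t : 1ℚ ℚ.≤ t) (0<δ : 0ℚ ℚ.< δ) where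

    -- Two terms more than m, so that the constant and linear terms are always present.
    f : ℚ → ℚ
    f q = E q (2 ℕ.+ m)

    0≤t : 0ℚ ℚ.≤ t
    0≤t = ℚ.≤-trans 0≤1 1≤t

    C = proj₁ (E-upper-bound 0≤t)

    E≤C : ∀ n → E t n ℚ.≤ C
    E≤C = proj₂ (proj₂ (E-upper-bound 0≤t))

    -- The grid divides [0, t] into K + 1 steps, with K so large that C times the step length is
    -- below δ.
    fine = archimedean-* (t ℚ.* C) 0<δ
    K = proj₁ fine

    step : ℚ
    step = t ℚ.* (1ℤ ℚ./ suc K)

    0≤step : 0ℚ ℚ.≤ step
    0≤step = 0≤t 0≤* 0≤1/ K

    grid : ℕ → ℚ
    grid j = ι j ℚ.* step

    0≤grid : ∀ j → 0ℚ ℚ.≤ grid j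
    0≤grid j = 0≤ι j 0≤* 0≤step

    grid-end : grid (suc K) ≡ t
    grid-end = trans (solve 3 (λ c t r → c :* (t :* r) := t :* (c :* r)) refl (ι (suc K)) t (1ℤ ℚ./ suc K))
      (trans (cong (t ℚ.*_) (ι*1/ K)) (ℚ.*-identityʳ t))

    grid≤t : ∀ j → j ℕ.≤ suc K → grid j ℚ.≤ t
    grid≤t j j≤K+1 = subst (grid j ℚ.≤_) grid-end
      (ℚ.*-monoʳ-≤-nonNeg step {{ℚ.nonNegative 0≤step}} (ι-mono-≤ j (suc K) j≤K+1))

    -- The terms 1 + t of the sum already exceed t; thus f crosses the value t on [0, t].
    t≤f[t] : t ℚ.≤ f (grid (suc K))
    t≤f[t] = subst (λ q → t ℚ.≤ f q) (sym grid-end) (subst (t ℚ.≤_) (sym (E-expansion t m))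
      (q-p≡r⇒p≤q (solve 2 (λ t s → con 1ℚ :+ t :+ s :- t := con 1ℚ :+ s) refl t (∑ (λ k → e t (2 ℕ.+ k)) m))
        (0≤1 0≤+ 0≤∑ (λ k → 0≤e 0≤t (2 ℕ.+ k)) m)))

    f[0]≤t : f (grid 0) ℚ.≤ t
    f[0]≤t = ℚ.≤-trans (ℚ.≤-reflexive (trans (cong f (ℚ.*-zeroˡ step)) (E-zero (suc m)))) 1≤t

    cross = crossing (f ∘ grid) t f[0]≤t K t≤f[t]
    j = proj₁ cross

    log : ℚ
    log = grid j

    0≤log : 0ℚ ℚ.≤ log
    0≤log = 0≤grid j

    log≤t : log ℚ.≤ t
    log≤t = grid≤t j (ℕ.m≤n⇒m≤1+n (proj₁ (proj₂ cross)))

    ∣grid∣≤t : ∀ i → i ℕ.≤ suc K → ℚ.∣ grid i ∣ ℚ.≤ t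
    ∣grid∣≤t i i≤ = subst (ℚ._≤ t) (sym (ℚ.0≤p⇒∣p∣≡p (0≤grid i))) (grid≤t i i≤)

    -- The value t lies between f at two neighbouring grid points, which differ by at most the step
    -- length times the Lipschitz constant C.
    ∣f[log]-t∣<δ : ℚ.∣ f log ℚ.- t ∣ ℚ.< δ
    ∣f[log]-t∣<δ = begin-strict
      ℚ.∣ f log ℚ.- t ∣
        ≡⟨ trans (∣p-q∣≡∣q-p∣ (f log) t) (ℚ.0≤p⇒∣p∣≡p (p≤q⇒0≤q-p (proj₁ (proj₂ (proj₂ cross))))) ⟩
      t ℚ.- f log
        ≤⟨ ℚ.+-monoˡ-≤ (ℚ.- f log) (proj₂ (proj₂ (proj₂ cross))) ⟩
      f (grid (suc j)) ℚ.- f log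
        ≤⟨ p≤∣p∣ (f (grid (suc j)) ℚ.- f log) ⟩
      ℚ.∣ f (grid (suc j)) ℚ.- f log ∣
        ≤⟨ E-Lipschitz (∣grid∣≤t (suc j) (ℕ.s≤s (proj₁ (proj₂ cross)))) (∣grid∣≤t j (ℕ.m≤n⇒m≤1+n (proj₁ (proj₂ cross)))) (2 ℕ.+ m) ⟩
      ℚ.∣ grid (suc j) ℚ.- grid j ∣ ℚ.* E t (2 ℕ.+ m)
        ≡⟨ cong (λ d → ℚ.∣ d ∣ ℚ.* E t (2 ℕ.+ m)) (trans (cong (λ c → c ℚ.* step ℚ.- grid j) (ι-suc j)) (solve 2 (λ c s → (con 1ℚ :+ c) :* s :- c :* s := s) refl (ι j) step)) ⟩
      ℚ.∣ step ∣ ℚ.* E t (2 ℕ.+ m)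
        ≡⟨ cong (ℚ._* E t (2 ℕ.+ m)) (ℚ.0≤p⇒∣p∣≡p 0≤step) ⟩
      step ℚ.* E t (2 ℕ.+ m)
        ≤⟨ ℚ.*-monoˡ-≤-nonNeg step {{ℚ.nonNegative 0≤step}} (E≤C (2 ℕ.+ m)) ⟩
      t ℚ.* (1ℤ ℚ./ suc K) ℚ.* C
        ≡⟨ solve 3 (λ t r c → t :* r :* c := r :* (t :* c)) refl t (1ℤ ℚ./ suc K) C ⟩
      (1ℤ ℚ./ suc K) ℚ.* (t ℚ.* C)
        <⟨ ℚ.*-monoʳ-<-pos (1ℤ ℚ./ suc K) {{ℚ.positive (0<1/ K)}} (proj₂ fine) ⟩
      (1ℤ ℚ./ suc K) ℚ.* (ι (suc K) ℚ.* δ)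
        ≡⟨ solve 3 (λ r c d → r :* (c :* d) := (c :* r) :* d) refl (1ℤ ℚ./ suc K) (ι (suc K)) δ ⟩
      (ι (suc K) ℚ.* (1ℤ ℚ./ suc K)) ℚ.* δ
        ≡⟨ trans (cong (ℚ._* δ) (ι*1/ K)) (ℚ.*-identityˡ δ) ⟩
      δ ∎

  1/-null : ∀ ε → 0ℚ ℚ.< ε → Eventually λ n → 1ℤ ℚ./ suc n ℚ.< ε
  1/-null ε 0<ε = N , λ n N≤n → ℚ.*-cancelˡ-<-nonNeg (ι (suc n)) {{ℚ.nonNegative (0≤ι (suc n))}} {1ℤ ℚ./ suc n} {ε} (begin-strict
    ι (suc n) ℚ.* (1ℤ ℚ./ suc n)  ≡⟨ ι*1/ n ⟩
    1ℚ                            <⟨ proj₂ (archimedean-* 1ℚ 0<ε) ⟩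
    ι (suc N) ℚ.* ε               ≤⟨ ℚ.*-monoʳ-≤-nonNeg ε {{ℚ.nonNegative (ℚ.<⇒≤ 0<ε)}} (ι-mono-≤ (suc N) (suc n) (ℕ.s≤s N≤n)) ⟩
    ι (suc n) ℚ.* ε               ∎)
    where
    N = proj₁ (archimedean-* 1ℚ 0<ε)

  -- Turns closeness of exponentials into closeness of the approximate logarithms.
  ∣x-y∣≤∣E-E∣ : ∀ {x y} → 0ℚ ℚ.≤ x → 0ℚ ℚ.≤ y → ∀ n → ℚ.∣ x ℚ.- y ∣ ℚ.≤ ℚ.∣ E x (2 ℕ.+ n) ℚ.- E y (2 ℕ.+ n) ∣
  ∣x-y∣≤∣E-E∣ {x} {y} 0≤x 0≤y n = [ (λ x≤y → subst₂ ℚ._≤_ (∣p-q∣≡∣q-p∣ y x) (∣p-q∣≡∣q-p∣ (E y (2 ℕ.+ n)) (E x (2 ℕ.+ n))) (ordered 0≤x x≤y)) , ordered 0≤y ]′ (ℚ.≤-total x y)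
    where
    ordered : ∀ {x y} → 0ℚ ℚ.≤ x → x ℚ.≤ y → ℚ.∣ y ℚ.- x ∣ ℚ.≤ ℚ.∣ E y (2 ℕ.+ n) ℚ.- E x (2 ℕ.+ n) ∣
    ordered {x} {y} 0≤x x≤y = begin
      ℚ.∣ y ℚ.- x ∣                                   ≡⟨ ℚ.0≤p⇒∣p∣≡p (p≤q⇒0≤q-p x≤y) ⟩
      y ℚ.- x                                         ≤⟨ E-growth 0≤x x≤y n ⟩
      E y (2 ℕ.+ n) ℚ.- E x (2 ℕ.+ n)                 ≤⟨ p≤∣p∣ (E y (2 ℕ.+ n) ℚ.- E x (2 ℕ.+ n)) ⟩
      ℚ.∣ E y (2 ℕ.+ n) ℚ.- E x (2 ℕ.+ n) ∣           ∎

  module Logarithm (θ : ℝ) (1<θ : 1ℝ < θ) where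

    -- The grid search needs a target of at least 1; truncation provides it at every index and is
    -- eventually invisible because 1 < θ.
    t : ℕ → ℚ
    t n = seq θ n ℚ.⊔ 1ℚ

    module Approx (n : ℕ) = LogApproximation n (ℚ.p≤q⊔p (seq θ n) 1ℚ) (0<1/ n)

    y : ℕ → ℚ
    y n = Approx.log n

    t≡θ : Eventually λ n → t n ≡ seq θ n
    t≡θ = map (λ {n} 1<θ → ℚ.p≥q⇒p⊔q≡p (ℚ.<⇒≤ 1<θ)) (<-eventually {1ℝ} {θ} 1<θ)

    B = proj₁ (bounded θ)
    0≤B : 0ℚ ℚ.≤ B
    0≤B = ℚ.<⇒≤ (proj₁ (proj₂ (bounded θ)))

    y≤B : Eventually λ n → ℚ.∣ y n ∣ ℚ.≤ B
    y≤B = zip (λ {n} t≡θ θ≤B → ℚ.≤-trans (ℚ.≤-reflexive (ℚ.0≤p⇒∣p∣≡p (Approx.0≤log n)))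
                (ℚ.≤-trans (Approx.log≤t n) (ℚ.≤-trans (ℚ.≤-reflexive t≡θ) (ℚ.≤-trans (p≤∣p∣ (seq θ n)) θ≤B))))
              t≡θ (proj₂ (proj₂ (bounded θ)))

    error : ℕ → ℚ
    error n = E (y n) (2 ℕ.+ n) ℚ.- seq θ n

    error-null : Null error
    error-null ε 0<ε = zip (λ {n} → step n) t≡θ (1/-null ε 0<ε)
      where
      step : ∀ n → t n ≡ seq θ n → 1ℤ ℚ./ suc n ℚ.< ε → ℚ.∣ error n ∣ ℚ.< ε
      step n t≡θ 1/n<ε = ℚ.<-trans {ℚ.∣ error n ∣} {1ℤ ℚ./ suc n} {ε}
        (subst (λ q → ℚ.∣ E (y n) (2 ℕ.+ n) ℚ.- q ∣ ℚ.< 1ℤ ℚ./ suc n) t≡θ (Approx.∣f[log]-t∣<δ n)) 1/n<ε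

    -- Evaluating both exponentials with the same 2 + m terms bounds |y m - y n| by four quarters of
    -- ε: the search errors at m and at n, the change of θ, and the change of length at y n.
    y-cauchy : IsCauchy y
    y-cauchy ε 0<ε = N , λ m n N≤m N≤n → close m n (proj₂ good m N≤m) (proj₂ good n N≤n)
      where
      0<¼ε : 0ℚ ℚ.< ½ ℚ.* (½ ℚ.* ε)
      0<¼ε = ½*-pos (½*-pos 0<ε)
      ¼ε = ½ ℚ.* (½ ℚ.* ε)
      uniform = ∣E-E∣<ε 0≤B 0<¼ε
      tail = cauchy θ ¼ε 0<¼ε
      Good : ℕ → Set
      Good n = (ℚ.∣ error n ∣ ℚ.< ¼ε × proj₁ tail ℕ.≤ n) × (ℚ.∣ y n ∣ ℚ.≤ B × proj₁ uniform ℕ.≤ n)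
      good : Eventually Good
      good = zip _,_ (zip _,_ (error-null ¼ε 0<¼ε) (eventually-≥ (proj₁ tail))) (zip _,_ y≤B (eventually-≥ (proj₁ uniform)))
      N = proj₁ good
      close : ∀ m n → Good m → Good n → ℚ.∣ y m ℚ.- y n ∣ ℚ.< ε
      close m n ((em , θm) , (ym , um)) ((en , θn) , (yn , un)) = begin-strict
        ℚ.∣ y m ℚ.- y n ∣
          ≤⟨ ∣x-y∣≤∣E-E∣ (Approx.0≤log m) (Approx.0≤log n) m ⟩
        ℚ.∣ E (y m) (2 ℕ.+ m) ℚ.- E (y n) (2 ℕ.+ m) ∣
          ≡⟨ cong ℚ.∣_∣ (solve 5 (λ a b c p q → a :- b := (a :- p :+ (p :- q)) :+ (:- (c :- q) :+ (c :- b))) refl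
               (E (y m) (2 ℕ.+ m)) (E (y n) (2 ℕ.+ m)) (E (y n) (2 ℕ.+ n)) (seq θ m) (seq θ n)) ⟩
        ℚ.∣ (error m ℚ.+ Δθ) ℚ.+ (ℚ.- error n ℚ.+ ΔE) ∣
          ≤⟨ ℚ.∣p+q∣≤∣p∣+∣q∣ (error m ℚ.+ Δθ) (ℚ.- error n ℚ.+ ΔE) ⟩
        ℚ.∣ error m ℚ.+ Δθ ∣ ℚ.+ ℚ.∣ ℚ.- error n ℚ.+ ΔE ∣
          ≤⟨ ℚ.+-mono-≤ (ℚ.∣p+q∣≤∣p∣+∣q∣ (error m) Δθ) (ℚ.∣p+q∣≤∣p∣+∣q∣ (ℚ.- error n) ΔE) ⟩
        (ℚ.∣ error m ∣ ℚ.+ ℚ.∣ Δθ ∣) ℚ.+ (ℚ.∣ ℚ.- error n ∣ ℚ.+ ℚ.∣ ΔE ∣)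
          <⟨ ℚ.+-mono-< (ℚ.+-mono-< em (proj₂ tail m n θm θn))
               (ℚ.+-mono-< (subst (ℚ._< ¼ε) (sym (ℚ.∣-p∣≡∣p∣ (error n))) en)
                 (proj₂ uniform yn (2 ℕ.+ n) (2 ℕ.+ m) (ℕ.m≤n⇒m≤o+n 2 un) (ℕ.m≤n⇒m≤o+n 2 um))) ⟩
        (¼ε ℚ.+ ¼ε) ℚ.+ (¼ε ℚ.+ ¼ε)
          ≡⟨ cong₂ ℚ._+_ (halves (½ ℚ.* ε)) (halves (½ ℚ.* ε)) ⟩
        ½ ℚ.* ε ℚ.+ ½ ℚ.* ε
          ≡⟨ halves ε ⟩
        ε ∎
        where
        Δθ = seq θ m ℚ.- seq θ n
        ΔE = E (y n) (2 ℕ.+ n) ℚ.- E (y n) (2 ℕ.+ m)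

    log : ℝ
    log = mkℝ y y-cauchy

    -- `Exp` cuts the series at n, the search at n + 2; the uniform tail estimate absorbs the two
    -- extra terms.
    Exp-log : Exp log ≈ θ
    Exp-log = null-resp {λ n → (E (y n) n ℚ.- E (y n) (2 ℕ.+ n)) ℚ.+ error n} {λ n → E (y n) n ℚ.- seq θ n}
      (λ n → solve 3 (λ a b c → (a :- b) :+ (b :- c) := a :- c) refl (E (y n) n) (E (y n) (2 ℕ.+ n)) (seq θ n))
      (null-+ {λ n → E (y n) n ℚ.- E (y n) (2 ℕ.+ n)} {error}
        (λ ε 0<ε → zip (λ {n} yn un → proj₂ (∣E-E∣<ε 0≤B 0<ε) yn n (2 ℕ.+ n) un (ℕ.m≤n⇒m≤o+n 2 un)) y≤B (eventually-≥ (proj₁ (∣E-E∣<ε 0≤B 0<ε))))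
        error-null)

  exponentialField : ExcludedMiddle 0ℓ → ExponentialField
  exponentialField em = record
    { Carrier = ℝ ; _≈_ = _≈_ ; _+_ = _+_ ; _*_ = _*_ ; -_ = -_ ; κ = fromℚ
    ; isCommutativeRing = isCommutativeRing
    ; _<_       = _<_
    ; <-irrefl  = λ {x} {y} → <-irrefl {x} {y}
    ; <-trans   = λ {x} {y} {z} → <-trans {x} {y} {z}
    ; <-cmp     = <-cmp em
    ; <-respʳ-≈ = λ {x} {y} {z} → <-respʳ-≈ {x} {y} {z}
    ; <-respˡ-≈ = λ {x} {y} {z} → <-respˡ-≈ {x} {y} {z}
    ; +-monoˡ-< = λ z {x} {y} → +-monoˡ-< z {x} {y}
    ; *-pos     = λ {x} {y} → *-pos {x} {y}
    ; κ-+       = λ p q → pointwise {fromℚ (p ℚ.+ q)} {fromℚ p + fromℚ q} λ _ → refl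
    ; κ-*       = λ p q → pointwise {fromℚ (p ℚ.* q)} {fromℚ p * fromℚ q} λ _ → refl
    ; κ-neg     = λ p → pointwise {fromℚ (ℚ.- p)} { - fromℚ p} λ _ → refl
    ; κ-mono-<  = fromℚ-mono-<
    ; unbounded = unbounded
    ; inverse   = λ {x} → inverse {x}
    ; exp       = Exp
    ; exp-cong  = λ {x} {y} → Exp-cong {x} {y}
    ; exp-+     = Exp-+
    ; exp-0     = Exp-0
    ; exp-lower = λ {h} → Exp-lower {h}
    ; exp-upper = λ {h} → Exp-upper {h}
    }

-- Sets whose gaps tend to infinity have density 0.

module Density (em : ExcludedMiddle 0ℓ) (S : Pred ℕ 0ℓ)
  (gaps : ∀ d → ∃ λ N → ∀ n → N ℕ.≤ n → S n → ¬ S (suc d ℕ.+ n)) where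
  open ≡ using (refl; sym; trans; cong; cong₂; subst)
  open Classical em using (count; HasDensity)
  open ℕ.≤-Reasoning

  private
    c : ℕ → ℕ
    c = count S

    S? : ∀ n → Dec (S n)
    S? n = em {S n}

  c-suc : ∀ n → c (suc n) ≡ c n ℕ.+ length (filter S? List.[ suc n ])
  c-suc n = trans (cong (length ∘ filter S?) (sym (applyUpTo-∷ʳ suc n)))
    (trans (cong length (filter-++ S? (applyUpTo suc n) List.[ suc n ])) (length-++ (filter S? (applyUpTo suc n))))

  c-step : ∀ n → c (suc n) ≡ c n ⊎ (c (suc n) ≡ suc (c n) × S (suc n))
  c-step n with S? (suc n)
  ... | yes s = inj₂ (trans (c-suc n) (trans (cong (λ l → c n ℕ.+ length l) (filter-accept S? s)) (ℕ.+-comm (c n) 1)) , s)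
  ... | no ¬s = inj₁ (trans (c-suc n) (trans (cong (λ l → c n ℕ.+ length l) (filter-reject S? ¬s)) (ℕ.+-identityʳ (c n))))

  c≤ : ∀ n → c n ℕ.≤ n
  c≤ zero    = ℕ.z≤n
  c≤ (suc n) with c-step n
  ... | inj₁ eq       = ℕ.≤-trans (ℕ.≤-reflexive eq) (ℕ.m≤n⇒m≤1+n (c≤ n))
  ... | inj₂ (eq , _) = ℕ.≤-trans (ℕ.≤-reflexive eq) (ℕ.s≤s (c≤ n))

  -- The hypothesis supplies one threshold per distance; a window needs a single threshold for all
  -- distances up to D.
  gaps-below : ∀ D → ∃ λ N → ∀ n d → N ℕ.≤ n → d ℕ.< D → S n → ¬ S (suc d ℕ.+ n)
  gaps-below zero    = 0 , λ _ _ _ ()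
  gaps-below (suc D) = N₁ ℕ.⊔ N₂ , λ n d N≤n d<1+D → [_,_]′
    (λ d<D → proj₂ (gaps-below D) n d (ℕ.m⊔n≤o⇒m≤o N₁ N₂ N≤n) d<D)
    (λ { refl → proj₂ (gaps D) n (ℕ.m⊔n≤o⇒n≤o N₁ N₂ N≤n) })
    (ℕ.m<1+n⇒m<n∨m≡n d<1+D)
    where
    N₁ = proj₁ (gaps-below D)
    N₂ = proj₁ (gaps D)

  module _ (D : ℕ) where

    private
      N = proj₁ (gaps-below D)
      W = suc D

    -- The second alternative remembers the element d + 1 + M already met. A further element k + 1 +
    -- M would follow it at distance k - d ≤ D, which `gaps-below` excludes.
    window : ∀ M → N ℕ.≤ M → ∀ k → k ℕ.≤ W →
      c (k ℕ.+ M) ≡ c M ⊎ (c (k ℕ.+ M) ≡ suc (c M) × ∃ λ d → d ℕ.< k × S (suc d ℕ.+ M))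
    window M N≤M zero    _   = inj₁ refl
    window M N≤M (suc k) k<W with c-step (k ℕ.+ M) | window M N≤M k (ℕ.<⇒≤ k<W)
    ... | inj₁ eq       | inj₁ eq′                   = inj₁ (trans eq eq′)
    ... | inj₁ eq       | inj₂ (eq′ , d , d<k , s)   = inj₂ (trans eq eq′ , d , ℕ.m<n⇒m<1+n d<k , s)
    ... | inj₂ (eq , s) | inj₁ eq′                   = inj₂ (trans eq (cong suc eq′) , k , ℕ.n<1+n k , s)
    ... | inj₂ (_ , s)  | inj₂ (_ , d , d<k , s′)    = ⊥-elim
      (proj₂ (gaps-below D) (suc d ℕ.+ M) (k ℕ.∸ suc d) (ℕ.≤-trans N≤M (ℕ.m≤n+m M (suc d)))
        (ℕ.<-≤-trans (ℕ.∸-monoʳ-< {k} (ℕ.s≤s ℕ.z≤n) d<k) (ℕ.s≤s⁻¹ k<W)) s′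
        (subst S (sym shift) s))
      where
      shift : suc (k ℕ.∸ suc d) ℕ.+ (suc d ℕ.+ M) ≡ suc k ℕ.+ M
      shift = trans (sym (ℕ.+-assoc (suc (k ℕ.∸ suc d)) (suc d) M)) (cong (λ j → suc j ℕ.+ M) (ℕ.m∸n+n≡m d<k))

    c-window : ∀ M → N ℕ.≤ M → c (W ℕ.+ M) ℕ.≤ suc (c M)
    c-window M N≤M = [_,_]′ (λ eq → ℕ.≤-trans (ℕ.≤-reflexive eq) (ℕ.n≤1+n (c M))) (λ p → ℕ.≤-reflexive (proj₁ p)) (window M N≤M W ℕ.≤-refl)

    c-windows : ∀ M → N ℕ.≤ M → ∀ j → c (j ℕ.* W ℕ.+ M) ℕ.≤ j ℕ.+ c M
    c-windows M N≤M zero    = ℕ.≤-refl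
    c-windows M N≤M (suc j) = begin
      c (W ℕ.+ j ℕ.* W ℕ.+ M)   ≡⟨ cong c (ℕ.+-assoc W (j ℕ.* W) M) ⟩
      c (W ℕ.+ (j ℕ.* W ℕ.+ M)) ≤⟨ c-window (j ℕ.* W ℕ.+ M) (ℕ.≤-trans N≤M (ℕ.m≤n+m M (j ℕ.* W))) ⟩
      suc (c (j ℕ.* W ℕ.+ M))   ≤⟨ ℕ.s≤s (c-windows M N≤M j) ⟩
      suc j ℕ.+ c M             ∎

    -- Write n = q W + (r + N) with r < W. Each of the q windows adds at most one element and the
    -- initial segment at most W + N, so c n ≤ q + W + N; multiply by W and use q W ≤ n.
    sparse : ∃ λ K → ∀ n → W ℕ.* c n ℕ.≤ K ℕ.+ n
    sparse = W ℕ.* (W ℕ.+ N) , λ n → [_,_]′ (small n) (large n) (ℕ.≤-total n N)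
      where
      small : ∀ n → n ℕ.≤ N → W ℕ.* c n ℕ.≤ W ℕ.* (W ℕ.+ N) ℕ.+ n
      small n n≤N = ℕ.≤-trans (ℕ.*-monoʳ-≤ W (ℕ.≤-trans (c≤ n) (ℕ.≤-trans n≤N (ℕ.m≤n+m N W)))) (ℕ.m≤m+n (W ℕ.* (W ℕ.+ N)) n)
      large : ∀ n → N ℕ.≤ n → W ℕ.* c n ℕ.≤ W ℕ.* (W ℕ.+ N) ℕ.+ n
      large n N≤n = begin
        W ℕ.* c n                          ≡⟨ cong (λ i → W ℕ.* c i) n≡ ⟩
        W ℕ.* c (q ℕ.* W ℕ.+ (r ℕ.+ N))    ≤⟨ ℕ.*-monoʳ-≤ W (c-windows (r ℕ.+ N) (ℕ.m≤n+m N r) q) ⟩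
        W ℕ.* (q ℕ.+ c (r ℕ.+ N))          ≤⟨ ℕ.*-monoʳ-≤ W (ℕ.+-monoʳ-≤ q (ℕ.≤-trans (c≤ (r ℕ.+ N)) (ℕ.+-monoˡ-≤ N (ℕ.<⇒≤ (m%n<n (n ℕ.∸ N) W))))) ⟩
        W ℕ.* (q ℕ.+ (W ℕ.+ N))            ≡⟨ cong (W ℕ.*_) (ℕ.+-comm q (W ℕ.+ N)) ⟩
        W ℕ.* (W ℕ.+ N ℕ.+ q)              ≡⟨ ℕ.*-distribˡ-+ W (W ℕ.+ N) q ⟩
        W ℕ.* (W ℕ.+ N) ℕ.+ W ℕ.* q        ≡⟨ cong (W ℕ.* (W ℕ.+ N) ℕ.+_) (ℕ.*-comm W q) ⟩
        W ℕ.* (W ℕ.+ N) ℕ.+ q ℕ.* W        ≤⟨ ℕ.+-monoʳ-≤ (W ℕ.* (W ℕ.+ N)) (ℕ.≤-trans (ℕ.m≤m+n (q ℕ.* W) (r ℕ.+ N)) (ℕ.≤-reflexive (sym n≡))) ⟩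
        W ℕ.* (W ℕ.+ N) ℕ.+ n              ∎
        where
        q = (n ℕ.∸ N) ℕ./ W
        r = (n ℕ.∸ N) ℕ.% W
        n≡ : n ≡ q ℕ.* W ℕ.+ (r ℕ.+ N)
        n≡ = trans (sym (ℕ.m∸n+n≡m N≤n)) (trans (cong (ℕ._+ N) (trans (m≡m%n+[m/n]*n (n ℕ.∸ N) W) (ℕ.+-comm r (q ℕ.* W)))) (ℕ.+-assoc (q ℕ.* W) r N))

  -- For k ≥ K, `sparse` gives (D + 1) c(k + 1) ≤ K + (k + 1) ≤ 2(k + 1). The quotient is thus at
  -- most 2/(D + 1), and D is taken so that this is below δ/2.
  density-zero : HasDensity S 0ℝ
  density-zero ε (δ , 0<δ , δ≤ε) = K , λ k K≤k →
    within {ε} {fromℚ (ℤ.+ c (suc k) ℚ./ suc k) - 0ℝ} 0<δ δ≤ε (0 , λ _ _ → close k K≤k)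
    where
    open RationalOrder
    open RealExponential using (within)
    open +-*-Solver using (solve; con; _:+_; _:*_; _:-_; :-_; _:=_)
    wide : ∃ λ D → 1ℚ ℚ.+ 1ℚ ℚ.< ι (suc D) ℚ.* (½ ℚ.* δ)
    wide = archimedean-* (1ℚ ℚ.+ 1ℚ) (½*-pos 0<δ)
    D = proj₁ wide
    K = proj₁ (sparse D)
    close : ∀ k → K ℕ.≤ k → ℚ.∣ ℤ.+ c (suc k) ℚ./ suc k ℚ.- 0ℚ ∣ ℚ.≤ ½ ℚ.* δ
    close k K≤k = subst (ℚ._≤ ½ ℚ.* δ) (sym ∣∣≡) (ℚ.<⇒≤ (ℚ.*-cancelˡ-<-nonNeg (ι (suc D)) {{ℚ.nonNegative (0≤ι (suc D))}} {x} {½ ℚ.* δ} bound))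
      where
      r = 1ℤ ℚ./ suc k
      x = ι (c (suc k)) ℚ.* r
      ∣∣≡ : ℚ.∣ ℤ.+ c (suc k) ℚ./ suc k ℚ.- 0ℚ ∣ ≡ x
      ∣∣≡ = trans (cong ℚ.∣_∣ (trans (ℚ.+-identityʳ (ℤ.+ c (suc k) ℚ./ suc k)) (/≡/1*1/ (ℤ.+ c (suc k)) k)))
        (ℚ.0≤p⇒∣p∣≡p (0≤ι (c (suc k)) 0≤* 0≤1/ k))
      bound : ι (suc D) ℚ.* x ℚ.< ι (suc D) ℚ.* (½ ℚ.* δ)
      bound = R.begin-strict
        ι (suc D) ℚ.* (ι (c (suc k)) ℚ.* r)     R.≡⟨ ℚ.*-assoc (ι (suc D)) (ι (c (suc k))) r ⟨
        ι (suc D) ℚ.* ι (c (suc k)) ℚ.* r       R.≡⟨ cong (ℚ._* r) (/1-* (ℤ.+ suc D) (ℤ.+ c (suc k))) ⟨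
        (ℤ.+ suc D ℤ.* ℤ.+ c (suc k)) ℚ./ 1 ℚ.* r  R.≡⟨ cong (λ i → i ℚ./ 1 ℚ.* r) (sym (ℤ.pos-* (suc D) (c (suc k)))) ⟩
        ι (suc D ℕ.* c (suc k)) ℚ.* r           R.≤⟨ mono (suc D ℕ.* c (suc k)) (K ℕ.+ suc k) (proj₂ (sparse D) (suc k)) ⟩
        ι (K ℕ.+ suc k) ℚ.* r                   R.≤⟨ mono (K ℕ.+ suc k) (suc k ℕ.+ suc k) (ℕ.+-monoˡ-≤ (suc k) (ℕ.m≤n⇒m≤1+n K≤k)) ⟩
        ι (suc k ℕ.+ suc k) ℚ.* r               R.≡⟨ cong (ℚ._* r) (/1-+ (ℤ.+ suc k) (ℤ.+ suc k)) ⟩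
        (ι (suc k) ℚ.+ ι (suc k)) ℚ.* r         R.≡⟨ ℚ.*-distribʳ-+ r (ι (suc k)) (ι (suc k)) ⟩
        ι (suc k) ℚ.* r ℚ.+ ι (suc k) ℚ.* r     R.≡⟨ cong₂ ℚ._+_ (ι*1/ k) (ι*1/ k) ⟩
        1ℚ ℚ.+ 1ℚ                               R.<⟨ proj₂ wide ⟩
        ι (suc D) ℚ.* (½ ℚ.* δ)                 R.∎
        where
        module R = ℚ.≤-Reasoning
        mono : ∀ i j → i ℕ.≤ j → ι i ℚ.* r ℚ.≤ ι j ℚ.* r
        mono i j i≤j = ℚ.*-monoʳ-≤-nonNeg r {{ℚ.nonNegative (0≤1/ k)}} (ι-mono-≤ i j i≤j)

-- The abstract conclusions read in ℝ.

module RealFloors (em : ExcludedMiddle 0ℓ) where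
  open RealExponential using (Exp; exponentialField)
  private
    F : ExponentialField
    F = exponentialField em
    module FC = FloorComparison F

  floor-exists : ∀ x → ∃ λ k → fromℤ k ≤ x × x < fromℤ (k ℤ.+ 1ℤ)
  floor-exists = OrderedFieldProperties.floor-exists F

  -- Needed because `1ℝ ÷ x` unfolds to `1ℝ * x ⁻¹`.
  x*y≈1⇒x*[1*y]≈1 : ∀ x y → x * y ≈ 1ℝ → x * (1ℝ * y) ≈ 1ℝ
  x*y≈1⇒x*[1*y]≈1 x y = ExponentialField.trans F {x * (1ℝ * y)} {x * y} {1ℝ}
    (ExponentialField.*-congˡ F {x} {1ℝ * y} {y} (ExponentialField.*-identityˡ F y))

  module _ (θ L : ℝ) (1<θ : 1ℝ < θ) (eᴸ≈θ : Exp L ≈ θ) where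

    0<L : 0ℝ < L
    0<L = FC.0<L {θ} {L} 1<θ eᴸ≈θ

    root-exists : ∀ m → ∃ λ r → 0ℝ ≤ r × r ^ suc m ≈ θ
    root-exists = FC.root-exists {θ} {L} 1<θ eᴸ≈θ

    0<root-1 : ∀ m r → 0ℝ ≤ r × r ^ suc m ≈ θ → 0ℝ < r - 1ℝ
    0<root-1 m r (0≤r , r^≈θ) = FC.0<root-1 {θ} {L} 1<θ eᴸ≈θ m {r} 0≤r r^≈θ

    module _ (α : ℝ) (Lα≈1 : L * α ≈ 1ℝ) where

      FloorsDiffer : ℕ → Set
      FloorsDiffer m = ∃ λ r → ∃ λ w → ∃ λ i → ∃ λ j →
        (0ℝ ≤ r × r ^ suc m ≈ θ) × (r - 1ℝ) * w ≈ 1ℝ ×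
        (fromℤ i ≤ w × w < fromℤ (i ℤ.+ 1ℤ)) ×
        (fromℤ j ≤ fromℤ (ℤ.+ suc m) * α - ½ℝ × fromℤ (ℤ.+ suc m) * α - ½ℝ < fromℤ (j ℤ.+ 1ℤ)) × i ≢ j

      floors-differ-gaps : ∀ d → ∃ λ N → ∀ m → N ℕ.≤ m → FloorsDiffer m → ¬ FloorsDiffer (suc d ℕ.+ m)
      floors-differ-gaps = FC.floors-differ-gaps {θ} {L} 1<θ eᴸ≈θ {α} Lα≈1

-- Defining properties of the chosen values.

module Specifications (em : ExcludedMiddle 0ℓ) where
  open ≡ using (refl)
  open RealField using (≈-sym; ≈-trans; inverse)
  open RealExponential using (Exp; expSum⟶Exp; ⟶-unique; module Logarithm)
  open RealFloors em using (floor-exists; x*y≈1⇒x*[1*y]≈1)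

  -- With a, d and P explicit, instances hold syntactically; comparing
  -- P (choose d P) with P a by unfolding is infeasible.
  chosen : ∀ {A : Set} (a d : A) (P : A → Set) → a ≡ Classical.choose em d P → ∃ P → P a
  chosen a d P refl = Classical.choose-spec em d P

  -- The chosen value is some limit of the partial sums, `Exp x` is another, and limits are unique.
  exp≈Exp : ∀ x → Classical.exp em x ≈ Exp x
  exp≈Exp x = ⟶-unique {expSum x} {Classical.exp em x} {Exp x}
    (chosen (Classical.exp em x) 0ℝ (expSum x ⟶_) refl (Exp x , expSum⟶Exp x)) (expSum⟶Exp x)

  log-exists : ∀ θ → 1ℝ < θ → ∃ λ y → Classical.exp em y ≈ θ
  log-exists θ 1<θ = ℓ , ≈-trans {Classical.exp em ℓ} {Exp ℓ} {θ} (exp≈Exp ℓ) (Logarithm.Exp-log θ 1<θ)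
    where
    ℓ = Logarithm.log θ 1<θ

  Exp-log : ∀ θ → 1ℝ < θ → Exp (Classical.log em θ) ≈ θ
  Exp-log θ 1<θ = ≈-trans {Exp L} {Classical.exp em L} {θ} (≈-sym {Classical.exp em L} {Exp L} (exp≈Exp L))
    (chosen L 0ℝ (λ y → Classical.exp em y ≈ θ) refl (log-exists θ 1<θ))
    where
    L = Classical.log em θ

  ⁻¹-inverseʳ : ∀ x → 0ℝ < x → x * Classical._⁻¹ em x ≈ 1ℝ
  ⁻¹-inverseʳ x 0<x = chosen (Classical._⁻¹ em x) 0ℝ (λ y → x * y ≈ 1ℝ) refl (inverse {x} 0<x)

  ÷-inverseʳ : ∀ x → 0ℝ < x → x * Classical._÷_ em 1ℝ x ≈ 1ℝ
  ÷-inverseʳ x 0<x = x*y≈1⇒x*[1*y]≈1 x (Classical._⁻¹ em x) (⁻¹-inverseʳ x 0<x)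

  ⌊⌋-spec : ∀ x → fromℤ (Classical.⌊_⌋ em x) ≤ x × x < fromℤ (Classical.⌊_⌋ em x ℤ.+ 1ℤ)
  ⌊⌋-spec x = chosen (Classical.⌊_⌋ em x) 0ℤ (λ k → fromℤ k ≤ x × x < fromℤ (k ℤ.+ 1ℤ)) refl (floor-exists x)

  root-spec : ∀ n θ → (∃ λ y → 0ℝ ≤ y × y ^ n ≈ θ) → 0ℝ ≤ Classical.root em n θ × Classical.root em n θ ^ n ≈ θ
  root-spec n θ = chosen (Classical.root em n θ) 0ℝ (λ y → 0ℝ ≤ y × y ^ n ≈ θ) refl

-- Gaps of the exceptional set and its density.

module _ (em : ExcludedMiddle 0ℓ) (θ : ℝ) (1<θ : 1ℝ < θ) where
  open ≡ using (subst)
  open Specifications em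
  open RealFloors em using (FloorsDiffer; floors-differ-gaps; root-exists; 0<root-1; 0<L)
  open RealExponential using (Exp)

  private
    L : ℝ
    L = Classical.log em θ

    eᴸ≈θ : Exp L ≈ θ
    eᴸ≈θ = Exp-log θ 1<θ

    α : ℝ
    α = Classical._⁻¹ em L

    Lα≈1 : L * α ≈ 1ℝ
    Lα≈1 = ⁻¹-inverseʳ L (0<L θ L 1<θ eᴸ≈θ)

  -- `fromℤ n ÷ log θ` unfolds to `fromℤ n * α`, so the second floor in the definition of `𝒜` is
  -- literally that of v.
  𝒜⇒floors-differ : ∀ m → Classical.𝒜 em θ (suc m) → FloorsDiffer θ L 1<θ eᴸ≈θ α Lα≈1 m
  𝒜⇒floors-differ m (_ , M′≢) =
    r , Classical._÷_ em 1ℝ (r - 1ℝ) , Classical.M′ em θ (suc m) , Classical.⌊_⌋ em v ,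
    r-spec , ÷-inverseʳ (r - 1ℝ) (0<root-1 θ L 1<θ eᴸ≈θ m r r-spec) ,
    ⌊⌋-spec (Classical._÷_ em 1ℝ (r - 1ℝ)) , ⌊⌋-spec v , M′≢
    where
    r = Classical.root em (suc m) θ
    v = fromℤ (ℤ.+ suc m) * α - ½ℝ
    r-spec : 0ℝ ≤ r × r ^ suc m ≈ θ
    r-spec = root-spec (suc m) θ (root-exists θ L 1<θ eᴸ≈θ m)

  𝒜-gaps : ∀ d → ∃ λ N → ∀ n → N ℕ.≤ n → Classical.𝒜 em θ n → ¬ Classical.𝒜 em θ (suc d ℕ.+ n)
  -- The threshold is N + 1 because n = m + 1; it also rules out n = 0.
  𝒜-gaps d = suc N , λ { (suc m) (ℕ.s≤s N≤m) a a′ →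
    proj₂ gaps m N≤m (𝒜⇒floors-differ m a)
      (𝒜⇒floors-differ (suc d ℕ.+ m) (subst (Classical.𝒜 em θ) (ℕ.+-suc (suc d) m) a′)) }
    where
    gaps = floors-differ-gaps θ L 1<θ eᴸ≈θ α Lα≈1 d
    N = proj₁ gaps

theorem3 : (em : ExcludedMiddle 0ℓ) (θ : ℝ) → 1ℝ < θ → Classical.HasDensity em (Classical.𝒜 em θ) 0ℝ
theorem3 em θ 1<θ = Density.density-zero em (Classical.𝒜 em θ) (𝒜-gaps em θ 1<θ)
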